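{- Let $\alpha>0$ be an integer, let $p\ge 3$ be a prime, and let $r\ge 0$ be an integer that is a quadratic nonresidue modulo $p$. Then for every integer $n\ge 0$, $$v_0(2^{2\alpha+2}(pn+r))\equiv 0 \pmod{2^{3\alpha+2}}.$$
   Context: The integer sequence $v_0(n)$, $n\ge 0$, is defined by the generating function (formal power series in $q$) $$\sum_{n=0}^\infty v_0(n)q^n=\sum_{n=0}^\infty \frac{q^{n^2}(-q;q^2)_n}{(q;q^2)_n},$$ where $(a;q)_0=1$ and $(a;q)_n=\prod_{i=1}^n(1-aq^{i-1})$ for $n\ge1$, so that $(-q;q^2)_n=\prod_{i=1}^n(1+q^{2i-1})$ and $(q;q^2)_n=\prod_{i=1}^n(1-q^{2i-1})$. -}

module Defs where

open import Data.Integer using (ℤ; +_; 0ℤ; 1ℤ; _+_; _*_; _-_; -_)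
open import Data.Integer.Divisibility using (_∣_)
open import Data.Nat as ℕ using (ℕ; zero; suc; _∸_)
open import Data.Product using (∃-syntax)
open import Data.Vec using (Vec; []; _∷_; head)
open import Relation.Nullary using (¬_; yes; no)

-- ∑≤ n f = f 0 + f 1 + ⋯ + f n
∑≤ : ℕ → (ℕ → ℤ) → ℤ
∑≤ zero    f = f 0
∑≤ (suc n) f = ∑≤ n f + f (suc n)

-- Formal power series in q over ℤ: f n is the coefficient of qⁿ.
Series : Set
Series = ℕ → ℤ

infixl 6 _-ˢ_
infixl 7 _*ˢ_ _/ˢ_
infixr 8 _^ˢ_

1ˢ : Series
1ˢ zero    = 1ℤ
1ˢ (suc _) = 0ℤ

q^_ : ℕ → Series
(q^ k) n with n ℕ.≟ k
... | yes _ = 1ℤ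
... | no  _ = 0ℤ

negˢ : Series → Series
negˢ f n = - f n

_-ˢ_ : Series → Series → Series
(f -ˢ g) n = f n - g n

_*ˢ_ : Series → Series → Series
(f *ˢ g) n = ∑≤ n (λ i → f i * g (n ∸ i))

_^ˢ_ : Series → ℕ → Series
f ^ˢ zero  = 1ˢ
f ^ˢ suc n = f ^ˢ n *ˢ f

-- dot g (h₁ ∷ ⋯ ∷ hₖ ∷ []) = g 1 * h₁ + ⋯ + g k * hₖ
dot : ∀ {k} → Series → Vec ℤ k → ℤ
dot g []       = 0ℤ
dot g (h ∷ hs) = g 1 * h + dot (λ i → g (suc i)) hs

-- The coefficients n, n - 1, …, 0 (in this order) of f /ˢ g.
quotientCoeffs : Series → Series → (n : ℕ) → Vec ℤ (suc n)
quotientCoeffs f g zero    = f 0 ∷ []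
quotientCoeffs f g (suc n) = (f (suc n) - dot g hs) ∷ hs
  where hs = quotientCoeffs f g n

-- Division by a series g with constant term 1 (the value is meaningless for
-- other g): h = f /ˢ g is the series with h n = f n - ∑_{i=1}^{n} g i * h (n - i),
-- equivalently g *ˢ h = f.
_/ˢ_ : Series → Series → Series
(f /ˢ g) n = head (quotientCoeffs f g n)

-- poch a b n is the q-Pochhammer symbol (a; b)ₙ = ∏_{i=1}^{n} (1 - a bⁱ⁻¹).
poch : Series → Series → ℕ → Series
poch a b zero    = 1ˢ
poch a b (suc n) = poch a b n *ˢ (1ˢ -ˢ a *ˢ b ^ˢ n)

-- The infinite sum ∑_{n≥0} tₙ of a family in which tₙ has no terms of degree
-- below n, so that tₙ with n > N does not contribute to the coefficient of q^N.
∑∞ : (ℕ → Series) → Series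
∑∞ t N = ∑≤ N (λ n → t n N)

-- The summand has order n² ≥ n, and (q; q²)ₙ has constant term 1.
v₀ : ℕ → ℤ
v₀ = ∑∞ (λ n → (q^ (n ℕ.* n)) *ˢ poch (negˢ (q^ 1)) (q^ 2) n /ˢ poch (q^ 1) (q^ 2) n)

-- r ≡ 0 (mod p) is excluded as well, since then x = 0 solves x² ≡ r.
QuadraticNonresidue : ℕ → ℕ → Set
QuadraticNonresidue p r = ¬ (∃[ x ] (+ p) ∣ (x * x - + r))

{-# OPTIONS --safe #-}

-- Let φ(q) = ∑_{n ∈ ℤ} q^{n²}, and let U send ∑ c(n) qⁿ to ∑ c(4n) qⁿ.
--
-- The series of v₀ and the one obtained from it by q → -q combine to the bilateral sum
-- ∑_{n ∈ ℤ} q^{n²} (-q; q²)ₙ / (q; q²)ₙ. Expanding the products by Euler and summing over n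
-- first leaves Gauss's alternating sum of Gaussian binomials, so the bilateral sum is a
-- product. The same argument with a sign (-1)ⁿ gives the identities between φ and the
-- products that are needed to conclude 2 ∑ v₀(4n) qⁿ - 1 = φ(q)² / φ(-q).
--
-- Put Z = 1 - φ(-q)⁴ / φ(q)⁴, which is divisible by 16. Then U φ = φ,
-- U (φ(q)² / φ(-q)) = φ (1 + 4 Z / (1 - Z)), and U maps φ Z ℤ[Z, 1/(1 - Z)] to 8 times itself:
-- with y = (φ(q) - φ(q⁴)) / φ(q⁴) one has φ(q) = φ(q⁴) (1 + y) and
-- Z = 8 y (1 + y²) / (1 + y)⁴, and taking the even part twice replaces the odd series y first
-- by the odd series V with V(q²) = y² and then by Z, since Z(q²) = V². Hence
-- 2 v₀(4^{α+1} n) is, for n > 0, congruent to the coefficient of qⁿ in φ modulo 2^{3α+3}.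
-- That coefficient vanishes if n is not a square, and a square is never congruent to a
-- nonresidue.
module Submission where

open import Defs
open import Data.Nat using (ℕ; _+_; _*_; _^_; _<_; _≤_)
open import Data.Nat.Primality using (Prime)
open import Data.Integer using (+_)
open import Data.Integer.Divisibility using (_∣_)

open import Algebra.Bundles using (CommutativeRing)
import Algebra.Solver.Ring
open import Algebra.Solver.Ring.AlmostCommutativeRing
  using (AlmostCommutativeRing; fromCommutativeRing; _-Raw-AlmostCommutative⟶_)
open import Data.Integer as ℤ using (ℤ; 0ℤ; 1ℤ; -[1+_])
import Data.Integer.Properties as ℤₚ
import Data.Integer.Solver as ℤSolver
open import Data.Maybe using (Maybe; just; nothing)
open import Data.Nat as ℕ using (zero; suc; _∸_; z≤n; s≤s; ∣_-_∣)
import Data.Nat.Divisibility as ℕ∣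
open import Data.Nat.Induction using (<-rec)
import Data.Nat.Properties as ℕₚ
import Data.Nat.Solver as ℕSolver
open import Data.Product using (_×_; _,_; proj₁; proj₂; ∃-syntax)
open import Data.Sum using (_⊎_; inj₁; inj₂)
open import Data.Vec using (Vec; []; _∷_)
open import Level using (0ℓ)
open import Relation.Binary.PropositionalEquality
  using (_≡_; _≢_; refl; sym; trans; cong; cong₂; subst; module ≡-Reasoning)
open import Relation.Nullary using (yes; no; contradiction)

-- The term of index -n of the bilateral sum is (-1)ⁿ q^{n²} (q; q²)ₙ / (-q; q²)ₙ, the n-th summand
-- after q → -q. Both halves contain the index 0, whence the -1 next to 2 ∑ v₀(4n) qⁿ.
--
-- Multiplying by (-q; q²)_∞ (q; q²)_∞ removes every denominator and turns the n-th summand into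
-- q^{n²} (-q; q²)ₙ (-q; q²)_∞ times (q²ⁿ⁺¹; q²)_∞. Both factors have Euler expansions, with indices
-- j and i, and the resulting exponent is (n + i)² + (n - j)². By shifting n, its sum over n ∈ ℤ
-- depends only on i + j, so the coefficients (-1)ⁱ / ((q²; q²)ᵢ (q²; q²)ⱼ) can be collected along i
-- + j = k.
--
-- The contraction acts only on multiples of Z: the even part of y f is a multiple of V, that of V g
-- a multiple of Z, so the factor from which 8 is drawn is there again for the next round. Hence φ,
-- which U fixes, is split off before iterating. The modulus 2^{3α+3} is 4 · 8^{α - 1} · 16: 4 from
-- the first application of U, 8 from each further one, 16 from Z.

module ℕS = ℕSolver.+-*-Solver
module ℤS = ℤSolver.+-*-Solver

-- Finite sums of integers

∑-cong≤ : ∀ n {f g : ℕ → ℤ} → (∀ i → i ≤ n → f i ≡ g i) → ∑≤ n f ≡ ∑≤ n g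
∑-cong≤ zero    eq = eq 0 z≤n
∑-cong≤ (suc n) eq =
  cong₂ ℤ._+_ (∑-cong≤ n λ i i≤n → eq i (ℕₚ.m≤n⇒m≤1+n i≤n)) (eq (suc n) ℕₚ.≤-refl)

∑-cong : ∀ n {f g : ℕ → ℤ} → (∀ i → f i ≡ g i) → ∑≤ n f ≡ ∑≤ n g
∑-cong n eq = ∑-cong≤ n λ i _ → eq i

∑-+ : ∀ n (f g : ℕ → ℤ) → ∑≤ n (λ i → f i ℤ.+ g i) ≡ ∑≤ n f ℤ.+ ∑≤ n g
∑-+ zero    f g = refl
∑-+ (suc n) f g = trans (cong (ℤ._+ (f (suc n) ℤ.+ g (suc n))) (∑-+ n f g))
  (ℤS.solve 4 (λ a b c d → (a :+ b) :+ (c :+ d) := (a :+ c) :+ (b :+ d)) refl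
    (∑≤ n f) (∑≤ n g) (f (suc n)) (g (suc n)))
  where open ℤS using (_:+_; _:=_)

∑-*ˡ : ∀ n c (f : ℕ → ℤ) → ∑≤ n (λ i → c ℤ.* f i) ≡ c ℤ.* ∑≤ n f
∑-*ˡ zero    c f = refl
∑-*ˡ (suc n) c f = trans (cong (ℤ._+ (c ℤ.* f (suc n))) (∑-*ˡ n c f))
  (sym (ℤₚ.*-distribˡ-+ c (∑≤ n f) (f (suc n))))

∑-neg : ∀ n (f : ℕ → ℤ) → ∑≤ n (λ i → ℤ.- f i) ≡ ℤ.- ∑≤ n f
∑-neg zero    f = refl
∑-neg (suc n) f = trans (cong (ℤ._+ (ℤ.- f (suc n))) (∑-neg n f))
  (sym (ℤₚ.neg-distrib-+ (∑≤ n f) (f (suc n))))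

∑-0 : ∀ n {f : ℕ → ℤ} → (∀ i → i ≤ n → f i ≡ 0ℤ) → ∑≤ n f ≡ 0ℤ
∑-0 zero    eq = eq 0 z≤n
∑-0 (suc n) eq =
  cong₂ ℤ._+_ (∑-0 n λ i i≤n → eq i (ℕₚ.m≤n⇒m≤1+n i≤n)) (eq (suc n) ℕₚ.≤-refl)

∑-head : ∀ n (f : ℕ → ℤ) → ∑≤ (suc n) f ≡ f 0 ℤ.+ ∑≤ n (λ i → f (suc i))
∑-head zero    f = refl
∑-head (suc n) f = trans (cong (ℤ._+ f (suc (suc n))) (∑-head n f))
  (ℤₚ.+-assoc (f 0) (∑≤ n (λ i → f (suc i))) (f (suc (suc n))))

∑-swap : ∀ m n (f : ℕ → ℕ → ℤ) →
  ∑≤ m (λ i → ∑≤ n (λ j → f i j)) ≡ ∑≤ n (λ j → ∑≤ m (λ i → f i j))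
∑-swap zero    n f = refl
∑-swap (suc m) n f = trans (cong (ℤ._+ ∑≤ n (f (suc m))) (∑-swap m n f))
  (sym (∑-+ n (λ j → ∑≤ m (λ i → f i j)) (f (suc m))))

∑-extend : ∀ {m n} {f : ℕ → ℤ} → m ≤ n → (∀ i → m < i → f i ≡ 0ℤ) → ∑≤ n f ≡ ∑≤ m f
∑-extend {m} {n} {f} m≤n vanish = go n m≤n
  where
  go : ∀ n → m ≤ n → ∑≤ n f ≡ ∑≤ m f
  go n m≤n with ℕₚ.m≤n⇒m<n∨m≡n m≤n
  go (suc n) m≤n | inj₁ (s≤s m≤n′) =
    trans (cong₂ ℤ._+_ (go n m≤n′) (vanish (suc n) (s≤s m≤n′))) (ℤₚ.+-identityʳ _)
  go n m≤n | inj₂ refl = refl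

∑-triangle : ∀ n (f : ℕ → ℕ → ℤ) →
  ∑≤ n (λ i → ∑≤ (n ∸ i) (f i)) ≡ ∑≤ n (λ k → ∑≤ k (λ i → f i (k ∸ i)))
∑-triangle zero    f = refl
∑-triangle (suc n) f = begin
  ∑≤ n (λ i → ∑≤ (suc n ∸ i) (f i)) ℤ.+ ∑≤ (n ∸ n) (f (suc n))
    ≡⟨ cong₂ ℤ._+_ (∑-cong≤ n λ i i≤n →
         trans (cong (λ k → ∑≤ k (f i)) (ℕₚ.+-∸-assoc 1 i≤n))
               (cong (λ k → ∑≤ (n ∸ i) (f i) ℤ.+ f i k) (sym (ℕₚ.+-∸-assoc 1 i≤n))))
         (trans (cong (λ k → ∑≤ k (f (suc n))) (ℕₚ.n∸n≡0 n))
                (cong (f (suc n)) (sym (ℕₚ.n∸n≡0 n)))) ⟩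
  ∑≤ n (λ i → ∑≤ (n ∸ i) (f i) ℤ.+ f i (suc n ∸ i)) ℤ.+ f (suc n) (n ∸ n)
    ≡⟨ cong (ℤ._+ f (suc n) (n ∸ n))
         (∑-+ n (λ i → ∑≤ (n ∸ i) (f i)) (λ i → f i (suc n ∸ i))) ⟩
  ∑≤ n (λ i → ∑≤ (n ∸ i) (f i)) ℤ.+ ∑≤ n (λ i → f i (suc n ∸ i)) ℤ.+ f (suc n) (n ∸ n)
    ≡⟨ ℤₚ.+-assoc (∑≤ n (λ i → ∑≤ (n ∸ i) (f i))) _ _ ⟩
  ∑≤ n (λ i → ∑≤ (n ∸ i) (f i)) ℤ.+ ∑≤ (suc n) (λ i → f i (suc n ∸ i))
    ≡⟨ cong (ℤ._+ ∑≤ (suc n) (λ i → f i (suc n ∸ i))) (∑-triangle n f) ⟩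
  ∑≤ (suc n) (λ k → ∑≤ k (λ i → f i (k ∸ i))) ∎
  where open ≡-Reasoning

∑-even-odd : ∀ n (f : ℕ → ℤ) →
  ∑≤ (suc (n ℕ.* 2)) f ≡ ∑≤ n (λ i → f (i ℕ.* 2)) ℤ.+ ∑≤ n (λ i → f (suc (i ℕ.* 2)))
∑-even-odd zero    f = refl
∑-even-odd (suc n) f =
  trans (cong (λ s → s ℤ.+ f (suc n ℕ.* 2) ℤ.+ f (suc (suc n ℕ.* 2))) (∑-even-odd n f))
    (ℤS.solve 4 (λ a b c d → a :+ b :+ c :+ d := (a :+ c) :+ (b :+ d)) refl
      (∑≤ n (λ i → f (i ℕ.* 2))) (∑≤ n (λ i → f (suc (i ℕ.* 2))))
      (f (suc n ℕ.* 2)) (f (suc (suc n ℕ.* 2))))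
  where open ℤS using (_:+_; _:=_)

-- Arithmetic of the index and of the modulus

nonresidue⇒nonsquare : ∀ p r n → QuadraticNonresidue p r → ∀ j → p * n + r ≢ j * j
nonresidue⇒nonsquare p r n nonresidue j eq = nonresidue (+ j , ℕ∣.divides n (trans (cong ℤ.∣_∣ (begin
  + j ℤ.* + j ℤ.- + r         ≡⟨ cong (ℤ._- + r) (ℤₚ.pos-* j j) ⟨
  + (j * j) ℤ.- + r           ≡⟨ cong (λ m → + m ℤ.- + r) eq ⟨
  + (p * n + r) ℤ.- + r       ≡⟨ cong (ℤ._- + r) (ℤₚ.pos-+ (p * n) r) ⟩
  + (p * n) ℤ.+ + r ℤ.- + r   ≡⟨ ℤS.solve 2 (λ x y → x :+ y :- y := x) refl (+ (p * n)) (+ r) ⟩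
  + (p * n)                   ∎)) (ℕₚ.*-comm p n)))
  where
  open ≡-Reasoning
  open ℤS using (_:+_; _:-_; _:=_)

-- The left side is the index as iterated even parts produce it: 4 ^ α from `U^ α`, and one factor 2
-- each from `v-even` and `F`.
index-pow : ∀ N α → N * 4 ^ α * 2 * 2 ≡ 2 ^ (2 * α + 2) * N
index-pow N α = begin
  N * 4 ^ α * 2 * 2          ≡⟨ cong (λ x → N * x * 2 * 2) (ℕₚ.^-*-assoc 2 2 α) ⟩
  N * 2 ^ (2 * α) * 2 * 2    ≡⟨ ℕS.solve 2 (λ N x → N :* x :* con 2 :* con 2 := x :* con 4 :* N) refl N (2 ^ (2 * α)) ⟩
  2 ^ (2 * α) * 2 ^ 2 * N    ≡⟨ cong (_* N) (ℕₚ.^-distribˡ-+-* 2 (2 * α) 2) ⟨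
  2 ^ (2 * α + 2) * N        ∎
  where
  open ≡-Reasoning
  open ℕS using (_:*_; _:=_; con)

modulus-pow : ∀ k → 32 * 8 ^ k ≡ 2 ^ (3 * suc k + 2)
modulus-pow k = begin
  32 * 8 ^ k                     ≡⟨ cong (32 *_) (ℕₚ.^-*-assoc 2 3 k) ⟩
  2 ^ 5 * 2 ^ (3 * k)            ≡⟨ ℕₚ.^-distribˡ-+-* 2 5 (3 * k) ⟨
  2 ^ (5 + 3 * k)                ≡⟨ cong (2 ^_) (ℕS.solve 1 (λ k → con 5 :+ con 3 :* k := con 3 :* (con 1 :+ k) :+ con 2) refl k) ⟩
  2 ^ (3 * suc k + 2)            ∎
  where
  open ≡-Reasoning
  open ℕS using (_:+_; _:*_; _:=_; con)

double-cancel : ∀ x y → x ℤ.+ x ≡ y ℤ.+ y → x ≡ y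
double-cancel x y eq = ℤₚ.*-cancelˡ-≡ (+ 2) x y (trans (2* x) (trans eq (sym (2* y))))
  where
  2* : ∀ x → + 2 ℤ.* x ≡ x ℤ.+ x
  2* = ℤS.solve 1 (λ x → ℤS.con (+ 2) ℤS.:* x ℤS.:= x ℤS.:+ x) refl

-- The factor 4 · 8ᵏ comes from iterating `U` and 16 from `Z`. The product is displayed as a sum of
-- two equal halves because v₀ is only reached doubled.
32·8ᵏ : ∀ k X → + (4 * 8 ^ k) ℤ.* (+ 16 ℤ.* X) ≡ + (32 * 8 ^ k) ℤ.* X ℤ.+ + (32 * 8 ^ k) ℤ.* X
32·8ᵏ k X = begin
  + (4 * 8 ^ k) ℤ.* (+ 16 ℤ.* X)
    ≡⟨ cong (ℤ._* (+ 16 ℤ.* X)) (ℤₚ.pos-* 4 (8 ^ k)) ⟩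
  + 4 ℤ.* + (8 ^ k) ℤ.* (+ 16 ℤ.* X)
    ≡⟨ ℤS.solve 2 (λ e X → con (+ 4) :* e :* (con (+ 16) :* X) := con (+ 32) :* e :* X :+ con (+ 32) :* e :* X) refl (+ (8 ^ k)) X ⟩
  + 32 ℤ.* + (8 ^ k) ℤ.* X ℤ.+ + 32 ℤ.* + (8 ^ k) ℤ.* X
    ≡⟨ cong (λ e → e ℤ.* X ℤ.+ e ℤ.* X) (ℤₚ.pos-* 32 (8 ^ k)) ⟨
  + (32 * 8 ^ k) ℤ.* X ℤ.+ + (32 * 8 ^ k) ℤ.* X ∎
  where
  open ≡-Reasoning
  open ℤS using (_:*_; _:+_; _:=_; con)

-- The ring of power series

-- Series wrapped in a record without η, so that sums and products of series are
-- compared by their arguments instead of being unfolded to their coefficients.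
record PowerSeries : Set where
  no-eta-equality
  constructor ⟪_⟫
  infixl 9 _!_
  field _!_ : Series
open PowerSeries public

infix 4 _≈_
infixl 6 _+ₛ_ _-ₛ_
infixl 7 _*ₛ_

record _≈_ (f g : PowerSeries) : Set where
  constructor ptw
  field at : ∀ n → f ! n ≡ g ! n
open _≈_ public

0ₛ 1ₛ : PowerSeries
0ₛ ! _ = 0ℤ
1ₛ ! n = 1ˢ n

_+ₛ_ _*ₛ_ _-ₛ_ : PowerSeries → PowerSeries → PowerSeries
(f +ₛ g) ! n = f ! n ℤ.+ g ! n
(f *ₛ g) ! n = ((f !_) *ˢ (g !_)) n

neg tail : PowerSeries → PowerSeries
neg f ! n  = ℤ.- (f ! n)
tail f ! n = f ! suc n

f -ₛ g = f +ₛ neg g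

≈-refl : ∀ {f} → f ≈ f
≈-refl = ptw λ _ → refl

≈-sym : ∀ {f g} → f ≈ g → g ≈ f
≈-sym p = ptw λ n → sym (at p n)

≈-trans : ∀ {f g h} → f ≈ g → g ≈ h → f ≈ h
≈-trans p q = ptw λ n → trans (at p n) (at q n)

*-suc : ∀ f g n → (f *ₛ g) ! suc n ≡ f ! 0 ℤ.* g ! suc n ℤ.+ (tail f *ₛ g) ! n
*-suc f g n = ∑-head n (λ i → f ! i ℤ.* g ! (suc n ∸ i))

*-sucʳ : ∀ f g n → (f *ₛ g) ! suc n ≡ (f *ₛ tail g) ! n ℤ.+ f ! suc n ℤ.* g ! 0
*-sucʳ f g n = cong₂ ℤ._+_
  (∑-cong≤ n λ i i≤n → cong (λ k → f ! i ℤ.* g ! k) (ℕₚ.+-∸-assoc 1 i≤n))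
  (cong (λ k → f ! suc n ℤ.* g ! k) (ℕₚ.n∸n≡0 n))

*-cong≤ : ∀ f f′ g g′ n → (∀ i → i ≤ n → f ! i ≡ f′ ! i) → (∀ i → i ≤ n → g ! i ≡ g′ ! i) →
  (f *ₛ g) ! n ≡ (f′ *ₛ g′) ! n
*-cong≤ f f′ g g′ n p q =
  ∑-cong≤ n λ i i≤n → cong₂ ℤ._*_ (p i i≤n) (q (n ∸ i) (ℕₚ.m∸n≤m n i))

*ₛ-cong : ∀ {f f′ g g′} → f ≈ f′ → g ≈ g′ → f *ₛ g ≈ f′ *ₛ g′
*ₛ-cong {f} {f′} {g} {g′} p q = ptw λ n → *-cong≤ f f′ g g′ n (λ i _ → at p i) (λ i _ → at q i)

*ₛ-comm : ∀ f g → f *ₛ g ≈ g *ₛ f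
*ₛ-comm f g = ptw (go f g)
  where
  go : ∀ f g n → (f *ₛ g) ! n ≡ (g *ₛ f) ! n
  go f g zero    = ℤₚ.*-comm (f ! 0) (g ! 0)
  go f g (suc n) = begin
    (f *ₛ g) ! suc n                              ≡⟨ *-suc f g n ⟩
    f ! 0 ℤ.* g ! suc n ℤ.+ (tail f *ₛ g) ! n     ≡⟨ cong₂ ℤ._+_ (ℤₚ.*-comm (f ! 0) (g ! suc n)) (go (tail f) g n) ⟩
    g ! suc n ℤ.* f ! 0 ℤ.+ (g *ₛ tail f) ! n     ≡⟨ ℤₚ.+-comm (g ! suc n ℤ.* f ! 0) _ ⟩
    (g *ₛ tail f) ! n ℤ.+ g ! suc n ℤ.* f ! 0     ≡⟨ *-sucʳ g f n ⟨
    (g *ₛ f) ! suc n                              ∎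
    where open ≡-Reasoning

*ₛ-distribʳ : ∀ h f g → (f +ₛ g) *ₛ h ≈ f *ₛ h +ₛ g *ₛ h
*ₛ-distribʳ h f g = ptw λ n →
  trans (∑-cong n λ i → ℤₚ.*-distribʳ-+ (h ! (n ∸ i)) (f ! i) (g ! i))
        (∑-+ n (λ i → f ! i ℤ.* h ! (n ∸ i)) (λ i → g ! i ℤ.* h ! (n ∸ i)))

*ₛ-distribˡ : ∀ h f g → h *ₛ (f +ₛ g) ≈ h *ₛ f +ₛ h *ₛ g
*ₛ-distribˡ h f g = ptw λ n →
  trans (∑-cong n λ i → ℤₚ.*-distribˡ-+ (h ! i) (f ! (n ∸ i)) (g ! (n ∸ i)))
        (∑-+ n (λ i → h ! i ℤ.* f ! (n ∸ i)) (λ i → h ! i ℤ.* g ! (n ∸ i)))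

scale : ℤ → PowerSeries → PowerSeries
scale c f ! n = c ℤ.* f ! n

scale-* : ∀ c f g n → (scale c f *ₛ g) ! n ≡ c ℤ.* (f *ₛ g) ! n
scale-* c f g n = trans (∑-cong n λ i → ℤₚ.*-assoc c (f ! i) (g ! (n ∸ i)))
  (∑-*ˡ n c (λ i → f ! i ℤ.* g ! (n ∸ i)))

*ₛ-assoc : ∀ f g h → (f *ₛ g) *ₛ h ≈ f *ₛ (g *ₛ h)
*ₛ-assoc f g h = ptw (go f)
  where
  go : ∀ f n → ((f *ₛ g) *ₛ h) ! n ≡ (f *ₛ (g *ₛ h)) ! n
  go f zero    = ℤₚ.*-assoc (f ! 0) (g ! 0) (h ! 0)
  go f (suc n) = begin
    ((f *ₛ g) *ₛ h) ! suc n
      ≡⟨ *-suc (f *ₛ g) h n ⟩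
    f ! 0 ℤ.* g ! 0 ℤ.* h ! suc n ℤ.+ (tail (f *ₛ g) *ₛ h) ! n
      ≡⟨ cong (λ s → f ! 0 ℤ.* g ! 0 ℤ.* h ! suc n ℤ.+ s)
           (trans (at (*ₛ-cong {tail (f *ₛ g)} {scale (f ! 0) (tail g) +ₛ tail f *ₛ g}
                    (ptw (*-suc f g)) (≈-refl {h})) n)
           (trans (at (*ₛ-distribʳ h (scale (f ! 0) (tail g)) (tail f *ₛ g)) n)
             (cong₂ ℤ._+_ (scale-* (f ! 0) (tail g) h n) (go (tail f) n)))) ⟩
    f ! 0 ℤ.* g ! 0 ℤ.* h ! suc n ℤ.+ (f ! 0 ℤ.* (tail g *ₛ h) ! n ℤ.+ (tail f *ₛ (g *ₛ h)) ! n)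
      ≡⟨ ℤS.solve 5 (λ a b c d e → a :* b :* c :+ (a :* d :+ e) := a :* (b :* c :+ d) :+ e) refl
           (f ! 0) (g ! 0) (h ! suc n) ((tail g *ₛ h) ! n) ((tail f *ₛ (g *ₛ h)) ! n) ⟩
    f ! 0 ℤ.* (g ! 0 ℤ.* h ! suc n ℤ.+ (tail g *ₛ h) ! n) ℤ.+ (tail f *ₛ (g *ₛ h)) ! n
      ≡⟨ cong (λ s → f ! 0 ℤ.* s ℤ.+ (tail f *ₛ (g *ₛ h)) ! n) (*-suc g h n) ⟨
    f ! 0 ℤ.* (g *ₛ h) ! suc n ℤ.+ (tail f *ₛ (g *ₛ h)) ! n
      ≡⟨ *-suc f (g *ₛ h) n ⟨
    (f *ₛ (g *ₛ h)) ! suc n ∎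
    where
    open ≡-Reasoning
    open ℤS using (_:+_; _:*_; _:=_)

*ₛ-identityˡ : ∀ f → 1ₛ *ₛ f ≈ f
*ₛ-identityˡ f = ptw λ where
  zero    → ℤₚ.*-identityˡ (f ! 0)
  (suc n) → trans (*-suc 1ₛ f n) (trans
    (cong₂ ℤ._+_ (ℤₚ.*-identityˡ (f ! suc n)) (∑-0 n λ _ _ → refl))
    (ℤₚ.+-identityʳ _))

*ₛ-identityʳ : ∀ f → f *ₛ 1ₛ ≈ f
*ₛ-identityʳ f = ≈-trans (*ₛ-comm f 1ₛ) (*ₛ-identityˡ f)

seriesRing : CommutativeRing 0ℓ 0ℓ
seriesRing = record
  { Carrier = PowerSeries ; _≈_ = _≈_ ; _+_ = _+ₛ_ ; _*_ = _*ₛ_ ; -_ = neg ; 0# = 0ₛ ; 1# = 1ₛ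
  ; isCommutativeRing = record
    { isRing = record
      { +-isAbelianGroup = record
        { isGroup = record
          { isMonoid = record
            { isSemigroup = record
              { isMagma = record
                { isEquivalence = record { refl = ≈-refl ; sym = ≈-sym ; trans = ≈-trans }
                ; ∙-cong = λ p q → ptw λ n → cong₂ ℤ._+_ (at p n) (at q n) }
              ; assoc = λ f g h → ptw λ n → ℤₚ.+-assoc (f ! n) (g ! n) (h ! n) }
            ; identity = (λ f → ptw λ n → ℤₚ.+-identityˡ (f ! n)) , (λ f → ptw λ n → ℤₚ.+-identityʳ (f ! n)) }
          ; inverse = (λ f → ptw λ n → ℤₚ.+-inverseˡ (f ! n)) , (λ f → ptw λ n → ℤₚ.+-inverseʳ (f ! n))
          ; ⁻¹-cong = λ p → ptw λ n → cong ℤ.-_ (at p n) }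
        ; comm = λ f g → ptw λ n → ℤₚ.+-comm (f ! n) (g ! n) }
      ; *-cong = *ₛ-cong
      ; *-assoc = *ₛ-assoc
      ; *-identity = *ₛ-identityˡ , *ₛ-identityʳ
      ; distrib = *ₛ-distribˡ , *ₛ-distribʳ }
    ; *-comm = *ₛ-comm } }

open CommutativeRing seriesRing using () renaming
  (+-cong to +ₛ-cong; -‿cong to neg-cong; setoid to seriesSetoid; +-congˡ to +ₛ-congˡ;
   +-congʳ to +ₛ-congʳ; *-congˡ to *ₛ-congˡ; *-congʳ to *ₛ-congʳ; +-identityʳ to +ₛ-identityʳ;
   +-identityˡ to +ₛ-identityˡ; zeroʳ to *ₛ-zeroʳ)

const : ℤ → PowerSeries
const c ! zero  = c
const c ! suc _ = 0ℤ

-- Agrees with const, but represents 0 and 1 by the constants 0ₛ and 1ₛ, as the ring solver needs.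
int : ℤ → PowerSeries
int (+ 0) = 0ₛ
int (+ 1) = 1ₛ
int c     = const c

int≈const : ∀ c → int c ≈ const c
int≈const (+ 0)           = ptw λ { zero → refl ; (suc _) → refl }
int≈const (+ 1)           = ptw λ { zero → refl ; (suc _) → refl }
int≈const (+ suc (suc _)) = ≈-refl
int≈const -[1+ _ ]        = ≈-refl

const-* : ∀ c f n → (const c *ₛ f) ! n ≡ c ℤ.* f ! n
const-* c f zero    = refl
const-* c f (suc n) = trans (*-suc (const c) f n) (trans
  (cong (λ s → c ℤ.* f ! suc n ℤ.+ s) (∑-0 n λ _ _ → refl)) (ℤₚ.+-identityʳ _))

int-* : ∀ c f n → (int c *ₛ f) ! n ≡ c ℤ.* f ! n
int-* c f n = trans (at (*ₛ-congʳ {f} (int≈const c)) n) (const-* c f n)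

private
  seriesACR : AlmostCommutativeRing 0ℓ 0ℓ
  seriesACR = fromCommutativeRing seriesRing

  int-homo : CommutativeRing.rawRing ℤₚ.+-*-commutativeRing -Raw-AlmostCommutative⟶ seriesACR
  int-homo = record
    { ⟦_⟧ = int
    ; +-homo = λ c d → ≈-trans (int≈const (c ℤ.+ d)) (≈-trans
        (ptw λ { zero → refl ; (suc _) → refl })
        (≈-sym (+ₛ-cong (int≈const c) (int≈const d))))
    ; *-homo = λ c d → ≈-trans (int≈const (c ℤ.* d)) (≈-trans
        (ptw λ { zero → refl ; (suc n) → sym (trans (const-* c (const d) (suc n)) (ℤₚ.*-zeroʳ c)) })
        (≈-sym (*ₛ-cong (int≈const c) (int≈const d))))
    ; -‿homo = λ c → ≈-trans (int≈const (ℤ.- c)) (≈-trans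
        (ptw λ { zero → refl ; (suc _) → refl })
        (≈-sym (neg-cong (int≈const c))))
    ; 0-homo = ≈-refl
    ; 1-homo = ≈-refl }

  int-≟ : ∀ c d → Maybe (int c ≈ int d)
  int-≟ c d with c ℤ.≟ d
  ... | yes refl = just ≈-refl
  ... | no  _    = nothing

module RS = Algebra.Solver.Ring (CommutativeRing.rawRing ℤₚ.+-*-commutativeRing) seriesACR int-homo int-≟

open import Relation.Binary.Reasoning.Setoid seriesSetoid

-- Orders and powers of q

Ord : ℕ → PowerSeries → Set
Ord k f = ∀ n → n < k → f ! n ≡ 0ℤ

Ord-≤ : ∀ {k l f} → k ≤ l → Ord l f → Ord k f
Ord-≤ k≤l o n n<k = o n (ℕₚ.<-≤-trans n<k k≤l)

Ord-≈ : ∀ {k f g} → f ≈ g → Ord k f → Ord k g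
Ord-≈ p o n n<k = trans (sym (at p n)) (o n n<k)

Ord-* : ∀ {k l} f g → Ord k f → Ord l g → Ord (k ℕ.+ l) (f *ₛ g)
Ord-* {k} {l} f g of og n n<k+l = ∑-0 n λ i i≤n → term i i≤n
  where
  term : ∀ i → i ≤ n → f ! i ℤ.* g ! (n ∸ i) ≡ 0ℤ
  term i i≤n with i ℕ.<? k
  ... | yes i<k = cong (ℤ._* (g ! (n ∸ i))) (of i i<k)
  ... | no  i≮k = trans (cong (f ! i ℤ.*_) (og (n ∸ i) n∸i<l)) (ℤₚ.*-zeroʳ (f ! i))
    where
    n∸i<l : n ∸ i < l
    n∸i<l = ℕₚ.+-cancelˡ-< i (n ∸ i) l (ℕₚ.≤-<-trans (ℕₚ.≤-reflexive (ℕₚ.m+[n∸m]≡n i≤n))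
      (ℕₚ.<-≤-trans n<k+l (ℕₚ.+-monoˡ-≤ l (ℕₚ.≮⇒≥ i≮k))))

Ord-*ˡ : ∀ {k} f g → Ord k f → Ord k (f *ₛ g)
Ord-*ˡ {k} f g o = Ord-≤ {f = f *ₛ g} (ℕₚ.≤-reflexive (sym (ℕₚ.+-identityʳ k))) (Ord-* {l = 0} f g o (λ _ ()))

Ord-*ʳ : ∀ {k} f g → Ord k g → Ord k (f *ₛ g)
Ord-*ʳ f g o = Ord-* {k = 0} f g (λ _ ()) o

Ord-+ : ∀ {k f g} → Ord k f → Ord k g → Ord k (f +ₛ g)
Ord-+ of og n n<k = cong₂ ℤ._+_ (of n n<k) (og n n<k)

q↑_ : ℕ → PowerSeries
(q↑ k) ! n = (q^ k) n

qᵏ-self : ∀ k → (q↑ k) ! k ≡ 1ℤ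
qᵏ-self k with k ℕ.≟ k
... | yes _   = refl
... | no  k≢k = contradiction refl k≢k

qᵏ-other : ∀ {k n} → n ≢ k → (q↑ k) ! n ≡ 0ℤ
qᵏ-other {k} {n} n≢k with n ℕ.≟ k
... | yes n≡k = contradiction n≡k n≢k
... | no  _   = refl

Ord-qᵏ : ∀ k → Ord k (q↑ k)
Ord-qᵏ k n n<k = qᵏ-other (ℕₚ.<⇒≢ n<k)

q⁰≈1 : q↑ 0 ≈ 1ₛ
q⁰≈1 = ptw λ { zero → refl ; (suc n) → refl }

tail-qᵏ : ∀ k → tail (q↑ suc k) ≈ q↑ k
tail-qᵏ k = ptw λ n → go n
  where
  go : ∀ n → (q↑ suc k) ! suc n ≡ (q↑ k) ! n
  go n with n ℕ.≟ k
  ... | yes refl = qᵏ-self (suc k)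
  ... | no  n≢k  = qᵏ-other λ eq → n≢k (ℕₚ.suc-injective eq)

qᵏ-suc-* : ∀ k f n → (q↑ suc k *ₛ f) ! suc n ≡ (q↑ k *ₛ f) ! n
qᵏ-suc-* k f n = trans (*-suc (q↑ suc k) f n)
  (trans (ℤₚ.+-identityˡ _) (at (*ₛ-congʳ {f} (tail-qᵏ k)) n))

qᵏ-+-* : ∀ k f n → (q↑ k *ₛ f) ! (k ℕ.+ n) ≡ f ! n
qᵏ-+-* zero    f n = at (≈-trans (*ₛ-congʳ q⁰≈1) (*ₛ-identityˡ f)) n
qᵏ-+-* (suc k) f n = trans (qᵏ-suc-* k f (k ℕ.+ n)) (qᵏ-+-* k f n)

qᵏ-+ : ∀ k l → q↑ (k ℕ.+ l) ≈ q↑ k *ₛ q↑ l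
qᵏ-+ zero    l = ≈-sym (≈-trans (*ₛ-congʳ q⁰≈1) (*ₛ-identityˡ (q↑ l)))
qᵏ-+ (suc k) l = ptw λ where
  zero    → refl
  (suc n) → trans (at (tail-qᵏ (k ℕ.+ l)) n)
    (trans (at (qᵏ-+ k l) n) (sym (qᵏ-suc-* k (q↑ l) n)))

qᵏ-cong : ∀ {k l} → k ≡ l → q↑ k ≈ q↑ l
qᵏ-cong refl = ≈-refl

qᵏ*qˡ : ∀ {k l m} → k ℕ.+ l ≡ m → q↑ k *ₛ q↑ l ≈ q↑ m
qᵏ*qˡ {k} {l} refl = ≈-sym (qᵏ-+ k l)

-- Inverses

-- The offset `i` makes the induction go through: `dot` advances the index of `g` by one with each
-- entry of the vector.
quotient-tail : ∀ (f g : Series) n i → (hs : Vec ℤ (suc n)) → hs ≡ quotientCoeffs f g n →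
  dot (λ k → g (i ℕ.+ k)) hs ≡ ∑≤ n (λ k → g (i ℕ.+ suc k) ℤ.* (f /ˢ g) (n ∸ k))
quotient-tail f g zero    i _ refl = ℤₚ.+-identityʳ _
quotient-tail f g (suc n) i _ refl = trans
  (cong (λ s → g (i ℕ.+ 1) ℤ.* (f /ˢ g) (suc n) ℤ.+ s)
    (trans (dot-cong (quotientCoeffs f g n) λ k → cong g (ℕₚ.+-suc i k))
           (trans (quotient-tail f g n (suc i) _ refl)
                  (∑-cong n λ k → cong (λ l → g l ℤ.* (f /ˢ g) (n ∸ k)) (sym (ℕₚ.+-suc i (suc k)))))))
  (sym (∑-head n (λ k → g (i ℕ.+ suc k) ℤ.* (f /ˢ g) (suc n ∸ k))))
  where
  dot-cong : ∀ {m} {g g′ : Series} (hs : Vec ℤ m) → (∀ k → g k ≡ g′ k) → dot g hs ≡ dot g′ hs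
  dot-cong []       eq = refl
  dot-cong (h ∷ hs) eq = cong₂ ℤ._+_ (cong (ℤ._* h) (eq 1)) (dot-cong hs λ k → eq (suc k))

infixl 7 _/ₛ_

_/ₛ_ : PowerSeries → PowerSeries → PowerSeries
(f /ₛ g) ! n = ((f !_) /ˢ (g !_)) n

*-/ₛ : ∀ f g → g ! 0 ≡ 1ℤ → g *ₛ (f /ₛ g) ≈ f
*-/ₛ f g g0 = ptw go
  where
  go : ∀ n → (g *ₛ (f /ₛ g)) ! n ≡ f ! n
  go zero    = trans (cong (ℤ._* (f ! 0)) g0) (ℤₚ.*-identityˡ (f ! 0))
  go (suc n) = trans (*-suc g (f /ₛ g) n) (trans
    (cong₂ ℤ._+_ (trans (cong (ℤ._* ((f /ₛ g) ! suc n)) g0) (ℤₚ.*-identityˡ ((f /ₛ g) ! suc n)))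
      (sym (quotient-tail (f !_) (g !_) n 0 _ refl)))
    (ℤS.solve 2 (λ a b → a ℤS.:- b ℤS.:+ b ℤS.:= a) refl (f ! suc n)
      (dot (g !_) (quotientCoeffs (f !_) (g !_) n))))

inv : PowerSeries → PowerSeries
inv g = 1ₛ /ₛ g

*-inv : ∀ g → g ! 0 ≡ 1ℤ → g *ₛ inv g ≈ 1ₛ
*-inv = *-/ₛ 1ₛ

*ₛ-cancelˡ : ∀ {f g} h → h ! 0 ≡ 1ℤ → h *ₛ f ≈ h *ₛ g → f ≈ g
*ₛ-cancelˡ {f} {g} h h0 p = begin
  f                  ≈⟨ strip f ⟨
  inv h *ₛ (h *ₛ f)  ≈⟨ *ₛ-congˡ p ⟩
  inv h *ₛ (h *ₛ g)  ≈⟨ strip g ⟩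
  g                  ∎
  where
  strip : ∀ f → inv h *ₛ (h *ₛ f) ≈ f
  strip f = begin
    inv h *ₛ (h *ₛ f)  ≈⟨ RS.solve 3 (λ i h f → i :* (h :* f) := h :* i :* f) ≈-refl (inv h) h f ⟩
    h *ₛ inv h *ₛ f    ≈⟨ *ₛ-congʳ (*-inv h h0) ⟩
    1ₛ *ₛ f            ≈⟨ *ₛ-identityˡ f ⟩
    f                  ∎
    where open RS

-- Even and odd parts

-- `dbl` and `alt` are the substitutions q → q² and q → -q. Identities about them are mostly proved
-- by comparing even and odd parts through `ev-od-ext`.
ev od dbl alt : PowerSeries → PowerSeries
ev f ! n = f ! (n ℕ.* 2)
od f ! n = f ! suc (n ℕ.* 2)
dbl f ! zero        = f ! 0
dbl f ! suc zero    = 0ℤ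
dbl f ! suc (suc n) = dbl (tail f) ! n
alt f ! zero  = f ! 0
alt f ! suc n = ℤ.- (alt (tail f) ! n)

parity : ∀ n → (∃[ m ] n ≡ m ℕ.* 2) ⊎ (∃[ m ] n ≡ suc (m ℕ.* 2))
parity zero = inj₁ (0 , refl)
parity (suc n) with parity n
... | inj₁ (m , refl) = inj₂ (m , refl)
... | inj₂ (m , refl) = inj₁ (suc m , refl)

ev-od-ext : ∀ {f g} → ev f ≈ ev g → od f ≈ od g → f ≈ g
ev-od-ext {f} {g} p q = ptw go
  where
  go : ∀ n → f ! n ≡ g ! n
  go n with parity n
  ... | inj₁ (m , refl) = at p m
  ... | inj₂ (m , refl) = at q m

ev-cong : ∀ {f g} → f ≈ g → ev f ≈ ev g
ev-cong p = ptw λ n → at p (n ℕ.* 2)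

od-cong : ∀ {f g} → f ≈ g → od f ≈ od g
od-cong p = ptw λ n → at p (suc (n ℕ.* 2))

ev-dbl : ∀ f → ev (dbl f) ≈ f
ev-dbl f = ptw (go f)
  where
  go : ∀ f n → ev (dbl f) ! n ≡ f ! n
  go f zero    = refl
  go f (suc n) = go (tail f) n

od-dbl : ∀ f → od (dbl f) ≈ 0ₛ
od-dbl f = ptw (go f)
  where
  go : ∀ f n → od (dbl f) ! n ≡ 0ℤ
  go f zero    = refl
  go f (suc n) = go (tail f) n

ev-alt : ∀ f → ev (alt f) ≈ ev f
ev-alt f = ptw (go f)
  where
  go : ∀ f n → ev (alt f) ! n ≡ ev f ! n
  go f zero    = refl
  go f (suc n) = trans (ℤₚ.neg-involutive _) (go (tail (tail f)) n)

od-alt : ∀ f → od (alt f) ≈ neg (od f)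
od-alt f = ptw (go f)
  where
  go : ∀ f n → od (alt f) ! n ≡ ℤ.- (od f ! n)
  go f zero    = refl
  go f (suc n) = trans (ℤₚ.neg-involutive _) (go (tail (tail f)) n)

q q² : PowerSeries
q  = q↑ 1
q² = q↑ 2

-- Two odd indices 2i + 1 and 2j + 1 add up to 2(i + j + 1); this is the factor q on the product of
-- the odd parts.
ev-* : ∀ f g → ev (f *ₛ g) ≈ ev f *ₛ ev g +ₛ q *ₛ (od f *ₛ od g)
ev-* f g = ptw go
  where
  F : ℕ → ℕ → ℤ
  F n i = f ! i ℤ.* g ! (n ℕ.* 2 ∸ i)

  index : ∀ n i → n ℕ.* 2 ∸ i ℕ.* 2 ≡ (n ∸ i) ℕ.* 2
  index n i = sym (ℕₚ.*-distribʳ-∸ 2 n i)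

  go : ∀ n → ev (f *ₛ g) ! n ≡ (ev f *ₛ ev g +ₛ q *ₛ (od f *ₛ od g)) ! n
  go zero    = sym (ℤₚ.+-identityʳ _)
  go (suc n) = trans
    (cong (ℤ._+ F (suc n) (suc n ℕ.* 2)) (∑-even-odd n (F (suc n)))) (trans
    (ℤS.solve 3 (λ a b c → a ℤS.:+ b ℤS.:+ c ℤS.:= a ℤS.:+ c ℤS.:+ b) refl
      (∑≤ n (λ i → F (suc n) (i ℕ.* 2))) (∑≤ n (λ i → F (suc n) (suc (i ℕ.* 2)))) _)
    (cong₂ ℤ._+_
      (∑-cong (suc n) λ i → cong (λ k → f ! (i ℕ.* 2) ℤ.* g ! k) (index (suc n) i))
      (trans
        (∑-cong≤ n λ i i≤n → cong (λ k → f ! suc (i ℕ.* 2) ℤ.* g ! k)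
          (trans (ℕₚ.+-∸-assoc 1 (ℕₚ.*-monoˡ-≤ 2 i≤n)) (cong suc (index n i))))
        (sym (trans (qᵏ-suc-* 0 (od f *ₛ od g) n) (qᵏ-+-* 0 (od f *ₛ od g) n))))))

od-* : ∀ f g → od (f *ₛ g) ≈ ev f *ₛ od g +ₛ od f *ₛ ev g
od-* f g = ptw λ n → trans (∑-even-odd n (λ i → f ! i ℤ.* g ! (suc (n ℕ.* 2) ∸ i))) (cong₂ ℤ._+_
  (∑-cong≤ n λ i i≤n → cong (λ k → f ! (i ℕ.* 2) ℤ.* g ! k)
    (trans (ℕₚ.+-∸-assoc 1 (ℕₚ.*-monoˡ-≤ 2 i≤n)) (cong suc (index n i))))
  (∑-cong n λ i → cong (λ k → f ! suc (i ℕ.* 2) ℤ.* g ! k) (index n i)))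
  where
  index : ∀ n i → n ℕ.* 2 ∸ i ℕ.* 2 ≡ (n ∸ i) ℕ.* 2
  index n i = sym (ℕₚ.*-distribʳ-∸ 2 n i)

dbl-cong : ∀ {f g} → f ≈ g → dbl f ≈ dbl g
dbl-cong {f} {g} p = ev-od-ext
  (≈-trans (ev-dbl f) (≈-trans p (≈-sym (ev-dbl g))))
  (≈-trans (od-dbl f) (≈-sym (od-dbl g)))

alt-cong : ∀ {f g} → f ≈ g → alt f ≈ alt g
alt-cong {f} {g} p = ev-od-ext
  (≈-trans (ev-alt f) (≈-trans (ev-cong p) (≈-sym (ev-alt g))))
  (≈-trans (od-alt f) (≈-trans (neg-cong (od-cong p)) (≈-sym (od-alt g))))

dbl-* : ∀ f g → dbl (f *ₛ g) ≈ dbl f *ₛ dbl g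
dbl-* f g = ev-od-ext
  (begin
    ev (dbl (f *ₛ g))                                        ≈⟨ ev-dbl (f *ₛ g) ⟩
    f *ₛ g                                                   ≈⟨ RS.solve 3 (λ f g q → f :* g := f :* g :+ q :* (con 0ℤ :* con 0ℤ)) ≈-refl f g q ⟩
    f *ₛ g +ₛ q *ₛ (0ₛ *ₛ 0ₛ)                                ≈⟨ +ₛ-cong (*ₛ-cong (ev-dbl f) (ev-dbl g)) (*ₛ-congˡ (*ₛ-cong (od-dbl f) (od-dbl g))) ⟨
    ev (dbl f) *ₛ ev (dbl g) +ₛ q *ₛ (od (dbl f) *ₛ od (dbl g)) ≈⟨ ev-* (dbl f) (dbl g) ⟨
    ev (dbl f *ₛ dbl g)                                      ∎)
  (begin
    od (dbl (f *ₛ g))                              ≈⟨ od-dbl (f *ₛ g) ⟩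
    0ₛ                                             ≈⟨ RS.solve 2 (λ f g → con 0ℤ := f :* con 0ℤ :+ con 0ℤ :* g) ≈-refl f g ⟩
    f *ₛ 0ₛ +ₛ 0ₛ *ₛ g                             ≈⟨ +ₛ-cong (*ₛ-cong (ev-dbl f) (od-dbl g)) (*ₛ-cong (od-dbl f) (ev-dbl g)) ⟨
    ev (dbl f) *ₛ od (dbl g) +ₛ od (dbl f) *ₛ ev (dbl g) ≈⟨ od-* (dbl f) (dbl g) ⟨
    od (dbl f *ₛ dbl g)                            ∎)
  where open RS using (_:*_; _:+_; _:=_; con)

alt-* : ∀ f g → alt (f *ₛ g) ≈ alt f *ₛ alt g
alt-* f g = ev-od-ext
  (begin
    ev (alt (f *ₛ g))                                        ≈⟨ ev-alt (f *ₛ g) ⟩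
    ev (f *ₛ g)                                              ≈⟨ ev-* f g ⟩
    ev f *ₛ ev g +ₛ q *ₛ (od f *ₛ od g)                      ≈⟨ RS.solve 5 (λ a b q c d → a :* b :+ q :* (c :* d) := a :* b :+ q :* (:- c :* :- d)) ≈-refl (ev f) (ev g) q (od f) (od g) ⟩
    ev f *ₛ ev g +ₛ q *ₛ (neg (od f) *ₛ neg (od g))        ≈⟨ +ₛ-cong (*ₛ-cong (ev-alt f) (ev-alt g)) (*ₛ-congˡ (*ₛ-cong (od-alt f) (od-alt g))) ⟨
    ev (alt f) *ₛ ev (alt g) +ₛ q *ₛ (od (alt f) *ₛ od (alt g)) ≈⟨ ev-* (alt f) (alt g) ⟨
    ev (alt f *ₛ alt g)                                      ∎)
  (begin
    od (alt (f *ₛ g))                              ≈⟨ od-alt (f *ₛ g) ⟩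
    neg (od (f *ₛ g))                             ≈⟨ neg-cong (od-* f g) ⟩
    neg (ev f *ₛ od g +ₛ od f *ₛ ev g)            ≈⟨ RS.solve 4 (λ a b c d → :- (a :* b :+ c :* d) := a :* :- b :+ :- c :* d) ≈-refl (ev f) (od g) (od f) (ev g) ⟩
    ev f *ₛ neg (od g) +ₛ neg (od f) *ₛ ev g     ≈⟨ +ₛ-cong (*ₛ-cong (ev-alt f) (od-alt g)) (*ₛ-cong (od-alt f) (ev-alt g)) ⟨
    ev (alt f) *ₛ od (alt g) +ₛ od (alt f) *ₛ ev (alt g) ≈⟨ od-* (alt f) (alt g) ⟨
    od (alt f *ₛ alt g)                            ∎)
  where open RS using (_:*_; _:+_; :-_; _:=_)

dbl-+ : ∀ f g → dbl (f +ₛ g) ≈ dbl f +ₛ dbl g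
dbl-+ f g = ev-od-ext
  (≈-trans (ev-dbl (f +ₛ g)) (ptw λ n → sym (cong₂ ℤ._+_ (at (ev-dbl f) n) (at (ev-dbl g) n))))
  (≈-trans (od-dbl (f +ₛ g)) (ptw λ n → sym (cong₂ ℤ._+_ (at (od-dbl f) n) (at (od-dbl g) n))))

dbl-neg : ∀ f → dbl (neg f) ≈ neg (dbl f)
dbl-neg f = ev-od-ext
  (≈-trans (ev-dbl (neg f)) (ptw λ n → cong ℤ.-_ (sym (at (ev-dbl f) n))))
  (≈-trans (od-dbl (neg f)) (ptw λ n → cong ℤ.-_ (sym (at (od-dbl f) n))))

alt-+ : ∀ f g → alt (f +ₛ g) ≈ alt f +ₛ alt g
alt-+ f g = ev-od-ext
  (≈-trans (ev-alt (f +ₛ g)) (ptw λ n → sym (cong₂ ℤ._+_ (at (ev-alt f) n) (at (ev-alt g) n))))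
  (≈-trans (od-alt (f +ₛ g)) (ptw λ n → trans (ℤₚ.neg-distrib-+ (od f ! n) (od g ! n))
    (sym (cong₂ ℤ._+_ (at (od-alt f) n) (at (od-alt g) n)))))

alt-neg : ∀ f → alt (neg f) ≈ neg (alt f)
alt-neg f = ev-od-ext
  (≈-trans (ev-alt (neg f)) (ptw λ n → cong ℤ.-_ (sym (at (ev-alt f) n))))
  (≈-trans (od-alt (neg f)) (ptw λ n → cong ℤ.-_ (sym (at (od-alt f) n))))

dbl-1 : dbl 1ₛ ≈ 1ₛ
dbl-1 = ev-od-ext
  (≈-trans (ev-dbl 1ₛ) (ptw λ { zero → refl ; (suc _) → refl }))
  (≈-trans (od-dbl 1ₛ) (ptw λ _ → refl))

alt-dbl : ∀ f → alt (dbl f) ≈ dbl f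
alt-dbl f = ev-od-ext (ev-alt (dbl f)) (begin
  od (alt (dbl f))   ≈⟨ od-alt (dbl f) ⟩
  neg (od (dbl f))  ≈⟨ ptw (λ n → cong ℤ.-_ (at (od-dbl f) n)) ⟩
  0ₛ                 ≈⟨ od-dbl f ⟨
  od (dbl f)         ∎)

alt-alt : ∀ f → alt (alt f) ≈ f
alt-alt f = ev-od-ext (≈-trans (ev-alt (alt f)) (ev-alt f))
  (≈-trans (od-alt (alt f)) (≈-trans (neg-cong (od-alt f)) (ptw λ n → ℤₚ.neg-involutive _)))

alt-1 : alt 1ₛ ≈ 1ₛ
alt-1 = ≈-trans (alt-cong (≈-sym dbl-1)) (≈-trans (alt-dbl 1ₛ) dbl-1)

dbl-qᵏ : ∀ k → dbl (q↑ k) ≈ q↑ (k ℕ.* 2)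
dbl-qᵏ zero    = ≈-trans (dbl-cong q⁰≈1) (≈-trans dbl-1 (≈-sym q⁰≈1))
dbl-qᵏ (suc k) = begin
  dbl (q↑ suc k)            ≈⟨ dbl-cong (qᵏ-+ 1 k) ⟩
  dbl (q *ₛ q↑ k)           ≈⟨ dbl-* q (q↑ k) ⟩
  dbl q *ₛ dbl (q↑ k)       ≈⟨ *ₛ-cong dbl-q (dbl-qᵏ k) ⟩
  q² *ₛ q↑ (k ℕ.* 2)        ≈⟨ qᵏ-+ 2 (k ℕ.* 2) ⟨
  q↑ (suc k ℕ.* 2)          ∎
  where
  dbl-q : dbl q ≈ q²
  dbl-q = ev-od-ext
    (≈-trans (ev-dbl q) (ptw λ { zero → refl ; (suc zero) → refl ; (suc (suc _)) → refl }))
    (≈-trans (od-dbl q) (ptw λ { zero → refl ; (suc _) → refl }))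

-- The constant (-1)ⁿ as a series, so that signs can be handled by the ring solver.
sg : ℕ → PowerSeries
sg zero    = 1ₛ
sg (suc n) = neg (sg n)

sg-+ : ∀ m n → sg (m ℕ.+ n) ≈ sg m *ₛ sg n
sg-+ zero    n = ≈-sym (*ₛ-identityˡ (sg n))
sg-+ (suc m) n = ≈-trans (neg-cong (sg-+ m n))
  (RS.solve 2 (λ a b → :- (a :* b) := :- a :* b) ≈-refl (sg m) (sg n))
  where open RS

sg-double : ∀ n → sg (n ℕ.+ n) ≈ 1ₛ
sg-double zero    = ≈-refl
sg-double (suc n) = begin
  neg (sg (n ℕ.+ suc n))      ≡⟨ cong (λ k → neg (sg k)) (ℕₚ.+-suc n n) ⟩
  neg (neg (sg (n ℕ.+ n)))   ≈⟨ RS.solve 1 (λ a → RS.:- (RS.:- a) RS.:= a) ≈-refl (sg (n ℕ.+ n)) ⟩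
  sg (n ℕ.+ n)                 ≈⟨ sg-double n ⟩
  1ₛ                           ∎

alt-q : alt q ≈ neg q
alt-q = ev-od-ext
  (≈-trans (ev-alt q) (ptw λ { zero → refl ; (suc _) → refl }))
  (≈-trans (od-alt q) (ptw λ _ → refl))

alt-qᵏ : ∀ k → alt (q↑ k) ≈ sg k *ₛ q↑ k
alt-qᵏ zero    = begin
  alt (q↑ 0)   ≈⟨ alt-cong q⁰≈1 ⟩
  alt 1ₛ       ≈⟨ alt-1 ⟩
  1ₛ           ≈⟨ q⁰≈1 ⟨
  q↑ 0         ≈⟨ *ₛ-identityˡ (q↑ 0) ⟨
  1ₛ *ₛ q↑ 0   ∎
alt-qᵏ (suc k) = begin
  alt (q↑ suc k)                  ≈⟨ alt-cong (qᵏ-+ 1 k) ⟩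
  alt (q *ₛ q↑ k)                 ≈⟨ alt-* q (q↑ k) ⟩
  alt q *ₛ alt (q↑ k)             ≈⟨ *ₛ-cong alt-q (alt-qᵏ k) ⟩
  neg q *ₛ (sg k *ₛ q↑ k)        ≈⟨ RS.solve 3 (λ q s r → :- q :* (s :* r) := :- s :* (q :* r)) ≈-refl q (sg k) (q↑ k) ⟩
  neg (sg k) *ₛ (q *ₛ q↑ k)      ≈⟨ *ₛ-congˡ (qᵏ-+ 1 k) ⟨
  neg (sg k) *ₛ q↑ suc k         ∎
  where open RS

-- Infinite sums

∑ₛ : (ℕ → PowerSeries) → PowerSeries
∑ₛ t ! N = ∑≤ N (λ n → t n ! N)

-- The condition under which ∑ₛ t is the sum of the family t.
Small : (ℕ → PowerSeries) → Set
Small t = ∀ n → Ord n (t n)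

∑ₛ-cong : ∀ {s t} → (∀ n → s n ≈ t n) → ∑ₛ s ≈ ∑ₛ t
∑ₛ-cong p = ptw λ N → ∑-cong N λ n → at (p n) N

∑ₛ-+ : ∀ s t → ∑ₛ (λ n → s n +ₛ t n) ≈ ∑ₛ s +ₛ ∑ₛ t
∑ₛ-+ s t = ptw λ N → ∑-+ N (λ n → s n ! N) (λ n → t n ! N)

∑ₛ-swap : ∀ (t : ℕ → ℕ → PowerSeries) → ∑ₛ (λ m → ∑ₛ (t m)) ≈ ∑ₛ (λ n → ∑ₛ (λ m → t m n))
∑ₛ-swap t = ptw λ N → ∑-swap N N (λ m n → t m n ! N)

∑ₛ-0 : ∀ {t} → (∀ n → t n ≈ 0ₛ) → ∑ₛ t ≈ 0ₛ
∑ₛ-0 p = ptw λ N → ∑-0 N λ n _ → at (p n) N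

∑ₛ-Ord : ∀ {k t} → (∀ n → Ord k (t n)) → Ord k (∑ₛ t)
∑ₛ-Ord o N N<k = ∑-0 N λ n _ → o n N N<k

∑ₛ-head : ∀ {t} → Small t → ∑ₛ t ≈ t 0 +ₛ ∑ₛ (λ n → t (suc n))
∑ₛ-head {t} small = ptw λ N → trans
  -- The bound is raised to N + 1, where smallness kills the extra term, so that the shifted sum is
  -- again truncated at N.
  (sym (∑-extend (ℕₚ.n≤1+n N) λ n N<n → small n N N<n))
  (∑-head N (λ n → t n ! N))

-- The i-th coefficient of `f` meets the sum truncated at N - i; smallness restores the common bound
-- N, and the rest is a finite interchange.
*ₛ-∑ₛ : ∀ f {t} → Small t → f *ₛ ∑ₛ t ≈ ∑ₛ (λ n → f *ₛ t n)
*ₛ-∑ₛ f {t} small = ptw λ N → trans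
  (∑-cong N λ i → trans
    (cong (f ! i ℤ.*_) (sym (∑-extend (ℕₚ.m∸n≤m N i) λ n lt → small n (N ∸ i) lt)))
    (sym (∑-*ˡ N (f ! i) (λ n → t n ! (N ∸ i)))))
  (∑-swap N N (λ i n → f ! i ℤ.* t n ! (N ∸ i)))

∑ₛ-*ₛ : ∀ {t} f → Small t → ∑ₛ t *ₛ f ≈ ∑ₛ (λ n → t n *ₛ f)
∑ₛ-*ₛ {t} f small = ≈-trans (*ₛ-comm (∑ₛ t) f)
  (≈-trans (*ₛ-∑ₛ f small) (∑ₛ-cong λ n → *ₛ-comm f (t n)))

∑ₛ-* : ∀ {s t} → Small s → Small t → ∑ₛ s *ₛ ∑ₛ t ≈ ∑ₛ (λ i → ∑ₛ (λ j → s i *ₛ t j))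
∑ₛ-* {s} {t} small-s small-t =
  ≈-trans (∑ₛ-*ₛ (∑ₛ t) small-s) (∑ₛ-cong λ i → *ₛ-∑ₛ (s i) small-t)

∑ₛ-even-odd : ∀ {t} → Small t → ∑ₛ t ≈ ∑ₛ (λ n → t (n ℕ.* 2)) +ₛ ∑ₛ (λ n → t (suc (n ℕ.* 2)))
∑ₛ-even-odd {t} small = ptw λ N → trans
  (sym (∑-extend (ℕₚ.m≤n⇒m≤1+n (ℕₚ.m≤m*n N 2)) λ n N<n → small n N N<n))
  (∑-even-odd N (λ n → t n ! N))

∑ₖ : ℕ → (ℕ → PowerSeries) → PowerSeries
∑ₖ k t ! N = ∑≤ k (λ i → t i ! N)

∑ₖ-cong : ∀ k {s t} → (∀ i → i ≤ k → s i ≈ t i) → ∑ₖ k s ≈ ∑ₖ k t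
∑ₖ-cong k p = ptw λ N → ∑-cong≤ k λ i i≤k → at (p i i≤k) N

∑ₖ-+ : ∀ k s t → ∑ₖ k (λ i → s i +ₛ t i) ≈ ∑ₖ k s +ₛ ∑ₖ k t
∑ₖ-+ k s t = ptw λ N → ∑-+ k (λ i → s i ! N) (λ i → t i ! N)

∑ₖ-neg : ∀ k s → ∑ₖ k (λ i → neg (s i)) ≈ neg (∑ₖ k s)
∑ₖ-neg k s = ptw λ N → ∑-neg k (λ i → s i ! N)

∑ₖ-head : ∀ k s → ∑ₖ (suc k) s ≈ s 0 +ₛ ∑ₖ k (λ i → s (suc i))
∑ₖ-head k s = ptw λ N → ∑-head k (λ i → s i ! N)

∑ₖ-last : ∀ k s → ∑ₖ (suc k) s ≈ ∑ₖ k s +ₛ s (suc k)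
∑ₖ-last k s = ptw λ _ → refl

*ₛ-∑ₖ : ∀ f k s → f *ₛ ∑ₖ k s ≈ ∑ₖ k (λ i → f *ₛ s i)
*ₛ-∑ₖ f k s = ptw λ N → trans
  (∑-cong N λ j → sym (∑-*ˡ k (f ! j) (λ i → s i ! (N ∸ j))))
  (∑-swap N k (λ j i → f ! j ℤ.* s i ! (N ∸ j)))

-- At the coefficient N the terms with i + j > N vanish, which cuts the square of index pairs down
-- to a triangle.
∑ₛ-diagonal : ∀ {t : ℕ → ℕ → PowerSeries} → (∀ i j → Ord (i ℕ.+ j) (t i j)) →
  ∑ₛ (λ i → ∑ₛ (t i)) ≈ ∑ₛ (λ k → ∑ₖ k (λ i → t i (k ∸ i)))
∑ₛ-diagonal {t} o = ptw λ N → trans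
  (∑-cong≤ N λ i i≤N → ∑-extend (ℕₚ.m∸n≤m N i) λ j N∸i<j →
    o i j N (ℕₚ.≤-<-trans (ℕₚ.≤-reflexive (sym (ℕₚ.m+[n∸m]≡n i≤N))) (ℕₚ.+-monoʳ-< i N∸i<j)))
  (∑-triangle N (λ i j → t i j ! N))

∑ₛ-alt : ∀ t → alt (∑ₛ t) ≈ ∑ₛ (λ n → alt (t n))
∑ₛ-alt t = ev-od-ext
  (≈-trans (ev-alt (∑ₛ t)) (ptw λ N → ∑-cong (N ℕ.* 2) λ n → sym (at (ev-alt (t n)) N)))
  (≈-trans (od-alt (∑ₛ t)) (ptw λ N → trans (sym (∑-neg (suc (N ℕ.* 2)) (λ n → t n ! suc (N ℕ.* 2))))
    (∑-cong (suc (N ℕ.* 2)) λ n → sym (at (od-alt (t n)) N))))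

∑ₛ-dbl : ∀ {t} → Small t → dbl (∑ₛ t) ≈ ∑ₛ (λ n → dbl (t n))
∑ₛ-dbl {t} small = ev-od-ext
  (≈-trans (ev-dbl (∑ₛ t)) (ptw λ N → sym (trans (∑-cong (N ℕ.* 2) λ n → at (ev-dbl (t n)) N)
    (∑-extend (ℕₚ.m≤m*n N 2) λ n N<n → small n N N<n))))
  (≈-trans (od-dbl (∑ₛ t)) (ptw λ N → sym (∑-0 (suc (N ℕ.* 2)) λ n _ → at (od-dbl (t n)) N)))

Ord-dbl : ∀ {k f} → Ord k f → Ord k (dbl f)
Ord-dbl {k} {f} o n n<k with parity n
... | inj₁ (m , refl) = trans (at (ev-dbl f) m) (o m (ℕₚ.≤-<-trans (ℕₚ.m≤m*n m 2) n<k))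
... | inj₂ (m , refl) = at (od-dbl f) m

-- Euler's series

-- Q j = (q²; q²)ⱼ
Q : ℕ → PowerSeries
Q zero    = 1ₛ
Q (suc j) = Q j *ₛ (1ₛ -ₛ q↑ (suc j ℕ.* 2))

ι : ℕ → PowerSeries
ι j = inv (Q j)

Q-unit : ∀ j → Q j ! 0 ≡ 1ℤ
Q-unit zero    = refl
Q-unit (suc j) = cong (ℤ._* 1ℤ) (Q-unit j)

Q-ι : ∀ j → Q j *ₛ ι j ≈ 1ₛ
Q-ι j = *-inv (Q j) (Q-unit j)

ι-suc : ∀ j → (1ₛ -ₛ q↑ (suc j ℕ.* 2)) *ₛ ι (suc j) ≈ ι j
ι-suc j = *ₛ-cancelˡ (Q j) (Q-unit j) (begin
  Q j *ₛ ((1ₛ -ₛ q↑ (suc j ℕ.* 2)) *ₛ ι (suc j))  ≈⟨ *ₛ-assoc (Q j) _ (ι (suc j)) ⟨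
  Q (suc j) *ₛ ι (suc j)                          ≈⟨ Q-ι (suc j) ⟩
  1ₛ                                              ≈⟨ Q-ι j ⟨
  Q j *ₛ ι j                                      ∎)

ι-zero : ι 0 ≈ 1ₛ
ι-zero = ≈-trans (≈-sym (*ₛ-identityˡ (ι 0))) (Q-ι 0)

sg-*2 : ∀ n → sg (n ℕ.* 2) ≈ 1ₛ
sg-*2 zero    = ≈-refl
sg-*2 (suc n) = ≈-trans (RS.solve 1 (λ a → RS.:- (RS.:- a) RS.:= a) ≈-refl (sg (n ℕ.* 2))) (sg-*2 n)

alt-ι : ∀ j → alt (ι j) ≈ ι j
alt-ι j = *ₛ-cancelˡ (Q j) (Q-unit j) (begin
  Q j *ₛ alt (ι j)        ≈⟨ *ₛ-congʳ (alt-Q j) ⟨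
  alt (Q j) *ₛ alt (ι j)  ≈⟨ alt-* (Q j) (ι j) ⟨
  alt (Q j *ₛ ι j)        ≈⟨ alt-cong (Q-ι j) ⟩
  alt 1ₛ                  ≈⟨ alt-1 ⟩
  1ₛ                      ≈⟨ Q-ι j ⟨
  Q j *ₛ ι j              ∎)
  where
  alt-Q : ∀ j → alt (Q j) ≈ Q j
  alt-Q zero    = alt-1
  alt-Q (suc j) = begin
    alt (Q j *ₛ (1ₛ -ₛ q↑ (suc j ℕ.* 2)))
      ≈⟨ alt-* (Q j) _ ⟩
    alt (Q j) *ₛ alt (1ₛ -ₛ q↑ (suc j ℕ.* 2))
      ≈⟨ *ₛ-cong (alt-Q j) (≈-trans (alt-+ 1ₛ _) (+ₛ-cong alt-1 (≈-trans (alt-neg (q↑ (suc j ℕ.* 2))) (neg-cong even)))) ⟩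
    Q j *ₛ (1ₛ -ₛ q↑ (suc j ℕ.* 2)) ∎
    where
    even : alt (q↑ (suc j ℕ.* 2)) ≈ q↑ (suc j ℕ.* 2)
    even = ≈-trans (alt-qᵏ (suc j ℕ.* 2)) (≈-trans (*ₛ-congʳ (sg-*2 (suc j))) (*ₛ-identityˡ _))

n≤n² : ∀ n → n ≤ n ℕ.* n
n≤n² zero    = z≤n
n≤n² (suc n) = ℕₚ.m≤m+n (suc n) _

euler : ℕ → ℕ → PowerSeries
euler n i = ι i *ₛ q↑ (i ℕ.* i ℕ.+ n ℕ.* i ℕ.* 2)

-- ep n = (-q²ⁿ⁺¹; q²)_∞, by Euler's expansion.
ep : ℕ → PowerSeries
ep n = ∑ₛ (euler n)

euler-small : ∀ n → Small (euler n)
euler-small n i = Ord-*ʳ (ι i) (q↑ (i ℕ.* i ℕ.+ n ℕ.* i ℕ.* 2))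
  (Ord-≤ {f = q↑ (i ℕ.* i ℕ.+ n ℕ.* i ℕ.* 2)} (ℕₚ.≤-trans (n≤n² i) (ℕₚ.m≤m+n _ _))
    (Ord-qᵏ (i ℕ.* i ℕ.+ n ℕ.* i ℕ.* 2)))

-- Split 1 = y + (1 - y) with y = q²⁽ⁱ⁺¹⁾ in the term i + 1: the part with y has n raised to n + 1,
-- and 1 - y lowers `ι (suc i)` to `ι i`, which gives the shifted sum with the factor q²ⁿ⁺¹.
ep-suc : ∀ n → ep n ≈ (1ₛ +ₛ q↑ suc (n ℕ.* 2)) *ₛ ep (suc n)
ep-suc n = begin
  ep n
    ≈⟨ ∑ₛ-head (euler-small n) ⟩
  euler n 0 +ₛ ∑ₛ (λ i → euler n (suc i))
    ≈⟨ +ₛ-cong (*ₛ-congˡ (qᵏ-cong exponent₀)) (∑ₛ-cong term) ⟩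
  euler (suc n) 0 +ₛ ∑ₛ (λ i → euler (suc n) (suc i) +ₛ m *ₛ euler (suc n) i)
    ≈⟨ +ₛ-congˡ (≈-trans (∑ₛ-+ _ _) (+ₛ-congˡ (≈-sym (*ₛ-∑ₛ m (euler-small (suc n)))))) ⟩
  euler (suc n) 0 +ₛ (∑ₛ (λ i → euler (suc n) (suc i)) +ₛ m *ₛ ep (suc n))
    ≈⟨ RS.solve 4 (λ a b m e → a :+ (b :+ m :* e) := (a :+ b) :+ m :* e) ≈-refl _ _ m (ep (suc n)) ⟩
  euler (suc n) 0 +ₛ ∑ₛ (λ i → euler (suc n) (suc i)) +ₛ m *ₛ ep (suc n)
    ≈⟨ +ₛ-congʳ (∑ₛ-head (euler-small (suc n))) ⟨
  ep (suc n) +ₛ m *ₛ ep (suc n)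
    ≈⟨ RS.solve 2 (λ m e → e :+ m :* e := (con 1ℤ :+ m) :* e) ≈-refl m (ep (suc n)) ⟩
  (1ₛ +ₛ m) *ₛ ep (suc n) ∎
  where
  open RS using (_:*_; _:+_; _:-_; _:=_; con)
  m = q↑ suc (n ℕ.* 2)

  exponent₀ : n ℕ.* 0 ℕ.* 2 ≡ suc n ℕ.* 0 ℕ.* 2
  exponent₀ = trans (cong (ℕ._* 2) (ℕₚ.*-zeroʳ n)) (sym (cong (ℕ._* 2) (ℕₚ.*-zeroʳ (suc n))))

  term : ∀ i → euler n (suc i) ≈ euler (suc n) (suc i) +ₛ m *ₛ euler (suc n) i
  term i = begin
    ι (suc i) *ₛ x
      ≈⟨ RS.solve 3 (λ c x y → c :* x := c :* (x :* y) :+ (con 1ℤ :- y) :* c :* x) ≈-refl (ι (suc i)) x y ⟩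
    ι (suc i) *ₛ (x *ₛ y) +ₛ (1ₛ -ₛ y) *ₛ ι (suc i) *ₛ x
      ≈⟨ +ₛ-cong (*ₛ-congˡ (qᵏ*qˡ exponent₁)) (*ₛ-cong (ι-suc i) (≈-sym (qᵏ*qˡ exponent₂))) ⟩
    euler (suc n) (suc i) +ₛ ι i *ₛ (m *ₛ q↑ (i ℕ.* i ℕ.+ suc n ℕ.* i ℕ.* 2))
      ≈⟨ +ₛ-congˡ (RS.solve 3 (λ c m x → c :* (m :* x) := m :* (c :* x)) ≈-refl (ι i) m _) ⟩
    euler (suc n) (suc i) +ₛ m *ₛ euler (suc n) i ∎
    where
    x = q↑ (suc i ℕ.* suc i ℕ.+ n ℕ.* suc i ℕ.* 2)
    y = q↑ (suc i ℕ.* 2)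
    exponent₁ : suc i ℕ.* suc i ℕ.+ n ℕ.* suc i ℕ.* 2 ℕ.+ suc i ℕ.* 2 ≡
                suc i ℕ.* suc i ℕ.+ suc n ℕ.* suc i ℕ.* 2
    exponent₁ = ℕS.solve 2 (λ i n → i ℕS.:* i ℕS.:+ n ℕS.:* i ℕS.:* ℕS.con 2 ℕS.:+ i ℕS.:* ℕS.con 2 ℕS.:=
      i ℕS.:* i ℕS.:+ (ℕS.con 1 ℕS.:+ n) ℕS.:* i ℕS.:* ℕS.con 2) refl (suc i) n
    exponent₂ : suc (n ℕ.* 2) ℕ.+ (i ℕ.* i ℕ.+ suc n ℕ.* i ℕ.* 2) ≡
                suc i ℕ.* suc i ℕ.+ n ℕ.* suc i ℕ.* 2
    exponent₂ = ℕS.solve 2 (λ i n → ℕS.con 1 ℕS.:+ n ℕS.:* ℕS.con 2 ℕS.:+ (i ℕS.:* i ℕS.:+ (ℕS.con 1 ℕS.:+ n) ℕS.:* i ℕS.:* ℕS.con 2) ℕS.:=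
      (ℕS.con 1 ℕS.:+ i) ℕS.:* (ℕS.con 1 ℕS.:+ i) ℕS.:+ n ℕS.:* (ℕS.con 1 ℕS.:+ i) ℕS.:* ℕS.con 2) refl i n

-- pochhammer⁺ n = (-q; q²)ₙ
pochhammer⁺ : ℕ → PowerSeries
pochhammer⁺ zero    = 1ₛ
pochhammer⁺ (suc n) = pochhammer⁺ n *ₛ (1ₛ +ₛ q↑ suc (n ℕ.* 2))

pochhammer⁺-ep : ∀ n → pochhammer⁺ n *ₛ ep n ≈ ep 0
pochhammer⁺-ep zero    = *ₛ-identityˡ (ep 0)
pochhammer⁺-ep (suc n) = begin
  pochhammer⁺ n *ₛ (1ₛ +ₛ q↑ suc (n ℕ.* 2)) *ₛ ep (suc n)    ≈⟨ *ₛ-assoc (pochhammer⁺ n) _ (ep (suc n)) ⟩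
  pochhammer⁺ n *ₛ ((1ₛ +ₛ q↑ suc (n ℕ.* 2)) *ₛ ep (suc n))  ≈⟨ *ₛ-congˡ (ep-suc n) ⟨
  pochhammer⁺ n *ₛ ep n                                      ≈⟨ pochhammer⁺-ep n ⟩
  ep 0                                                       ∎

sq : ℕ → ℕ
sq n = n ℕ.* n

cauchy : ℕ → ℕ → PowerSeries
cauchy n j = q↑ (sq n ℕ.+ sq ∣ n - j ∣) *ₛ ι j

-- The factor q^{n²} clears the negative exponents of (-q¹⁻²ⁿ; q²)_∞, whose Euler
-- expansion is ∑ⱼ q^{j² - 2nj} / (q²; q²)ⱼ.
H : ℕ → PowerSeries
H n = ∑ₛ (cauchy n)

∣n-j∣-bound : ∀ n j → j ≤ sq n ℕ.+ sq ∣ n - j ∣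
∣n-j∣-bound n j = ℕₚ.≤-trans (ℕₚ.m≤n+∣n-m∣ j n) (ℕₚ.+-mono-≤ (n≤n² n) (n≤n² ∣ n - j ∣))

cauchy-small : ∀ n → Small (cauchy n)
cauchy-small n j = Ord-*ˡ (q↑ e) (ι j) (Ord-≤ {f = q↑ e} (∣n-j∣-bound n j) (Ord-qᵏ e))
  where e = sq n ℕ.+ sq ∣ n - j ∣

-- This is (n - j - 1)² - (n - j)² = 2j + 1 - 2n, arranged without subtraction.
∣n-1+j∣² : ∀ n j → sq ∣ n - suc j ∣ ℕ.+ n ℕ.* 2 ≡ sq ∣ n - j ∣ ℕ.+ suc (j ℕ.* 2)
∣n-1+j∣² zero    j       = ℕS.solve 1 (λ j → (con 1 :+ j) :* (con 1 :+ j) :+ con 0 := j :* j :+ (con 1 :+ j :* con 2)) refl j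
  where open ℕS
∣n-1+j∣² (suc n) zero    = trans (cong (λ k → sq k ℕ.+ suc n ℕ.* 2) (ℕₚ.∣-∣-identityʳ n))
  (ℕS.solve 1 (λ n → n :* n :+ (con 1 :+ n) :* con 2 := (con 1 :+ n) :* (con 1 :+ n) :+ con 1) refl n)
  where open ℕS
∣n-1+j∣² (suc n) (suc j) = trans
  (ℕS.solve 2 (λ a b → a :+ (con 2 :+ b) := con 2 :+ (a :+ b)) refl (sq ∣ n - suc j ∣) (n ℕ.* 2))
  (trans (cong (λ k → suc (suc k)) (∣n-1+j∣² n j))
    (ℕS.solve 2 (λ a b → con 2 :+ (a :+ b) := a :+ (con 2 :+ b)) refl (sq ∣ n - j ∣) (suc (j ℕ.* 2))))
  where open ℕS using (_:+_; _:=_; con)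

-- With m = q²ⁿ⁺¹, the split 1 = (1 - y) + y for y = q²⁽ʲ⁺¹⁾ turns the term j + 1 into m times the
-- term j of `H n` plus m² times its term j + 1. The term 0 supplies the missing m² `cauchy n 0`, so
-- the total is (m + m²) `H n`.
H-suc : ∀ n → H (suc n) ≈ q↑ suc (n ℕ.* 2) *ₛ ((1ₛ +ₛ q↑ suc (n ℕ.* 2)) *ₛ H n)
H-suc n = begin
  H (suc n)
    ≈⟨ ∑ₛ-head (cauchy-small (suc n)) ⟩
  cauchy (suc n) 0 +ₛ ∑ₛ (λ j → cauchy (suc n) (suc j))
    ≈⟨ +ₛ-cong (≈-trans (*ₛ-congʳ (≈-sym (≈-trans (*ₛ-congʳ (qᵏ*qˡ refl)) (qᵏ*qˡ exponent₀)))) (*ₛ-assoc (m *ₛ m) _ (ι 0)))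
         (≈-trans (∑ₛ-cong term) (∑ₛ-+ _ _)) ⟩
  m *ₛ m *ₛ cauchy n 0 +ₛ (∑ₛ (λ j → m *ₛ cauchy n j) +ₛ ∑ₛ (λ j → m *ₛ m *ₛ cauchy n (suc j)))
    ≈⟨ +ₛ-congˡ (+ₛ-cong (*ₛ-∑ₛ m (cauchy-small n)) (*ₛ-∑ₛ (m *ₛ m) tail-small)) ⟨
  m *ₛ m *ₛ cauchy n 0 +ₛ (m *ₛ H n +ₛ m *ₛ m *ₛ ∑ₛ (λ j → cauchy n (suc j)))
    ≈⟨ RS.solve 4 (λ m a h s → m :* m :* a :+ (m :* h :+ m :* m :* s) := m :* (h :+ m :* (a :+ s))) ≈-refl m _ (H n) _ ⟩
  m *ₛ (H n +ₛ m *ₛ (cauchy n 0 +ₛ ∑ₛ (λ j → cauchy n (suc j))))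
    ≈⟨ *ₛ-congˡ (+ₛ-congˡ (*ₛ-congˡ (≈-sym (∑ₛ-head (cauchy-small n))))) ⟩
  m *ₛ (H n +ₛ m *ₛ H n)
    ≈⟨ RS.solve 2 (λ m h → m :* (h :+ m :* h) := m :* ((con 1ℤ :+ m) :* h)) ≈-refl m (H n) ⟩
  m *ₛ ((1ₛ +ₛ m) *ₛ H n) ∎
  where
  open RS using (_:*_; _:+_; _:-_; _:=_; con)
  m = q↑ suc (n ℕ.* 2)

  tail-small : Small (λ j → cauchy n (suc j))
  tail-small j = Ord-≤ {f = cauchy n (suc j)} (ℕₚ.n≤1+n j) (cauchy-small n (suc j))

  exponent₀ : suc (n ℕ.* 2) ℕ.+ suc (n ℕ.* 2) ℕ.+ (sq n ℕ.+ sq ∣ n - 0 ∣) ≡ sq (suc n) ℕ.+ sq (suc n)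
  exponent₀ = trans (cong (λ k → suc (n ℕ.* 2) ℕ.+ suc (n ℕ.* 2) ℕ.+ (sq n ℕ.+ sq k)) (ℕₚ.∣-∣-identityʳ n))
    (ℕS.solve 1 (λ n → let m = ℕS.con 1 ℕS.:+ n ℕS.:* ℕS.con 2 ; n+1 = ℕS.con 1 ℕS.:+ n in
      m ℕS.:+ m ℕS.:+ (n ℕS.:* n ℕS.:+ n ℕS.:* n) ℕS.:= n+1 ℕS.:* n+1 ℕS.:+ n+1 ℕS.:* n+1) refl n)

  term : ∀ j → cauchy (suc n) (suc j) ≈ m *ₛ cauchy n j +ₛ m *ₛ m *ₛ cauchy n (suc j)
  term j = begin
    cauchy (suc n) (suc j)
      ≈⟨ *ₛ-congʳ (qᵏ*qˡ exponent₁) ⟨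
    m *ₛ z *ₛ ι (suc j)
      ≈⟨ RS.solve 4 (λ m z c y → m :* z :* c := m :* (z :* ((con 1ℤ :- y) :* c)) :+ m :* z :* y :* c) ≈-refl m z (ι (suc j)) y ⟩
    m *ₛ (z *ₛ ((1ₛ -ₛ y) *ₛ ι (suc j))) +ₛ m *ₛ z *ₛ y *ₛ ι (suc j)
      ≈⟨ +ₛ-cong (*ₛ-congˡ (*ₛ-congˡ (ι-suc j)))
           (*ₛ-congʳ (≈-trans (*ₛ-congʳ (qᵏ*qˡ refl)) (qᵏ*qˡ refl))) ⟩
    m *ₛ cauchy n j +ₛ q↑ (suc (n ℕ.* 2) ℕ.+ (sq n ℕ.+ sq ∣ n - j ∣) ℕ.+ suc j ℕ.* 2) *ₛ ι (suc j)
      ≈⟨ +ₛ-congˡ (*ₛ-congʳ (≈-trans (*ₛ-congʳ (qᵏ*qˡ refl)) (qᵏ*qˡ exponent₂))) ⟨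
    m *ₛ cauchy n j +ₛ m *ₛ m *ₛ q↑ (sq n ℕ.+ sq ∣ n - suc j ∣) *ₛ ι (suc j)
      ≈⟨ +ₛ-congˡ (*ₛ-assoc (m *ₛ m) _ (ι (suc j))) ⟩
    m *ₛ cauchy n j +ₛ m *ₛ m *ₛ cauchy n (suc j) ∎
    where
    z = q↑ (sq n ℕ.+ sq ∣ n - j ∣)
    y = q↑ (suc j ℕ.* 2)
    exponent₁ : suc (n ℕ.* 2) ℕ.+ (sq n ℕ.+ sq ∣ n - j ∣) ≡ sq (suc n) ℕ.+ sq ∣ n - j ∣
    exponent₁ = ℕS.solve 2 (λ n d → ℕS.con 1 ℕS.:+ n ℕS.:* ℕS.con 2 ℕS.:+ (n ℕS.:* n ℕS.:+ d) ℕS.:=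
      (ℕS.con 1 ℕS.:+ n) ℕS.:* (ℕS.con 1 ℕS.:+ n) ℕS.:+ d) refl n (sq ∣ n - j ∣)
    exponent₂ : suc (n ℕ.* 2) ℕ.+ suc (n ℕ.* 2) ℕ.+ (sq n ℕ.+ sq ∣ n - suc j ∣) ≡
                suc (n ℕ.* 2) ℕ.+ (sq n ℕ.+ sq ∣ n - j ∣) ℕ.+ suc j ℕ.* 2
    exponent₂ = trans
      (ℕS.solve 3 (λ a b d → ℕS.con 1 ℕS.:+ a ℕS.:+ (ℕS.con 1 ℕS.:+ a) ℕS.:+ (b ℕS.:+ d) ℕS.:=
        ℕS.con 2 ℕS.:+ a ℕS.:+ b ℕS.:+ (d ℕS.:+ a)) refl (n ℕ.* 2) (sq n) (sq ∣ n - suc j ∣)) (trans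
      (cong (2 ℕ.+ n ℕ.* 2 ℕ.+ sq n ℕ.+_) (∣n-1+j∣² n j))
      (ℕS.solve 4 (λ a b d e → ℕS.con 2 ℕS.:+ a ℕS.:+ b ℕS.:+ (d ℕS.:+ (ℕS.con 1 ℕS.:+ e)) ℕS.:=
        ℕS.con 1 ℕS.:+ a ℕS.:+ (b ℕS.:+ d) ℕS.:+ (ℕS.con 2 ℕS.:+ e)) refl (n ℕ.* 2) (sq n) (sq ∣ n - j ∣) (j ℕ.* 2)))

-- Both sides obey the recursion of `H-suc`, and `H 0` is Euler's series itself. This makes `H n`
-- the numerator of the n-th summand of v₀ times (-q; q²)_∞.
H-product : ∀ n → H n ≈ q↑ sq n *ₛ pochhammer⁺ n *ₛ ep 0
H-product zero    = begin
  H 0                      ≈⟨ ∑ₛ-cong (λ j → ≈-trans (*ₛ-comm (q↑ sq j) (ι j)) (*ₛ-congˡ (qᵏ-cong (sym (ℕₚ.+-identityʳ (sq j)))))) ⟩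
  ep 0                     ≈⟨ *ₛ-identityˡ (ep 0) ⟨
  1ₛ *ₛ ep 0               ≈⟨ *ₛ-congʳ (≈-trans (*ₛ-congʳ q⁰≈1) (*ₛ-identityˡ 1ₛ)) ⟨
  q↑ 0 *ₛ 1ₛ *ₛ ep 0       ∎
H-product (suc n) = begin
  H (suc n)
    ≈⟨ ≈-trans (H-suc n) (*ₛ-congˡ (*ₛ-congˡ (H-product n))) ⟩
  m *ₛ ((1ₛ +ₛ m) *ₛ (q↑ sq n *ₛ pochhammer⁺ n *ₛ ep 0))
    ≈⟨ RS.solve 5 (λ m m+1 s p e → m :* (m+1 :* (s :* p :* e)) := m :* s :* (p :* m+1) :* e) ≈-refl m (1ₛ +ₛ m) (q↑ sq n) (pochhammer⁺ n) (ep 0) ⟩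
  m *ₛ q↑ sq n *ₛ pochhammer⁺ (suc n) *ₛ ep 0
    ≈⟨ *ₛ-congʳ (*ₛ-congʳ (qᵏ*qˡ exponent)) ⟩
  q↑ sq (suc n) *ₛ pochhammer⁺ (suc n) *ₛ ep 0 ∎
  where
  open RS using (_:*_; _:=_)
  m = q↑ suc (n ℕ.* 2)
  exponent : suc (n ℕ.* 2) ℕ.+ sq n ≡ sq (suc n)
  exponent = ℕS.solve 1 (λ n → ℕS.con 1 ℕS.:+ n ℕS.:* ℕS.con 2 ℕS.:+ n ℕS.:* n ℕS.:= (ℕS.con 1 ℕS.:+ n) ℕS.:* (ℕS.con 1 ℕS.:+ n)) refl n

-- Gauss's alternating sum

gauss-term : ℕ → ℕ → PowerSeries
gauss-term k i = sg i *ₛ (ι i *ₛ ι (k ∸ i))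

-- Times (q²; q²)ₖ this is the alternating sum of the Gaussian binomials [k, i] in base q². The
-- normalisation by (q²; q²)ₖ lets all recursions run through `ι-suc`.
gauss : ℕ → PowerSeries
gauss k = ∑ₖ k (gauss-term k)

-- With the auxiliary sum `R`, weighted by q²ⁱ, the two parts S - R and R - q²ᵏ⁺⁴ S of the left side
-- each drop one index. What they leave is -(S - R) at k + 1, to which the first relation applies
-- again, so that `R` disappears.
gauss-suc-suc : ∀ k → (1ₛ -ₛ q↑ (suc (suc k) ℕ.* 2)) *ₛ gauss (suc (suc k)) ≈ gauss k
gauss-one     : gauss 1 ≈ 0ₛ

private
  R : ℕ → PowerSeries
  R k = ∑ₖ k (λ i → q↑ (i ℕ.* 2) *ₛ gauss-term k i)

  -- 1 - q²⁽ⁱ⁺ʲ⁾ = (1 - q²ⁱ) + q²ⁱ (1 - q²ʲ), and each factor lowers an index of ιᵢ ιⱼ.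
  lower-i : ∀ k → gauss (suc k) -ₛ R (suc k) ≈ neg (gauss k)
  lower-i k = begin
    gauss (suc k) -ₛ R (suc k)
      ≈⟨ +ₛ-congˡ (∑ₖ-neg (suc k) _) ⟨
    gauss (suc k) +ₛ ∑ₖ (suc k) (λ i → neg (q↑ (i ℕ.* 2) *ₛ gauss-term (suc k) i))
      ≈⟨ ∑ₖ-+ (suc k) _ _ ⟨
    ∑ₖ (suc k) (λ i → gauss-term (suc k) i -ₛ q↑ (i ℕ.* 2) *ₛ gauss-term (suc k) i)
      ≈⟨ ∑ₖ-head k _ ⟩
    gauss-term (suc k) 0 -ₛ q↑ 0 *ₛ gauss-term (suc k) 0 +ₛ
      ∑ₖ k (λ i → gauss-term (suc k) (suc i) -ₛ q↑ (suc i ℕ.* 2) *ₛ gauss-term (suc k) (suc i))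
      ≈⟨ +ₛ-cong (≈-trans (+ₛ-congˡ (neg-cong (*ₛ-congʳ q⁰≈1)))
           (RS.solve 1 (λ c → c :- con 1ℤ :* c := con 0ℤ) ≈-refl (gauss-term (suc k) 0)))
           (∑ₖ-cong k λ i _ → term i) ⟩
    0ₛ +ₛ ∑ₖ k (λ i → neg (gauss-term k i))
      ≈⟨ ≈-trans (+ₛ-identityˡ _) (∑ₖ-neg k (gauss-term k)) ⟩
    neg (gauss k) ∎
    where
    open RS using (_:*_; _:-_; :-_; _:=_; con)
    term : ∀ i → gauss-term (suc k) (suc i) -ₛ q↑ (suc i ℕ.* 2) *ₛ gauss-term (suc k) (suc i) ≈ neg (gauss-term k i)
    term i = ≈-trans
      (RS.solve 4 (λ s a b y → :- s :* (a :* b) :- y :* (:- s :* (a :* b)) := :- (s :* ((con 1ℤ :- y) :* a :* b)))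
        ≈-refl (sg i) (ι (suc i)) (ι (k ∸ i)) (q↑ (suc i ℕ.* 2)))
      (neg-cong (*ₛ-congˡ (*ₛ-congʳ (ι-suc i))))

  lower-j : ∀ k → R (suc k) -ₛ q↑ (suc k ℕ.* 2) *ₛ gauss (suc k) ≈ R k
  lower-j k = begin
    R (suc k) -ₛ q↑ (suc k ℕ.* 2) *ₛ gauss (suc k)
      ≈⟨ +ₛ-congˡ (neg-cong (*ₛ-∑ₖ (q↑ (suc k ℕ.* 2)) (suc k) (gauss-term (suc k)))) ⟩
    R (suc k) -ₛ ∑ₖ (suc k) (λ i → q↑ (suc k ℕ.* 2) *ₛ gauss-term (suc k) i)
      ≈⟨ +ₛ-congˡ (∑ₖ-neg (suc k) _) ⟨
    R (suc k) +ₛ ∑ₖ (suc k) (λ i → neg (q↑ (suc k ℕ.* 2) *ₛ gauss-term (suc k) i))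
      ≈⟨ ∑ₖ-+ (suc k) _ _ ⟨
    ∑ₖ (suc k) (λ i → q↑ (i ℕ.* 2) *ₛ gauss-term (suc k) i -ₛ q↑ (suc k ℕ.* 2) *ₛ gauss-term (suc k) i)
      ≈⟨ ∑ₖ-last k _ ⟩
    ∑ₖ k (λ i → q↑ (i ℕ.* 2) *ₛ gauss-term (suc k) i -ₛ q↑ (suc k ℕ.* 2) *ₛ gauss-term (suc k) i) +ₛ
      (q↑ (suc k ℕ.* 2) *ₛ gauss-term (suc k) (suc k) -ₛ q↑ (suc k ℕ.* 2) *ₛ gauss-term (suc k) (suc k))
      ≈⟨ +ₛ-cong (∑ₖ-cong k term) (RS.solve 1 (λ x → x :- x := con 0ℤ) ≈-refl _) ⟩
    R k +ₛ 0ₛ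
      ≈⟨ +ₛ-identityʳ (R k) ⟩
    R k ∎
    where
    open RS using (_:*_; _:-_; :-_; _:=_; con)
    term : ∀ i → i ≤ k →
      q↑ (i ℕ.* 2) *ₛ gauss-term (suc k) i -ₛ q↑ (suc k ℕ.* 2) *ₛ gauss-term (suc k) i ≈
      q↑ (i ℕ.* 2) *ₛ gauss-term k i
    term i i≤k = begin
      x *ₛ gauss-term (suc k) i -ₛ q↑ (suc k ℕ.* 2) *ₛ gauss-term (suc k) i
        ≡⟨ cong (λ l → x *ₛ (sg i *ₛ (ι i *ₛ ι l)) -ₛ q↑ (suc k ℕ.* 2) *ₛ (sg i *ₛ (ι i *ₛ ι l))) (ℕₚ.+-∸-assoc 1 i≤k) ⟩
      x *ₛ c -ₛ q↑ (suc k ℕ.* 2) *ₛ c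
        ≈⟨ +ₛ-congˡ (neg-cong (*ₛ-congʳ (qᵏ*qˡ exponent))) ⟨
      x *ₛ c -ₛ x *ₛ y *ₛ c
        ≈⟨ RS.solve 5 (λ x y s a b → x :* (s :* (a :* b)) :- x :* y :* (s :* (a :* b)) := x :* (s :* (a :* ((con 1ℤ :- y) :* b))))
             ≈-refl x y (sg i) (ι i) (ι (suc (k ∸ i))) ⟩
      x *ₛ (sg i *ₛ (ι i *ₛ ((1ₛ -ₛ y) *ₛ ι (suc (k ∸ i)))))
        ≈⟨ *ₛ-congˡ (*ₛ-congˡ (*ₛ-congˡ (ι-suc (k ∸ i)))) ⟩
      x *ₛ gauss-term k i ∎
      where
      x = q↑ (i ℕ.* 2)
      y = q↑ (suc (k ∸ i) ℕ.* 2)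
      c = sg i *ₛ (ι i *ₛ ι (suc (k ∸ i)))
      exponent : i ℕ.* 2 ℕ.+ suc (k ∸ i) ℕ.* 2 ≡ suc k ℕ.* 2
      exponent = trans (sym (ℕₚ.*-distribʳ-+ 2 i (suc (k ∸ i))))
        (cong (ℕ._* 2) (trans (ℕₚ.+-suc i (k ∸ i)) (cong suc (ℕₚ.m+[n∸m]≡n i≤k))))

gauss-suc-suc k = begin
  (1ₛ -ₛ y) *ₛ S (suc (suc k))
    ≈⟨ RS.solve 5 (λ y s₂ s₁ s₀ r₂ → (con 1ℤ :- y) :* s₂ := (s₂ :- r₂) :+ (r₂ :- y :* s₂)) ≈-refl y (S (suc (suc k))) (S (suc k)) (S k) (R (suc (suc k))) ⟩
  S (suc (suc k)) -ₛ R (suc (suc k)) +ₛ (R (suc (suc k)) -ₛ y *ₛ S (suc (suc k)))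
    ≈⟨ +ₛ-cong (lower-i (suc k)) (lower-j (suc k)) ⟩
  neg (S (suc k)) +ₛ R (suc k)
    ≈⟨ RS.solve 2 (λ s r → :- s :+ r := :- (s :- r)) ≈-refl (S (suc k)) (R (suc k)) ⟩
  neg (S (suc k) -ₛ R (suc k))
    ≈⟨ neg-cong (lower-i k) ⟩
  neg (neg (S k))
    ≈⟨ RS.solve 1 (λ s → :- (:- s) := s) ≈-refl (S k) ⟩
  S k ∎
  where
  open RS using (_:*_; _:+_; _:-_; :-_; _:=_; con)
  S = gauss
  y = q↑ (suc (suc k) ℕ.* 2)

gauss-one = *ₛ-cancelˡ (1ₛ -ₛ q²) refl (begin
  (1ₛ -ₛ q²) *ₛ S 1
    ≈⟨ RS.solve 3 (λ y s r → (con 1ℤ :- y) :* s := (s :- r) :+ (r :- y :* s)) ≈-refl q² (S 1) (R 1) ⟩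
  S 1 -ₛ R 1 +ₛ (R 1 -ₛ q² *ₛ S 1)
    ≈⟨ +ₛ-cong (lower-i 0) (≈-trans (lower-j 0) (ptw λ n → at (≈-trans (*ₛ-congʳ q⁰≈1) (*ₛ-identityˡ (gauss-term 0 0))) n)) ⟩
  neg (S 0) +ₛ gauss-term 0 0
    ≈⟨ ptw (λ n → ℤₚ.+-inverseˡ (gauss-term 0 0 ! n)) ⟩
  0ₛ
    ≈⟨ *ₛ-zeroʳ (1ₛ -ₛ q²) ⟨
  (1ₛ -ₛ q²) *ₛ 0ₛ ∎)
  where
  open RS using (_:*_; _:+_; _:-_; :-_; _:=_; con)
  S = gauss

gauss-odd : ∀ m → gauss (suc (m ℕ.* 2)) ≈ 0ₛ
gauss-odd zero    = gauss-one
gauss-odd (suc m) = *ₛ-cancelˡ y refl (begin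
  y *ₛ gauss (suc (suc m ℕ.* 2))  ≈⟨ gauss-suc-suc (suc (m ℕ.* 2)) ⟩
  gauss (suc (m ℕ.* 2))           ≈⟨ gauss-odd m ⟩
  0ₛ                              ≈⟨ *ₛ-zeroʳ y ⟨
  y *ₛ 0ₛ                         ∎)
  where y = 1ₛ -ₛ q↑ (suc (suc (suc (m ℕ.* 2))) ℕ.* 2)

-- Only every second factor 1 - q²ᵏ is met, namely 1 - q⁴, 1 - q⁸, and so on; these are the factors
-- of (q²; q²)ₘ after q → q².
gauss-even : ∀ m → gauss (m ℕ.* 2) ≈ dbl (ι m)
gauss-even zero    = begin
  gauss 0                 ≈⟨ ptw (λ _ → refl) ⟩
  1ₛ *ₛ (ι 0 *ₛ ι 0)      ≈⟨ *ₛ-congˡ (*ₛ-cong ι-zero ι-zero) ⟩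
  1ₛ *ₛ (1ₛ *ₛ 1ₛ)        ≈⟨ RS.solve 0 (RS.con 1ℤ RS.:* (RS.con 1ℤ RS.:* RS.con 1ℤ) RS.:= RS.con 1ℤ) ≈-refl ⟩
  1ₛ                      ≈⟨ dbl-1 ⟨
  dbl 1ₛ                  ≈⟨ dbl-cong ι-zero ⟨
  dbl (ι 0)               ∎
gauss-even (suc m) = *ₛ-cancelˡ y refl (begin
  y *ₛ gauss (suc m ℕ.* 2)                      ≈⟨ gauss-suc-suc (m ℕ.* 2) ⟩
  gauss (m ℕ.* 2)                               ≈⟨ gauss-even m ⟩
  dbl (ι m)                                     ≈⟨ dbl-cong (ι-suc m) ⟨
  dbl ((1ₛ -ₛ q↑ (suc m ℕ.* 2)) *ₛ ι (suc m))   ≈⟨ dbl-* _ (ι (suc m)) ⟩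
  dbl (1ₛ -ₛ q↑ (suc m ℕ.* 2)) *ₛ dbl (ι (suc m))
    ≈⟨ *ₛ-congʳ (≈-trans (dbl-+ 1ₛ _) (+ₛ-cong dbl-1 (≈-trans (dbl-neg _) (neg-cong (dbl-qᵏ (suc m ℕ.* 2)))))) ⟩
  y *ₛ dbl (ι (suc m)) ∎)
  where y = 1ₛ -ₛ q↑ (suc m ℕ.* 2 ℕ.* 2)

-- Bilateral sums

r : ℕ → PowerSeries
r m = q↑ sq m

-- The parameter `u` is q^{m²} for the sum of v₀ and (-1)ᵐ q^{m²} for the relation between theta
-- functions and products; the two cases differ only in the evaluation of `Θ m m`.
module Bilateral (u : ℕ → PowerSeries) (u-order : ∀ m → Ord (sq m) (u m)) where

  -- `term⁻` is the summand at index -n: by evenness, |n - i| and n + j stand for -n + i and -n - j.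
  term⁺ term⁻ : ℕ → ℕ → ℕ → PowerSeries
  term⁺  i j n = u (n ℕ.+ i) *ₛ r ∣ n - j ∣
  term⁻ i j n = u ∣ n - i ∣ *ₛ r (n ℕ.+ j)

  -- With u and r extended to ℤ as even functions: ∑_{n ∈ ℤ} u (n + i) r (n - j).
  Θ : ℕ → ℕ → PowerSeries
  Θ i j = ∑ₛ (term⁺ i j) +ₛ ∑ₛ (λ n → term⁻ i j (suc n))

  private
    pos-order : ∀ i j n → Ord (sq (n ℕ.+ i) ℕ.+ sq ∣ n - j ∣) (term⁺ i j n)
    pos-order i j n = Ord-* (u (n ℕ.+ i)) (r ∣ n - j ∣) (u-order (n ℕ.+ i)) (Ord-qᵏ (sq ∣ n - j ∣))

    neg-order : ∀ i j n → Ord (sq ∣ n - i ∣ ℕ.+ sq (n ℕ.+ j)) (term⁻ i j n)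
    neg-order i j n = Ord-* (u ∣ n - i ∣) (r (n ℕ.+ j)) (u-order ∣ n - i ∣) (Ord-qᵏ (sq (n ℕ.+ j)))

    bound : ∀ n i j → i ℕ.+ j ≤ sq (n ℕ.+ i) ℕ.+ sq ∣ n - j ∣
    bound n i j = ℕₚ.≤-trans (ℕₚ.+-monoʳ-≤ i (ℕₚ.m≤n+∣n-m∣ j n)) (ℕₚ.≤-trans
      (ℕₚ.≤-reflexive (ℕS.solve 3 (λ i n d → i ℕS.:+ (n ℕS.:+ d) ℕS.:= n ℕS.:+ i ℕS.:+ d) refl i n ∣ n - j ∣))
      (ℕₚ.+-mono-≤ (n≤n² (n ℕ.+ i)) (n≤n² ∣ n - j ∣)))

  pos-small : ∀ i j → Small (term⁺ i j)
  pos-small i j n = Ord-≤ {f = term⁺ i j n} (ℕₚ.≤-trans (ℕₚ.m≤m+n n i)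
    (ℕₚ.≤-trans (n≤n² (n ℕ.+ i)) (ℕₚ.m≤m+n _ _))) (pos-order i j n)

  neg-small : ∀ i j → Small (term⁻ i j)
  neg-small i j n = Ord-≤ {f = term⁻ i j n} (ℕₚ.≤-trans (ℕₚ.m≤m+n n j)
    (ℕₚ.≤-trans (n≤n² (n ℕ.+ j)) (ℕₚ.m≤n+m _ _))) (neg-order i j n)

  neg-suc-small : ∀ i j → Small (λ n → term⁻ i j (suc n))
  neg-suc-small i j n = Ord-≤ {f = term⁻ i j (suc n)} (ℕₚ.n≤1+n n) (neg-small i j (suc n))

  -- By the triangle inequality i + j ≤ |n + i| + |n - j| for n of either sign, and a square is at
  -- least its root. This order is what permits the summation along i + j = k.
  Θ-order : ∀ i j → Ord (i ℕ.+ j) (Θ i j)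
  Θ-order i j = Ord-+ {f = ∑ₛ (term⁺ i j)} {g = ∑ₛ (λ n → term⁻ i j (suc n))}
    (∑ₛ-Ord {t = term⁺ i j} λ n → Ord-≤ {f = term⁺ i j n} (bound n i j) (pos-order i j n))
    (∑ₛ-Ord {t = λ n → term⁻ i j (suc n)} λ n → Ord-≤ {f = term⁻ i j (suc n)}
      (ℕₚ.≤-trans (ℕₚ.≤-trans (ℕₚ.≤-reflexive (ℕₚ.+-comm i j)) (bound (suc n) j i))
        (ℕₚ.≤-reflexive (ℕₚ.+-comm (sq (suc n ℕ.+ j)) (sq ∣ suc n - i ∣))))
      (neg-order i j (suc n)))

  -- The summation index in ℤ is shifted by one. The only term that changes halves is the one at
  -- index 0, where `term⁻` and `term⁺` are the same by computation.
  Θ-shift : ∀ i j → Θ (suc i) j ≈ Θ i (suc j)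
  Θ-shift i j = begin
    ∑ₛ (term⁺ (suc i) j) +ₛ ∑ₛ (λ n → term⁻ (suc i) j (suc n))
      ≈⟨ +ₛ-cong
           (∑ₛ-cong λ n → *ₛ-congʳ (≡⇒≈ (cong u (ℕₚ.+-suc n i))))
           (∑ₛ-cong λ n → *ₛ-congˡ (≡⇒≈ (cong r (sym (ℕₚ.+-suc n j))))) ⟩
    ∑ₛ (λ n → term⁺ i (suc j) (suc n)) +ₛ ∑ₛ (term⁻ i (suc j))
      ≈⟨ +ₛ-congˡ (∑ₛ-head (neg-small i (suc j))) ⟩
    ∑ₛ (λ n → term⁺ i (suc j) (suc n)) +ₛ (term⁺ i (suc j) 0 +ₛ ∑ₛ (λ n → term⁻ i (suc j) (suc n)))
      ≈⟨ RS.solve 3 (λ a b c → a RS.:+ (b RS.:+ c) RS.:= b RS.:+ a RS.:+ c) ≈-refl _ _ _ ⟩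
    term⁺ i (suc j) 0 +ₛ ∑ₛ (λ n → term⁺ i (suc j) (suc n)) +ₛ ∑ₛ (λ n → term⁻ i (suc j) (suc n))
      ≈⟨ +ₛ-congʳ (∑ₛ-head (pos-small i (suc j))) ⟨
    Θ i (suc j) ∎
    where
    ≡⇒≈ : ∀ {f g} → f ≡ g → f ≈ g
    ≡⇒≈ refl = ≈-refl

  Θ-diagonal : ∀ i j → Θ i j ≈ Θ 0 (i ℕ.+ j)
  Θ-diagonal zero    j = ≈-refl
  Θ-diagonal (suc i) j = begin
    Θ (suc i) j              ≈⟨ Θ-shift i j ⟩
    Θ i (suc j)              ≈⟨ Θ-diagonal i (suc j) ⟩
    Θ 0 (i ℕ.+ suc j)        ≡⟨ cong (Θ 0) (ℕₚ.+-suc i j) ⟩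
    Θ 0 (suc i ℕ.+ j)        ∎

  weight : ℕ → ℕ → PowerSeries
  weight i j = sg i *ₛ (ι i *ₛ ι j)

  -- Since `Θ i j` depends only on i + j, it factors out of each diagonal and leaves `gauss k`. The
  -- odd diagonals vanish; on the even ones `Θ 0 (m * 2)` is moved back to the symmetric `Θ m m`,
  -- where the parallelogram law applies.
  bilateral :
    ∑ₛ (λ n → ∑ₛ λ i → ∑ₛ λ j → weight i j *ₛ term⁺ i j n) +ₛ
    ∑ₛ (λ n → ∑ₛ λ i → ∑ₛ λ j → weight i j *ₛ term⁻ i j (suc n)) ≈
    ∑ₛ (λ m → dbl (ι m) *ₛ Θ m m)
  bilateral = begin
    ∑ₛ (λ n → ∑ₛ λ i → ∑ₛ λ j → weight i j *ₛ term⁺ i j n) +ₛ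
    ∑ₛ (λ n → ∑ₛ λ i → ∑ₛ λ j → weight i j *ₛ term⁻ i j (suc n))
      ≈⟨ +ₛ-cong (inward term⁺ pos-small) (inward (λ i j n → term⁻ i j (suc n)) neg-suc-small) ⟩
    ∑ₛ (λ i → ∑ₛ λ j → weight i j *ₛ ∑ₛ (term⁺ i j)) +ₛ
    ∑ₛ (λ i → ∑ₛ λ j → weight i j *ₛ ∑ₛ (λ n → term⁻ i j (suc n)))
      ≈⟨ ∑ₛ-+ _ _ ⟨
    ∑ₛ (λ i → ∑ₛ (λ j → weight i j *ₛ ∑ₛ (term⁺ i j)) +ₛ
      ∑ₛ (λ j → weight i j *ₛ ∑ₛ (λ n → term⁻ i j (suc n))))
      ≈⟨ ∑ₛ-cong (λ i → ≈-trans (≈-sym (∑ₛ-+ _ _)) (∑ₛ-cong λ j → ≈-sym (*ₛ-distribˡ (weight i j) _ _))) ⟩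
    ∑ₛ (λ i → ∑ₛ λ j → weight i j *ₛ Θ i j)
      ≈⟨ ∑ₛ-diagonal (λ i j → Ord-*ʳ (weight i j) (Θ i j) (Θ-order i j)) ⟩
    ∑ₛ (λ k → ∑ₖ k λ i → weight i (k ∸ i) *ₛ Θ i (k ∸ i))
      ≈⟨ ∑ₛ-cong collect ⟩
    ∑ₛ (λ k → Θ 0 k *ₛ gauss k)
      ≈⟨ ∑ₛ-even-odd (λ k → Ord-*ˡ (Θ 0 k) (gauss k) (Θ-order 0 k)) ⟩
    ∑ₛ (λ m → Θ 0 (m ℕ.* 2) *ₛ gauss (m ℕ.* 2)) +ₛ ∑ₛ (λ m → Θ 0 (suc (m ℕ.* 2)) *ₛ gauss (suc (m ℕ.* 2)))
      ≈⟨ +ₛ-cong (∑ₛ-cong even) (∑ₛ-0 λ m → ≈-trans (*ₛ-congˡ (gauss-odd m)) (*ₛ-zeroʳ _)) ⟩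
    ∑ₛ (λ m → dbl (ι m) *ₛ Θ m m) +ₛ 0ₛ
      ≈⟨ +ₛ-identityʳ _ ⟩
    ∑ₛ (λ m → dbl (ι m) *ₛ Θ m m) ∎
    where
    inward : ∀ (f : ℕ → ℕ → ℕ → PowerSeries) → (∀ i j → Small (f i j)) →
      ∑ₛ (λ n → ∑ₛ λ i → ∑ₛ λ j → weight i j *ₛ f i j n) ≈
      ∑ₛ (λ i → ∑ₛ λ j → weight i j *ₛ ∑ₛ (f i j))
    inward f small = ≈-trans
      (∑ₛ-swap (λ n i → ∑ₛ λ j → weight i j *ₛ f i j n))
      (∑ₛ-cong λ i → ≈-trans (∑ₛ-swap (λ n j → weight i j *ₛ f i j n))
        (∑ₛ-cong λ j → ≈-sym (*ₛ-∑ₛ (weight i j) (small i j))))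

    collect : ∀ k → ∑ₖ k (λ i → weight i (k ∸ i) *ₛ Θ i (k ∸ i)) ≈ Θ 0 k *ₛ gauss k
    collect k = ≈-trans
      (∑ₖ-cong k λ i i≤k → ≈-trans (*ₛ-comm (weight i (k ∸ i)) (Θ i (k ∸ i)))
        (*ₛ-congʳ (subst (λ l → Θ i (k ∸ i) ≈ Θ 0 l) (ℕₚ.m+[n∸m]≡n i≤k) (Θ-diagonal i (k ∸ i)))))
      (≈-sym (*ₛ-∑ₖ (Θ 0 k) k (gauss-term k)))

    even : ∀ m → Θ 0 (m ℕ.* 2) *ₛ gauss (m ℕ.* 2) ≈ dbl (ι m) *ₛ Θ m m
    even m = ≈-trans (*ₛ-comm (Θ 0 (m ℕ.* 2)) (gauss (m ℕ.* 2))) (*ₛ-cong (gauss-even m)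
      (≈-sym (subst (λ l → Θ m m ≈ Θ 0 l) (ℕS.solve 1 (λ m → m ℕS.:+ m ℕS.:= m ℕS.:* ℕS.con 2) refl m) (Θ-diagonal m m))))

-- Signs under q → -q, and the product of an Euler and a Cauchy term

Ord-neg : ∀ {k} f → Ord k f → Ord k (neg f)
Ord-neg f o n n<k = cong ℤ.-_ (o n n<k)

Ord-alt : ∀ {k} f → Ord k f → Ord k (alt f)
Ord-alt f o n n<k with parity n
... | inj₁ (m , refl) = trans (at (ev-alt f) m) (o n n<k)
... | inj₂ (m , refl) = trans (at (od-alt f) m) (cong ℤ.-_ (o n n<k))

sg² : ∀ n → sg n *ₛ sg n ≈ 1ₛ
sg² n = ≈-trans (≈-sym (sg-+ n n)) (sg-double n)

sg-sq : ∀ n → sg (sq n) ≈ sg n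
sg-sq zero    = ≈-refl
sg-sq (suc n) = begin
  sg (sq (suc n))                      ≡⟨ cong sg (ℕS.solve 1 (λ n → (con 1 :+ n) :* (con 1 :+ n) := con 1 :+ (n :* con 2 :+ n :* n)) refl n) ⟩
  neg (sg (n ℕ.* 2 ℕ.+ sq n))          ≈⟨ neg-cong (≈-trans (sg-+ (n ℕ.* 2) (sq n)) (*ₛ-cong (sg-*2 n) (sg-sq n))) ⟩
  neg (1ₛ *ₛ sg n)                     ≈⟨ neg-cong (*ₛ-identityˡ (sg n)) ⟩
  neg (sg n)                           ∎
  where open ℕS

sg-∣-∣ : ∀ n i → sg n *ₛ sg ∣ n - i ∣ ≈ sg i
sg-∣-∣ zero    i       = *ₛ-identityˡ (sg i)
sg-∣-∣ (suc n) zero    = sg² (suc n)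
sg-∣-∣ (suc n) (suc i) = ≈-trans
  (RS.solve 2 (λ a b → RS.:- a RS.:* b RS.:= RS.:- (a RS.:* b)) ≈-refl (sg n) (sg ∣ n - i ∣))
  (neg-cong (sg-∣-∣ n i))

dbl-sg : ∀ n → dbl (sg n) ≈ sg n
dbl-sg zero    = dbl-1
dbl-sg (suc n) = ≈-trans (dbl-neg (sg n)) (neg-cong (dbl-sg n))

alt-r : ∀ n → alt (r n) ≈ sg n *ₛ r n
alt-r n = ≈-trans (alt-qᵏ (sq n)) (*ₛ-congʳ (sg-sq n))

alt-euler : ∀ n i → alt (euler n i) ≈ sg i *ₛ euler n i
alt-euler n i = begin
  alt (ι i *ₛ q↑ k)            ≈⟨ alt-* (ι i) (q↑ k) ⟩
  alt (ι i) *ₛ alt (q↑ k)      ≈⟨ *ₛ-cong (alt-ι i) (alt-qᵏ k) ⟩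
  ι i *ₛ (sg k *ₛ q↑ k)        ≈⟨ *ₛ-congˡ (*ₛ-congʳ (≈-trans (sg-+ (sq i) (n ℕ.* i ℕ.* 2)) (*ₛ-cong (sg-sq i) (sg-*2 (n ℕ.* i))))) ⟩
  ι i *ₛ (sg i *ₛ 1ₛ *ₛ q↑ k)  ≈⟨ RS.solve 3 (λ c s x → c :* (s :* con 1ℤ :* x) := s :* (c :* x)) ≈-refl (ι i) (sg i) (q↑ k) ⟩
  sg i *ₛ euler n i            ∎
  where
  open RS using (_:*_; _:=_; con)
  k = i ℕ.* i ℕ.+ n ℕ.* i ℕ.* 2

alt-cauchy : ∀ n i → alt (cauchy n i) ≈ sg i *ₛ cauchy n i
alt-cauchy n i = begin
  alt (q↑ k *ₛ ι i)            ≈⟨ alt-* (q↑ k) (ι i) ⟩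
  alt (q↑ k) *ₛ alt (ι i)      ≈⟨ *ₛ-cong (alt-qᵏ k) (alt-ι i) ⟩
  sg k *ₛ q↑ k *ₛ ι i          ≈⟨ *ₛ-congʳ (*ₛ-congʳ (≈-trans (sg-+ (sq n) (sq ∣ n - i ∣))
                                    (≈-trans (*ₛ-cong (sg-sq n) (sg-sq ∣ n - i ∣)) (sg-∣-∣ n i)))) ⟩
  sg i *ₛ q↑ k *ₛ ι i          ≈⟨ *ₛ-assoc (sg i) (q↑ k) (ι i) ⟩
  sg i *ₛ cauchy n i           ∎
  where k = sq n ℕ.+ sq ∣ n - i ∣

-- Completing the square: i² + 2ni from Euler's factor and n² from Cauchy's make (n + i)².
euler-cauchy : ∀ n i j → euler n i *ₛ cauchy n j ≈ ι i *ₛ ι j *ₛ (r (n ℕ.+ i) *ₛ r ∣ n - j ∣)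
euler-cauchy n i j = begin
  ι i *ₛ q↑ k *ₛ (q↑ l *ₛ ι j)
    ≈⟨ RS.solve 4 (λ a b x y → a :* x :* (y :* b) := a :* b :* (x :* y)) ≈-refl (ι i) (ι j) (q↑ k) (q↑ l) ⟩
  ι i *ₛ ι j *ₛ (q↑ k *ₛ q↑ l)
    ≈⟨ *ₛ-congˡ (≈-trans (qᵏ*qˡ exponent) (qᵏ-+ (sq (n ℕ.+ i)) (sq ∣ n - j ∣))) ⟩
  ι i *ₛ ι j *ₛ (r (n ℕ.+ i) *ₛ r ∣ n - j ∣) ∎
  where
  open RS using (_:*_; _:=_)
  k = i ℕ.* i ℕ.+ n ℕ.* i ℕ.* 2
  l = sq n ℕ.+ sq ∣ n - j ∣
  exponent : k ℕ.+ l ≡ sq (n ℕ.+ i) ℕ.+ sq ∣ n - j ∣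
  exponent = ℕS.solve 3 (λ n i d → i ℕS.:* i ℕS.:+ n ℕS.:* i ℕS.:* ℕS.con 2 ℕS.:+ (n ℕS.:* n ℕS.:+ d) ℕS.:=
    (n ℕS.:+ i) ℕS.:* (n ℕS.:+ i) ℕS.:+ d) refl n i (sq ∣ n - j ∣)

-- Theta functions

-- φ(q) = ∑_{n ∈ ℤ} q^{n²}
φ : PowerSeries
φ = ∑ₛ r +ₛ ∑ₛ (λ n → r (suc n))

r-small : Small r
r-small n = Ord-≤ {f = r n} (n≤n² n) (Ord-qᵏ (sq n))

r-suc-small : Small (λ n → r (suc n))
r-suc-small n = Ord-≤ {f = r (suc n)} (ℕₚ.n≤1+n n) (r-small (suc n))

em : ℕ → PowerSeries
em n = alt (ep n)

H-zero : H 0 ≈ ep 0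
H-zero = ≈-trans (H-product 0) (≈-trans
  (*ₛ-congʳ (≈-trans (*ₛ-congʳ q⁰≈1) (*ₛ-identityˡ 1ₛ))) (*ₛ-identityˡ (ep 0)))

H-order : ∀ n → Ord (sq n) (H n)
H-order n = Ord-≈ (≈-trans (≈-sym (*ₛ-assoc (r n) (pochhammer⁺ n) (ep 0))) (≈-sym (H-product n)))
  (Ord-*ˡ (r n) (pochhammer⁺ n *ₛ ep 0) (Ord-qᵏ (sq n)))

-- With q → -q in neither factor, the dependence on n collapses to q^{n²}. Weighted by (-1)ⁿ and
-- summed over n ∈ ℤ, these products therefore give (-q; q²)_∞² φ(-q).
ep-H : ∀ n → ep n *ₛ H n ≈ ep 0 *ₛ ep 0 *ₛ r n
ep-H n = begin
  ep n *ₛ H n                                      ≈⟨ *ₛ-congˡ (H-product n) ⟩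
  ep n *ₛ (r n *ₛ pochhammer⁺ n *ₛ ep 0)           ≈⟨ RS.solve 4 (λ e r p e₀ → e :* (r :* p :* e₀) := p :* e :* e₀ :* r) ≈-refl (ep n) (r n) (pochhammer⁺ n) (ep 0) ⟩
  pochhammer⁺ n *ₛ ep n *ₛ ep 0 *ₛ r n             ≈⟨ *ₛ-congʳ (*ₛ-congʳ (pochhammer⁺-ep n)) ⟩
  ep 0 *ₛ ep 0 *ₛ r n                              ∎
  where open RS using (_:*_; _:=_)

parallelogram : ∀ n m → sq (n ℕ.+ m) ℕ.+ sq ∣ n - m ∣ ≡ (sq n ℕ.+ sq m) ℕ.* 2
parallelogram zero    m       = ℕS.solve 1 (λ m → m ℕS.:* m ℕS.:+ m ℕS.:* m ℕS.:= (m ℕS.:* m) ℕS.:* ℕS.con 2) refl m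
parallelogram (suc n) zero    = ℕS.solve 1 (λ n → (n ℕS.:+ ℕS.con 0) ℕS.:* (n ℕS.:+ ℕS.con 0) ℕS.:+ n ℕS.:* n ℕS.:= (n ℕS.:* n ℕS.:+ ℕS.con 0) ℕS.:* ℕS.con 2) refl (suc n)
parallelogram (suc n) (suc m) = trans
  (ℕS.solve 3 (λ n m d → (con 1 :+ n :+ (con 1 :+ m)) :* (con 1 :+ n :+ (con 1 :+ m)) :+ d :=
    con 4 :+ con 4 :* (n :+ m) :+ ((n :+ m) :* (n :+ m) :+ d)) refl n m (sq ∣ n - m ∣))
  (trans (cong (4 ℕ.+ 4 ℕ.* (n ℕ.+ m) ℕ.+_) (parallelogram n m))
  (ℕS.solve 2 (λ n m → con 4 :+ con 4 :* (n :+ m) :+ (n :* n :+ m :* m) :* con 2 :=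
    ((con 1 :+ n) :* (con 1 :+ n) :+ (con 1 :+ m) :* (con 1 :+ m)) :* con 2) refl n m))
  where open ℕS

-- The parallelogram law separates n from m, so that for `u` = `r` the sum `Θ m m` is q^{m²} φ(q)
-- after q → q².
r-parallelogram : ∀ n m → r (n ℕ.+ m) *ₛ r ∣ n - m ∣ ≈ dbl (r m *ₛ r n)
r-parallelogram n m = begin
  r (n ℕ.+ m) *ₛ r ∣ n - m ∣       ≈⟨ qᵏ*qˡ (parallelogram n m) ⟩
  q↑ ((sq n ℕ.+ sq m) ℕ.* 2)       ≈⟨ dbl-qᵏ (sq n ℕ.+ sq m) ⟨
  dbl (q↑ (sq n ℕ.+ sq m))         ≈⟨ dbl-cong (≈-trans (qᵏ-+ (sq n) (sq m)) (*ₛ-comm (r n) (r m))) ⟩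
  dbl (r m *ₛ r n)                 ∎

r*φ : ∀ m → ∑ₛ (λ n → dbl (r m *ₛ r n)) +ₛ ∑ₛ (λ n → dbl (r m *ₛ r (suc n))) ≈ dbl (r m *ₛ φ)
r*φ m = begin
  ∑ₛ (λ n → dbl (r m *ₛ r n)) +ₛ ∑ₛ (λ n → dbl (r m *ₛ r (suc n)))
    ≈⟨ +ₛ-cong (pull r r-small) (pull (λ n → r (suc n)) r-suc-small) ⟩
  dbl (r m *ₛ ∑ₛ r) +ₛ dbl (r m *ₛ ∑ₛ (λ n → r (suc n)))
    ≈⟨ dbl-+ _ _ ⟨
  dbl (r m *ₛ ∑ₛ r +ₛ r m *ₛ ∑ₛ (λ n → r (suc n)))
    ≈⟨ dbl-cong (*ₛ-distribˡ (r m) _ _) ⟨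
  dbl (r m *ₛ φ) ∎
  where
  pull : ∀ t → Small t → ∑ₛ (λ n → dbl (r m *ₛ t n)) ≈ dbl (r m *ₛ ∑ₛ t)
  pull t small = ≈-trans (≈-sym (∑ₛ-dbl λ n → Ord-*ʳ (r m) (t n) (small n)))
    (dbl-cong (≈-sym (*ₛ-∑ₛ (r m) small)))

ιr-small : Small (λ m → ι m *ₛ r m)
ιr-small m = Ord-*ʳ (ι m) (r m) (r-small m)

-- The sum over m that remains once `Θ m m` is evaluated is Euler's series again.
∑-ιrφ : ∑ₛ (λ m → ι m *ₛ (r m *ₛ φ)) ≈ ep 0 *ₛ φ
∑-ιrφ = begin
  ∑ₛ (λ m → ι m *ₛ (r m *ₛ φ))   ≈⟨ ∑ₛ-cong (λ m → ≈-sym (*ₛ-assoc (ι m) (r m) φ)) ⟩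
  ∑ₛ (λ m → ι m *ₛ r m *ₛ φ)     ≈⟨ ∑ₛ-*ₛ φ ιr-small ⟨
  ∑ₛ (λ m → ι m *ₛ r m) *ₛ φ     ≈⟨ *ₛ-congʳ (∑ₛ-cong λ m → *ₛ-congˡ (qᵏ-cong (sym (ℕₚ.+-identityʳ (sq m))))) ⟩
  ep 0 *ₛ φ                      ∎

ιrφ-small : Small (λ m → ι m *ₛ (r m *ₛ φ))
ιrφ-small m = Ord-*ʳ (ι m) (r m *ₛ φ) (Ord-*ˡ (r m) φ (r-small m))

module _ where
  open Bilateral r (λ m → Ord-qᵏ (sq m))

  -- In the half with q → -q the sign moves from Euler's factor to Cauchy's, since n² + (n - i)² has
  -- the parity of i. The index carrying (-1)ⁱ thus belongs to `euler` in one half and to `cauchy`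
  -- in the other, which matches the exchange of roles in `term⁻`.
  ∑-em-H : ∑ₛ (λ n → em n *ₛ H n) +ₛ ∑ₛ (λ n → alt (em (suc n) *ₛ H (suc n))) ≈ dbl (ep 0 *ₛ φ)
  ∑-em-H = begin
    ∑ₛ (λ n → em n *ₛ H n) +ₛ ∑ₛ (λ n → alt (em (suc n) *ₛ H (suc n)))
      ≈⟨ +ₛ-cong (∑ₛ-cong expand⁺) (∑ₛ-cong λ n → expand⁻ (suc n)) ⟩
    ∑ₛ (λ n → ∑ₛ λ i → ∑ₛ λ j → weight i j *ₛ term⁺ i j n) +ₛ
    ∑ₛ (λ n → ∑ₛ λ i → ∑ₛ λ j → weight i j *ₛ term⁻ i j (suc n))
      ≈⟨ bilateral ⟩
    ∑ₛ (λ m → dbl (ι m) *ₛ Θ m m)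
      ≈⟨ ∑ₛ-cong (λ m → ≈-trans (*ₛ-congˡ (Θ-eval m)) (≈-sym (dbl-* (ι m) (r m *ₛ φ)))) ⟩
    ∑ₛ (λ m → dbl (ι m *ₛ (r m *ₛ φ)))
      ≈⟨ ≈-trans (≈-sym (∑ₛ-dbl ιrφ-small)) (dbl-cong ∑-ιrφ) ⟩
    dbl (ep 0 *ₛ φ) ∎
    where
    open RS using (_:*_; _:=_)

    expand⁺ : ∀ n → em n *ₛ H n ≈ ∑ₛ (λ i → ∑ₛ λ j → weight i j *ₛ term⁺ i j n)
    expand⁺ n = begin
      alt (ep n) *ₛ H n
        ≈⟨ *ₛ-congʳ (∑ₛ-alt (euler n)) ⟩
      ∑ₛ (λ i → alt (euler n i)) *ₛ H n
        ≈⟨ ∑ₛ-* (λ i → Ord-alt (euler n i) (euler-small n i)) (cauchy-small n) ⟩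
      ∑ₛ (λ i → ∑ₛ λ j → alt (euler n i) *ₛ cauchy n j)
        ≈⟨ ∑ₛ-cong (λ i → ∑ₛ-cong λ j → begin
             alt (euler n i) *ₛ cauchy n j       ≈⟨ *ₛ-congʳ (alt-euler n i) ⟩
             sg i *ₛ euler n i *ₛ cauchy n j     ≈⟨ *ₛ-assoc (sg i) _ _ ⟩
             sg i *ₛ (euler n i *ₛ cauchy n j)   ≈⟨ *ₛ-congˡ (euler-cauchy n i j) ⟩
             sg i *ₛ (ι i *ₛ ι j *ₛ term⁺ i j n)   ≈⟨ *ₛ-assoc (sg i) _ _ ⟨
             weight i j *ₛ term⁺ i j n             ∎) ⟩
      ∑ₛ (λ i → ∑ₛ λ j → weight i j *ₛ term⁺ i j n) ∎

    expand⁻ : ∀ n → alt (em n *ₛ H n) ≈ ∑ₛ (λ i → ∑ₛ λ j → weight i j *ₛ term⁻ i j n)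
    expand⁻ n = begin
      alt (alt (ep n) *ₛ H n)
        ≈⟨ ≈-trans (alt-* _ _) (*ₛ-cong (alt-alt (ep n)) (∑ₛ-alt (cauchy n))) ⟩
      ep n *ₛ ∑ₛ (λ i → alt (cauchy n i))
        ≈⟨ *ₛ-comm _ _ ⟩
      ∑ₛ (λ i → alt (cauchy n i)) *ₛ ep n
        ≈⟨ ∑ₛ-* (λ i → Ord-alt (cauchy n i) (cauchy-small n i)) (euler-small n) ⟩
      ∑ₛ (λ i → ∑ₛ λ j → alt (cauchy n i) *ₛ euler n j)
        ≈⟨ ∑ₛ-cong (λ i → ∑ₛ-cong λ j → begin
             alt (cauchy n i) *ₛ euler n j       ≈⟨ *ₛ-congʳ (alt-cauchy n i) ⟩
             sg i *ₛ cauchy n i *ₛ euler n j     ≈⟨ RS.solve 3 (λ s c e → s :* c :* e := s :* (e :* c)) ≈-refl (sg i) (cauchy n i) (euler n j) ⟩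
             sg i *ₛ (euler n j *ₛ cauchy n i)   ≈⟨ *ₛ-congˡ (euler-cauchy n j i) ⟩
             sg i *ₛ (ι j *ₛ ι i *ₛ (r (n ℕ.+ j) *ₛ r ∣ n - i ∣))
               ≈⟨ RS.solve 5 (λ s a b x y → s :* (b :* a :* (x :* y)) := s :* (a :* b) :* (y :* x)) ≈-refl (sg i) (ι i) (ι j) (r (n ℕ.+ j)) (r ∣ n - i ∣) ⟩
             weight i j *ₛ term⁻ i j n            ∎) ⟩
      ∑ₛ (λ i → ∑ₛ λ j → weight i j *ₛ term⁻ i j n) ∎

    Θ-eval : ∀ m → Θ m m ≈ dbl (r m *ₛ φ)
    Θ-eval m = ≈-trans
      (+ₛ-cong (∑ₛ-cong λ n → r-parallelogram n m)
        (∑ₛ-cong λ n → ≈-trans (*ₛ-comm _ _) (r-parallelogram (suc n) m)))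
      (r*φ m)

module _ where
  open Bilateral (λ m → sg m *ₛ r m) (λ m → Ord-*ʳ (sg m) (r m) (Ord-qᵏ (sq m)))

  -- The sign (-1)ⁿ of φ(-q) is distributed as (-1)ⁱ (-1)ⁿ⁺ⁱ: the first factor supplies the
  -- alternating weight of Gauss's sum, and the second is absorbed into `u`.
  ep²-φ : ep 0 *ₛ ep 0 *ₛ alt φ ≈ dbl (alt (ep 0 *ₛ φ))
  ep²-φ = begin
    ep 0 *ₛ ep 0 *ₛ alt φ
      ≈⟨ *ₛ-congˡ (≈-trans (alt-+ _ _) (+ₛ-cong (∑ₛ-alt r) (∑ₛ-alt (λ n → r (suc n))))) ⟩
    ep 0 *ₛ ep 0 *ₛ (∑ₛ (λ n → alt (r n)) +ₛ ∑ₛ (λ n → alt (r (suc n))))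
      ≈⟨ ≈-trans (*ₛ-distribˡ _ _ _) (+ₛ-cong
           (*ₛ-∑ₛ (ep 0 *ₛ ep 0) λ n → Ord-alt (r n) (r-small n))
           (*ₛ-∑ₛ (ep 0 *ₛ ep 0) λ n → Ord-alt (r (suc n)) (r-suc-small n))) ⟩
    ∑ₛ (λ n → ep 0 *ₛ ep 0 *ₛ alt (r n)) +ₛ ∑ₛ (λ n → ep 0 *ₛ ep 0 *ₛ alt (r (suc n)))
      ≈⟨ +ₛ-cong (∑ₛ-cong λ n → ≈-trans (unfold n) (expand⁺ n)) (∑ₛ-cong λ n → ≈-trans (unfold (suc n)) (expand⁻ (suc n))) ⟩
    ∑ₛ (λ n → ∑ₛ λ i → ∑ₛ λ j → weight i j *ₛ term⁺ i j n) +ₛ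
    ∑ₛ (λ n → ∑ₛ λ i → ∑ₛ λ j → weight i j *ₛ term⁻ i j (suc n))
      ≈⟨ bilateral ⟩
    ∑ₛ (λ m → dbl (ι m) *ₛ Θ m m)
      ≈⟨ ∑ₛ-cong (λ m → begin
           dbl (ι m) *ₛ Θ m m                      ≈⟨ *ₛ-cong (dbl-cong (≈-sym (alt-ι m))) (Θ-eval m) ⟩
           dbl (alt (ι m)) *ₛ dbl (alt (r m *ₛ φ)) ≈⟨ dbl-* _ _ ⟨
           dbl (alt (ι m) *ₛ alt (r m *ₛ φ))       ≈⟨ dbl-cong (alt-* _ _) ⟨
           dbl (alt (ι m *ₛ (r m *ₛ φ)))           ∎) ⟩
    ∑ₛ (λ m → dbl (alt (ι m *ₛ (r m *ₛ φ))))
      ≈⟨ ∑ₛ-dbl (λ m → Ord-alt (ι m *ₛ (r m *ₛ φ)) (ιrφ-small m)) ⟨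
    dbl (∑ₛ (λ m → alt (ι m *ₛ (r m *ₛ φ))))
      ≈⟨ dbl-cong (≈-trans (≈-sym (∑ₛ-alt _)) (alt-cong ∑-ιrφ)) ⟩
    dbl (alt (ep 0 *ₛ φ)) ∎
    where
    open RS using (_:*_; _:=_)

    unfold : ∀ n → ep 0 *ₛ ep 0 *ₛ alt (r n) ≈ sg n *ₛ (ep n *ₛ H n)
    unfold n = begin
      ep 0 *ₛ ep 0 *ₛ alt (r n)            ≈⟨ *ₛ-congˡ (alt-r n) ⟩
      ep 0 *ₛ ep 0 *ₛ (sg n *ₛ r n)        ≈⟨ RS.solve 3 (λ e s r → e :* (s :* r) := s :* (e :* r)) ≈-refl (ep 0 *ₛ ep 0) (sg n) (r n) ⟩
      sg n *ₛ (ep 0 *ₛ ep 0 *ₛ r n)        ≈⟨ *ₛ-congˡ (ep-H n) ⟨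
      sg n *ₛ (ep n *ₛ H n)                ∎

    sg-pos : ∀ n i → sg n ≈ sg i *ₛ sg (n ℕ.+ i)
    sg-pos n i = begin
      sg n                      ≈⟨ *ₛ-identityʳ (sg n) ⟨
      sg n *ₛ 1ₛ                ≈⟨ *ₛ-congˡ (sg² i) ⟨
      sg n *ₛ (sg i *ₛ sg i)    ≈⟨ RS.solve 2 (λ n i → n :* (i :* i) := i :* (n :* i)) ≈-refl (sg n) (sg i) ⟩
      sg i *ₛ (sg n *ₛ sg i)    ≈⟨ *ₛ-congˡ (sg-+ n i) ⟨
      sg i *ₛ sg (n ℕ.+ i)      ∎

    sg-neg : ∀ n i → sg n ≈ sg i *ₛ sg ∣ n - i ∣
    sg-neg n i = begin
      sg n                                     ≈⟨ *ₛ-identityʳ (sg n) ⟨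
      sg n *ₛ 1ₛ                               ≈⟨ *ₛ-congˡ (sg² ∣ n - i ∣) ⟨
      sg n *ₛ (sg ∣ n - i ∣ *ₛ sg ∣ n - i ∣)   ≈⟨ *ₛ-assoc _ _ _ ⟨
      sg n *ₛ sg ∣ n - i ∣ *ₛ sg ∣ n - i ∣     ≈⟨ *ₛ-congʳ (sg-∣-∣ n i) ⟩
      sg i *ₛ sg ∣ n - i ∣                     ∎

    sg-∣-∣-+ : ∀ n m → sg ∣ n - m ∣ ≈ sg (n ℕ.+ m)
    sg-∣-∣-+ n m = begin
      sg ∣ n - m ∣                       ≈⟨ *ₛ-identityˡ _ ⟨
      1ₛ *ₛ sg ∣ n - m ∣                 ≈⟨ *ₛ-congʳ (sg² n) ⟨
      sg n *ₛ sg n *ₛ sg ∣ n - m ∣       ≈⟨ *ₛ-assoc _ _ _ ⟩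
      sg n *ₛ (sg n *ₛ sg ∣ n - m ∣)     ≈⟨ *ₛ-congˡ (sg-∣-∣ n m) ⟩
      sg n *ₛ sg m                       ≈⟨ sg-+ n m ⟨
      sg (n ℕ.+ m)                       ∎

    expand⁺ : ∀ n → sg n *ₛ (ep n *ₛ H n) ≈ ∑ₛ (λ i → ∑ₛ λ j → weight i j *ₛ term⁺ i j n)
    expand⁺ n = begin
      sg n *ₛ (ep n *ₛ H n)
        ≈⟨ *ₛ-assoc _ _ _ ⟨
      sg n *ₛ ep n *ₛ H n
        ≈⟨ *ₛ-congʳ (*ₛ-∑ₛ (sg n) (euler-small n)) ⟩
      ∑ₛ (λ i → sg n *ₛ euler n i) *ₛ H n
        ≈⟨ ∑ₛ-* (λ i → Ord-*ʳ (sg n) (euler n i) (euler-small n i)) (cauchy-small n) ⟩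
      ∑ₛ (λ i → ∑ₛ λ j → sg n *ₛ euler n i *ₛ cauchy n j)
        ≈⟨ ∑ₛ-cong (λ i → ∑ₛ-cong λ j → begin
             sg n *ₛ euler n i *ₛ cauchy n j       ≈⟨ *ₛ-assoc _ _ _ ⟩
             sg n *ₛ (euler n i *ₛ cauchy n j)     ≈⟨ *ₛ-cong (sg-pos n i) (euler-cauchy n i j) ⟩
             sg i *ₛ sg (n ℕ.+ i) *ₛ (ι i *ₛ ι j *ₛ (r (n ℕ.+ i) *ₛ r ∣ n - j ∣))
               ≈⟨ RS.solve 6 (λ s t a b x y → s :* t :* (a :* b :* (x :* y)) := s :* (a :* b) :* (t :* x :* y)) ≈-refl
                    (sg i) (sg (n ℕ.+ i)) (ι i) (ι j) (r (n ℕ.+ i)) (r ∣ n - j ∣) ⟩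
             weight i j *ₛ term⁺ i j n               ∎) ⟩
      ∑ₛ (λ i → ∑ₛ λ j → weight i j *ₛ term⁺ i j n) ∎

    expand⁻ : ∀ n → sg n *ₛ (ep n *ₛ H n) ≈ ∑ₛ (λ i → ∑ₛ λ j → weight i j *ₛ term⁻ i j n)
    expand⁻ n = begin
      sg n *ₛ (ep n *ₛ H n)
        ≈⟨ RS.solve 3 (λ s e h → s :* (e :* h) := s :* h :* e) ≈-refl (sg n) (ep n) (H n) ⟩
      sg n *ₛ H n *ₛ ep n
        ≈⟨ *ₛ-congʳ (*ₛ-∑ₛ (sg n) (cauchy-small n)) ⟩
      ∑ₛ (λ i → sg n *ₛ cauchy n i) *ₛ ep n
        ≈⟨ ∑ₛ-* (λ i → Ord-*ʳ (sg n) (cauchy n i) (cauchy-small n i)) (euler-small n) ⟩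
      ∑ₛ (λ i → ∑ₛ λ j → sg n *ₛ cauchy n i *ₛ euler n j)
        ≈⟨ ∑ₛ-cong (λ i → ∑ₛ-cong λ j → begin
             sg n *ₛ cauchy n i *ₛ euler n j       ≈⟨ RS.solve 3 (λ s c e → s :* c :* e := s :* (e :* c)) ≈-refl (sg n) (cauchy n i) (euler n j) ⟩
             sg n *ₛ (euler n j *ₛ cauchy n i)     ≈⟨ *ₛ-cong (sg-neg n i) (euler-cauchy n j i) ⟩
             sg i *ₛ sg ∣ n - i ∣ *ₛ (ι j *ₛ ι i *ₛ (r (n ℕ.+ j) *ₛ r ∣ n - i ∣))
               ≈⟨ RS.solve 6 (λ s t a b x y → s :* t :* (b :* a :* (x :* y)) := s :* (a :* b) :* (t :* y :* x)) ≈-refl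
                    (sg i) (sg ∣ n - i ∣) (ι i) (ι j) (r (n ℕ.+ j)) (r ∣ n - i ∣) ⟩
             weight i j *ₛ term⁻ i j n              ∎) ⟩
      ∑ₛ (λ i → ∑ₛ λ j → weight i j *ₛ term⁻ i j n) ∎

    signed : ∀ n m → sg (n ℕ.+ m) *ₛ (r (n ℕ.+ m) *ₛ r ∣ n - m ∣) ≈ dbl (alt (r m *ₛ r n))
    signed n m = begin
      sg (n ℕ.+ m) *ₛ (r (n ℕ.+ m) *ₛ r ∣ n - m ∣)
        ≈⟨ *ₛ-cong (≈-sym (dbl-sg (n ℕ.+ m))) (r-parallelogram n m) ⟩
      dbl (sg (n ℕ.+ m)) *ₛ dbl (r m *ₛ r n)
        ≈⟨ dbl-* _ _ ⟨
      dbl (sg (n ℕ.+ m) *ₛ (r m *ₛ r n))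
        ≈⟨ dbl-cong (begin
             sg (n ℕ.+ m) *ₛ (r m *ₛ r n)          ≈⟨ *ₛ-congʳ (sg-+ n m) ⟩
             sg n *ₛ sg m *ₛ (r m *ₛ r n)          ≈⟨ RS.solve 4 (λ s t x y → s :* t :* (y :* x) := t :* y :* (s :* x)) ≈-refl (sg n) (sg m) (r n) (r m) ⟩
             sg m *ₛ r m *ₛ (sg n *ₛ r n)          ≈⟨ *ₛ-cong (alt-r m) (alt-r n) ⟨
             alt (r m) *ₛ alt (r n)                ≈⟨ alt-* _ _ ⟨
             alt (r m *ₛ r n)                      ∎) ⟩
      dbl (alt (r m *ₛ r n)) ∎

    Θ-eval : ∀ m → Θ m m ≈ dbl (alt (r m *ₛ φ))
    Θ-eval m = begin
      Θ m m
        ≈⟨ +ₛ-cong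
             (∑ₛ-cong λ n → ≈-trans (*ₛ-assoc _ _ _) (signed n m))
             (∑ₛ-cong λ n → ≈-trans (≈-trans (*ₛ-congʳ (*ₛ-congʳ (sg-∣-∣-+ (suc n) m)))
               (RS.solve 3 (λ s x y → s :* x :* y := s :* (y :* x)) ≈-refl (sg (suc n ℕ.+ m)) (r ∣ suc n - m ∣) (r (suc n ℕ.+ m))))
               (signed (suc n) m)) ⟩
      ∑ₛ (λ n → dbl (alt (r m *ₛ r n))) +ₛ ∑ₛ (λ n → dbl (alt (r m *ₛ r (suc n))))
        ≈⟨ +ₛ-cong (pull r r-small) (pull (λ n → r (suc n)) r-suc-small) ⟩
      dbl (alt (r m *ₛ ∑ₛ r)) +ₛ dbl (alt (r m *ₛ ∑ₛ (λ n → r (suc n))))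
        ≈⟨ ≈-trans (dbl-cong (alt-+ _ _)) (dbl-+ _ _) ⟨
      dbl (alt (r m *ₛ ∑ₛ r +ₛ r m *ₛ ∑ₛ (λ n → r (suc n))))
        ≈⟨ dbl-cong (alt-cong (*ₛ-distribˡ (r m) _ _)) ⟨
      dbl (alt (r m *ₛ φ)) ∎
      where
      pull : ∀ t → Small t → ∑ₛ (λ n → dbl (alt (r m *ₛ t n))) ≈ dbl (alt (r m *ₛ ∑ₛ t))
      pull t small = begin
        ∑ₛ (λ n → dbl (alt (r m *ₛ t n)))   ≈⟨ ∑ₛ-dbl (λ n → Ord-alt (r m *ₛ t n) (Ord-*ʳ (r m) (t n) (small n))) ⟨
        dbl (∑ₛ (λ n → alt (r m *ₛ t n)))   ≈⟨ dbl-cong (∑ₛ-alt _) ⟨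
        dbl (alt (∑ₛ (λ n → r m *ₛ t n)))   ≈⟨ dbl-cong (alt-cong (*ₛ-∑ₛ (r m) small)) ⟨
        dbl (alt (r m *ₛ ∑ₛ t))             ∎

-- Both sides are ∏ cₙ, since the tails xₙ and yₙ agree to higher and higher order.
product-unique : ∀ (c x y : ℕ → PowerSeries) →
  (∀ n → x n ≈ c n *ₛ x (suc n)) → (∀ n → y n ≈ c n *ₛ y (suc n)) →
  (∀ n → Ord (suc n) (x n -ₛ y n)) → x 0 ≈ y 0
product-unique c x y x-step y-step close = ptw λ n → trans (at (split n) n)
  (trans (cong (λ s → (∏c n *ₛ y n) ! n ℤ.+ s) (Ord-*ʳ (∏c n) (x n -ₛ y n) (close n) n (ℕₚ.n<1+n n)))
  (trans (ℤₚ.+-identityʳ _) (sym (at (unroll y y-step n) n))))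
  where
  open RS using (_:*_; _:+_; _:-_; _:=_)

  ∏c : ℕ → PowerSeries
  ∏c zero    = 1ₛ
  ∏c (suc n) = ∏c n *ₛ c n

  unroll : ∀ z → (∀ n → z n ≈ c n *ₛ z (suc n)) → ∀ n → z 0 ≈ ∏c n *ₛ z n
  unroll z step zero    = ≈-sym (*ₛ-identityˡ (z 0))
  unroll z step (suc n) = ≈-trans (unroll z step n)
    (≈-trans (*ₛ-congˡ (step n)) (≈-sym (*ₛ-assoc (∏c n) (c n) (z (suc n)))))

  split : ∀ n → x 0 ≈ ∏c n *ₛ y n +ₛ ∏c n *ₛ (x n -ₛ y n)
  split n = ≈-trans (unroll x x-step n)
    (RS.solve 3 (λ p x y → p :* x := p :* y :+ p :* (x :- y)) ≈-refl (∏c n) (x n) (y n))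

alt-1+q : ∀ n → alt (1ₛ +ₛ q↑ suc (n ℕ.* 2)) ≈ 1ₛ -ₛ q↑ suc (n ℕ.* 2)
alt-1+q n = begin
  alt (1ₛ +ₛ m)              ≈⟨ alt-+ 1ₛ m ⟩
  alt 1ₛ +ₛ alt m            ≈⟨ +ₛ-cong alt-1 (≈-trans (alt-qᵏ (suc (n ℕ.* 2))) (*ₛ-congʳ (neg-cong (sg-*2 n)))) ⟩
  1ₛ +ₛ neg 1ₛ *ₛ m          ≈⟨ RS.solve 1 (λ m → con 1ℤ :+ :- con 1ℤ :* m := con 1ℤ :- m) ≈-refl m ⟩
  1ₛ -ₛ m                    ∎
  where
  open RS using (_:*_; _:+_; _:-_; :-_; _:=_; con)
  m = q↑ suc (n ℕ.* 2)

em-suc : ∀ n → em n ≈ (1ₛ -ₛ q↑ suc (n ℕ.* 2)) *ₛ em (suc n)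
em-suc n = ≈-trans (alt-cong (ep-suc n)) (≈-trans (alt-* _ _) (*ₛ-congʳ (alt-1+q n)))

-- Because (1 + q²ⁿ⁺¹)(1 - q²ⁿ⁺¹) = 1 - q⁴ⁿ⁺², both sides unfold with the same factors, and the two
-- tails agree below order n + 1, being 1 there.
ep*em : ep 0 *ₛ em 0 ≈ dbl (em 0)
ep*em = product-unique (λ n → 1ₛ -ₛ q↑ (suc (n ℕ.* 2) ℕ.* 2)) (λ n → ep n *ₛ em n) (λ n → dbl (em n))
  x-step y-step close
  where
  open RS using (_:*_; _:+_; _:-_; :-_; _:=_; con)

  x-step : ∀ n → ep n *ₛ em n ≈ (1ₛ -ₛ q↑ (suc (n ℕ.* 2) ℕ.* 2)) *ₛ (ep (suc n) *ₛ em (suc n))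
  x-step n = begin
    ep n *ₛ em n
      ≈⟨ *ₛ-cong (ep-suc n) (em-suc n) ⟩
    (1ₛ +ₛ m) *ₛ ep (suc n) *ₛ ((1ₛ -ₛ m) *ₛ em (suc n))
      ≈⟨ RS.solve 3 (λ m a b → (con 1ℤ :+ m) :* a :* ((con 1ℤ :- m) :* b) := (con 1ℤ :- m :* m) :* (a :* b)) ≈-refl m (ep (suc n)) (em (suc n)) ⟩
    (1ₛ -ₛ m *ₛ m) *ₛ (ep (suc n) *ₛ em (suc n))
      ≈⟨ *ₛ-congʳ (+ₛ-congˡ (neg-cong (qᵏ*qˡ (ℕS.solve 1 (λ k → k ℕS.:+ k ℕS.:= k ℕS.:* ℕS.con 2) refl (suc (n ℕ.* 2)))))) ⟩
    (1ₛ -ₛ q↑ (suc (n ℕ.* 2) ℕ.* 2)) *ₛ (ep (suc n) *ₛ em (suc n)) ∎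
    where m = q↑ suc (n ℕ.* 2)

  y-step : ∀ n → dbl (em n) ≈ (1ₛ -ₛ q↑ (suc (n ℕ.* 2) ℕ.* 2)) *ₛ dbl (em (suc n))
  y-step n = ≈-trans (dbl-cong (em-suc n)) (≈-trans (dbl-* _ _) (*ₛ-congʳ
    (≈-trans (dbl-+ _ _) (+ₛ-cong dbl-1 (≈-trans (dbl-neg _) (neg-cong (dbl-qᵏ (suc (n ℕ.* 2)))))))))

  h : ℕ → PowerSeries
  h n = ∑ₛ (λ i → euler n (suc i))

  h-order : ∀ n → Ord (suc n) (h n)
  h-order n = ∑ₛ-Ord {t = λ i → euler n (suc i)} λ i →
    Ord-*ʳ (ι (suc i)) (q↑ (sq (suc i) ℕ.+ n ℕ.* suc i ℕ.* 2))
      (Ord-≤ {f = q↑ (sq (suc i) ℕ.+ n ℕ.* suc i ℕ.* 2)} (bound i)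
        (Ord-qᵏ (sq (suc i) ℕ.+ n ℕ.* suc i ℕ.* 2)))
    where
    bound : ∀ i → suc n ≤ sq (suc i) ℕ.+ n ℕ.* suc i ℕ.* 2
    bound i = ℕₚ.+-mono-≤ {1} (s≤s z≤n) (ℕₚ.≤-trans (ℕₚ.m≤m*n n (suc i)) (ℕₚ.m≤m*n (n ℕ.* suc i) 2))

  ep≈1+h : ∀ n → ep n ≈ 1ₛ +ₛ h n
  ep≈1+h n = ≈-trans (∑ₛ-head (euler-small n)) (+ₛ-congʳ (begin
    ι 0 *ₛ q↑ (n ℕ.* 0 ℕ.* 2)  ≈⟨ *ₛ-cong ι-zero (≈-trans (qᵏ-cong (cong (ℕ._* 2) (ℕₚ.*-zeroʳ n))) q⁰≈1) ⟩
    1ₛ *ₛ 1ₛ                   ≈⟨ *ₛ-identityˡ 1ₛ ⟩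
    1ₛ                         ∎))

  em≈1+h : ∀ n → em n ≈ 1ₛ +ₛ alt (h n)
  em≈1+h n = ≈-trans (alt-cong (ep≈1+h n)) (≈-trans (alt-+ _ _) (+ₛ-congʳ alt-1))

  close : ∀ n → Ord (suc n) (ep n *ₛ em n -ₛ dbl (em n))
  close n = Ord-≈ (≈-sym (begin
    ep n *ₛ em n -ₛ dbl (em n)
      ≈⟨ +ₛ-cong (*ₛ-cong (ep≈1+h n) (em≈1+h n))
           (neg-cong (≈-trans (dbl-cong (em≈1+h n)) (≈-trans (dbl-+ _ _) (+ₛ-congʳ dbl-1)))) ⟩
    (1ₛ +ₛ a) *ₛ (1ₛ +ₛ b) -ₛ (1ₛ +ₛ c)
      ≈⟨ RS.solve 3 (λ a b c → (con 1ℤ :+ a) :* (con 1ℤ :+ b) :- (con 1ℤ :+ c) := a :* (con 1ℤ :+ b) :+ (b :- c)) ≈-refl a b c ⟩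
    a *ₛ (1ₛ +ₛ b) +ₛ (b -ₛ c) ∎))
    (Ord-+ {f = a *ₛ (1ₛ +ₛ b)} {g = b -ₛ c} (Ord-*ˡ a (1ₛ +ₛ b) a-order)
      (Ord-+ {f = b} {g = neg c} b-order (Ord-neg c (Ord-dbl {f = b} b-order))))
    where
    a = h n
    b = alt (h n)
    c = dbl (alt (h n))
    a-order = h-order n
    b-order = Ord-alt (h n) (h-order n)

-- The generating function of v₀

summand : ℕ → PowerSeries
summand n = ⟪ (q^ (n ℕ.* n)) *ˢ poch (negˢ (q^ 1)) (q^ 2) n /ˢ poch (q^ 1) (q^ 2) n ⟫

v : PowerSeries
v = ∑ₛ summand

private
  power : ∀ n → ⟪ q^ 2 ^ˢ n ⟫ ≈ q↑ (n ℕ.* 2)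
  power zero    = ≈-trans (ptw λ _ → refl) (≈-sym q⁰≈1)
  power (suc n) = begin
    ⟪ q^ 2 ^ˢ suc n ⟫          ≈⟨ ptw (λ _ → refl) ⟩
    ⟪ q^ 2 ^ˢ n ⟫ *ₛ q²        ≈⟨ *ₛ-congʳ (power n) ⟩
    q↑ (n ℕ.* 2) *ₛ q²         ≈⟨ *ₛ-comm _ _ ⟩
    q² *ₛ q↑ (n ℕ.* 2)         ≈⟨ qᵏ-+ 2 (n ℕ.* 2) ⟨
    q↑ (suc n ℕ.* 2)           ∎

poch⁺ : ∀ n → ⟪ poch (negˢ (q^ 1)) (q^ 2) n ⟫ ≈ pochhammer⁺ n
poch⁺ zero    = ptw λ _ → refl
poch⁺ (suc n) = begin
  ⟪ poch (negˢ (q^ 1)) (q^ 2) (suc n) ⟫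
    ≈⟨ ptw (λ _ → refl) ⟩
  ⟪ poch (negˢ (q^ 1)) (q^ 2) n ⟫ *ₛ (1ₛ -ₛ neg q *ₛ ⟪ q^ 2 ^ˢ n ⟫)
    ≈⟨ *ₛ-cong (poch⁺ n) (+ₛ-congˡ (neg-cong (*ₛ-congˡ (power n)))) ⟩
  pochhammer⁺ n *ₛ (1ₛ -ₛ neg q *ₛ q↑ (n ℕ.* 2))
    ≈⟨ *ₛ-congˡ (RS.solve 2 (λ q x → con 1ℤ :- :- q :* x := con 1ℤ :+ q :* x) ≈-refl q (q↑ (n ℕ.* 2))) ⟩
  pochhammer⁺ n *ₛ (1ₛ +ₛ q *ₛ q↑ (n ℕ.* 2))
    ≈⟨ *ₛ-congˡ (+ₛ-congˡ (qᵏ*qˡ refl)) ⟩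
  pochhammer⁺ (suc n) ∎
  where open RS using (_:*_; _:+_; _:-_; :-_; _:=_; con)

poch⁻ : ∀ n → ⟪ poch (q^ 1) (q^ 2) n ⟫ ≈ alt (pochhammer⁺ n)
poch⁻ zero    = ≈-trans (ptw λ _ → refl) (≈-sym alt-1)
poch⁻ (suc n) = begin
  ⟪ poch (q^ 1) (q^ 2) (suc n) ⟫
    ≈⟨ ptw (λ _ → refl) ⟩
  ⟪ poch (q^ 1) (q^ 2) n ⟫ *ₛ (1ₛ -ₛ q *ₛ ⟪ q^ 2 ^ˢ n ⟫)
    ≈⟨ *ₛ-cong (poch⁻ n) (+ₛ-congˡ (neg-cong (≈-trans (*ₛ-congˡ (power n)) (qᵏ*qˡ refl)))) ⟩
  alt (pochhammer⁺ n) *ₛ (1ₛ -ₛ q↑ suc (n ℕ.* 2))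
    ≈⟨ *ₛ-congˡ (alt-1+q n) ⟨
  alt (pochhammer⁺ n) *ₛ alt (1ₛ +ₛ q↑ suc (n ℕ.* 2))
    ≈⟨ alt-* _ _ ⟨
  alt (pochhammer⁺ (suc n)) ∎

alt-pochhammer⁺-unit : ∀ n → alt (pochhammer⁺ n) ! 0 ≡ 1ℤ
alt-pochhammer⁺-unit zero    = refl
alt-pochhammer⁺-unit (suc n) = trans (ℤₚ.*-identityʳ (pochhammer⁺ n ! 0)) (alt-pochhammer⁺-unit n)

summand-spec : ∀ n → alt (pochhammer⁺ n) *ₛ summand n ≈ r n *ₛ pochhammer⁺ n
summand-spec n = begin
  alt (pochhammer⁺ n) *ₛ summand n
    ≈⟨ *ₛ-congʳ (poch⁻ n) ⟨
  ⟪ poch (q^ 1) (q^ 2) n ⟫ *ₛ summand n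
    ≈⟨ *ₛ-congˡ (ptw λ _ → refl) ⟩
  ⟪ poch (q^ 1) (q^ 2) n ⟫ *ₛ (⟪ (q^ (n ℕ.* n)) *ˢ poch (negˢ (q^ 1)) (q^ 2) n ⟫ /ₛ ⟪ poch (q^ 1) (q^ 2) n ⟫)
    ≈⟨ *-/ₛ _ _ (trans (at (poch⁻ n) 0) (alt-pochhammer⁺-unit n)) ⟩
  ⟪ (q^ (n ℕ.* n)) *ˢ poch (negˢ (q^ 1)) (q^ 2) n ⟫
    ≈⟨ ptw (λ _ → refl) ⟩
  r n *ₛ ⟪ poch (negˢ (q^ 1)) (q^ 2) n ⟫
    ≈⟨ *ₛ-congˡ (poch⁺ n) ⟩
  r n *ₛ pochhammer⁺ n ∎

summand-small : Small summand
summand-small n = Ord-≈ (≈-sym (*ₛ-cancelˡ d (alt-pochhammer⁺-unit n) (begin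
  d *ₛ summand n                             ≈⟨ summand-spec n ⟩
  r n *ₛ pochhammer⁺ n                       ≈⟨ *ₛ-identityˡ _ ⟨
  1ₛ *ₛ (r n *ₛ pochhammer⁺ n)               ≈⟨ *ₛ-congʳ (*-inv d (alt-pochhammer⁺-unit n)) ⟨
  d *ₛ inv d *ₛ (r n *ₛ pochhammer⁺ n)       ≈⟨ RS.solve 4 (λ d i r p → d :* i :* (r :* p) := d :* (r :* (p :* i))) ≈-refl d (inv d) (r n) (pochhammer⁺ n) ⟩
  d *ₛ (r n *ₛ (pochhammer⁺ n *ₛ inv d))     ∎)))
  (Ord-*ˡ (r n) (pochhammer⁺ n *ₛ inv d) (r-small n))
  where
  open RS using (_:*_; _:=_)
  d = alt (pochhammer⁺ n)

-- a = φ(q), b = φ(-q), E = (-q; q²)_∞ and hence em 0 = (q; q²)_∞.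
a b E : PowerSeries
a = φ
b = alt φ
E = ep 0

E-unit : E ! 0 ≡ 1ℤ
E-unit = refl

E*em-unit : (E *ₛ em 0) ! 0 ≡ 1ℤ
E*em-unit = refl

-- (q; q²)_∞ cancels the denominator (q; q²)ₙ and leaves its tail `em n`, while (-q; q²)_∞ completes
-- the numerator to `H n`.
e-summand : ∀ n → E *ₛ em 0 *ₛ summand n ≈ em n *ₛ H n
e-summand n = begin
  E *ₛ em 0 *ₛ summand n
    ≈⟨ *ₛ-congʳ (*ₛ-congˡ (≈-trans (alt-cong (≈-sym (pochhammer⁺-ep n))) (alt-* _ _))) ⟩
  E *ₛ (d *ₛ em n) *ₛ summand n
    ≈⟨ RS.solve 4 (λ e d m t → e :* (d :* m) :* t := m :* (d :* t :* e)) ≈-refl E d (em n) (summand n) ⟩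
  em n *ₛ (d *ₛ summand n *ₛ E)
    ≈⟨ *ₛ-congˡ (*ₛ-congʳ (summand-spec n)) ⟩
  em n *ₛ (r n *ₛ pochhammer⁺ n *ₛ E)
    ≈⟨ *ₛ-congˡ (H-product n) ⟨
  em n *ₛ H n ∎
  where
  open RS using (_:*_; _:=_)
  d = alt (pochhammer⁺ n)

-- The series 2 ∑ v₀(2n) qⁿ - 1.
v-even : PowerSeries
v-even = ev v +ₛ ev v -ₛ 1ₛ

alt-e : alt (E *ₛ em 0) ≈ E *ₛ em 0
alt-e = ≈-trans (alt-* _ _) (≈-trans (*ₛ-congˡ (alt-alt E)) (*ₛ-comm _ _))

e*v : E *ₛ em 0 *ₛ v ≈ ∑ₛ (λ n → em n *ₛ H n)
e*v = ≈-trans (*ₛ-∑ₛ (E *ₛ em 0) summand-small) (∑ₛ-cong e-summand)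

-- After q → q² the series `v-even` is v(q) + v(-q) - 1. The summands of v(-q) are the terms of
-- negative index of the bilateral sum, and the -1 takes away the second copy of index 0.
em*v-even : em 0 *ₛ v-even ≈ E *ₛ a
em*v-even = begin
  em 0 *ₛ v-even              ≈⟨ ev-dbl _ ⟨
  ev (dbl (em 0 *ₛ v-even))   ≈⟨ ev-cong doubled ⟩
  ev (dbl (E *ₛ a))           ≈⟨ ev-dbl _ ⟩
  E *ₛ a                      ∎
  where
  open RS using (_:*_; _:+_; _:-_; _:=_; con)

  dbl-v-even : dbl v-even ≈ v +ₛ alt v -ₛ 1ₛ
  dbl-v-even = ev-od-ext
    (≈-trans (ev-dbl v-even) (ptw λ n → cong₂ ℤ._+_ (cong (λ s → ev v ! n ℤ.+ s) (sym (at (ev-alt v) n))) (1-even n)))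
    (≈-trans (od-dbl v-even) (ptw λ n → sym (trans (ℤₚ.+-identityʳ _)
      (trans (cong (λ s → od v ! n ℤ.+ s) (at (od-alt v) n)) (ℤₚ.+-inverseʳ (od v ! n))))))
    where
    1-even : ∀ n → ℤ.- (1ₛ ! n) ≡ ℤ.- (1ₛ ! (n ℕ.* 2))
    1-even zero    = refl
    1-even (suc n) = refl

  doubled : dbl (em 0 *ₛ v-even) ≈ dbl (E *ₛ a)
  doubled = begin
    dbl (em 0 *ₛ v-even)
      ≈⟨ dbl-* _ _ ⟩
    dbl (em 0) *ₛ dbl v-even
      ≈⟨ *ₛ-cong (≈-sym ep*em) dbl-v-even ⟩
    E *ₛ em 0 *ₛ (v +ₛ alt v -ₛ 1ₛ)
      ≈⟨ RS.solve 3 (λ e v w → e :* (v :+ w :- con 1ℤ) := e :* v :+ (e :* w :- e)) ≈-refl (E *ₛ em 0) v (alt v) ⟩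
    E *ₛ em 0 *ₛ v +ₛ (E *ₛ em 0 *ₛ alt v -ₛ E *ₛ em 0)
      ≈⟨ +ₛ-cong e*v (begin
           E *ₛ em 0 *ₛ alt v -ₛ E *ₛ em 0
             ≈⟨ +ₛ-congʳ (≈-trans (*ₛ-congʳ (≈-sym alt-e)) (≈-trans (≈-sym (alt-* _ _)) (≈-trans (alt-cong e*v) (∑ₛ-alt _)))) ⟩
           ∑ₛ (λ n → alt (em n *ₛ H n)) -ₛ E *ₛ em 0
             ≈⟨ +ₛ-congʳ (∑ₛ-head λ n → Ord-alt (em n *ₛ H n) (Ord-≤ {f = em n *ₛ H n} (n≤n² n) (Ord-*ʳ (em n) (H n) (H-order n)))) ⟩
           alt (em 0 *ₛ H 0) +ₛ ∑ₛ (λ n → alt (em (suc n) *ₛ H (suc n))) -ₛ E *ₛ em 0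
             ≈⟨ +ₛ-congʳ (+ₛ-congʳ (≈-trans (alt-cong (≈-trans (*ₛ-congˡ H-zero) (*ₛ-comm _ _))) alt-e)) ⟩
           E *ₛ em 0 +ₛ ∑ₛ (λ n → alt (em (suc n) *ₛ H (suc n))) -ₛ E *ₛ em 0
             ≈⟨ RS.solve 2 (λ e s → e :+ s :- e := s) ≈-refl (E *ₛ em 0) _ ⟩
           ∑ₛ (λ n → alt (em (suc n) *ₛ H (suc n))) ∎) ⟩
    ∑ₛ (λ n → em n *ₛ H n) +ₛ ∑ₛ (λ n → alt (em (suc n) *ₛ H (suc n)))
      ≈⟨ ∑-em-H ⟩
    dbl (E *ₛ a) ∎

-- One factor E of `ep²-φ` can be cancelled because (q²; q⁴)_∞ = (-q; q²)_∞ (q; q²)_∞.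
E*b : E *ₛ b ≈ em 0 *ₛ dbl b
E*b = *ₛ-cancelˡ E E-unit (begin
  E *ₛ (E *ₛ b)              ≈⟨ *ₛ-assoc E E b ⟨
  E *ₛ E *ₛ b                ≈⟨ ep²-φ ⟩
  dbl (alt (E *ₛ φ))         ≈⟨ ≈-trans (dbl-cong (alt-* E φ)) (dbl-* _ _) ⟩
  dbl (em 0) *ₛ dbl b        ≈⟨ *ₛ-congʳ ep*em ⟨
  E *ₛ em 0 *ₛ dbl b         ≈⟨ *ₛ-assoc _ _ _ ⟩
  E *ₛ (em 0 *ₛ dbl b)       ∎)

em*a : em 0 *ₛ a ≈ E *ₛ dbl b
em*a = begin
  em 0 *ₛ a                       ≈⟨ *ₛ-congˡ (alt-alt φ) ⟨
  em 0 *ₛ alt b                   ≈⟨ alt-* _ _ ⟨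
  alt (E *ₛ b)                    ≈⟨ alt-cong E*b ⟩
  alt (em 0 *ₛ dbl b)             ≈⟨ alt-* _ _ ⟩
  alt (em 0) *ₛ alt (dbl b)       ≈⟨ *ₛ-cong (alt-alt E) (alt-dbl b) ⟩
  E *ₛ dbl b                      ∎

v-even*dbl-b : v-even *ₛ dbl b ≈ a *ₛ a
v-even*dbl-b = *ₛ-cancelˡ (E *ₛ em 0) E*em-unit (begin
  E *ₛ em 0 *ₛ (v-even *ₛ dbl b)       ≈⟨ RS.solve 4 (λ e m v d → e :* m :* (v :* d) := m :* v :* (e :* d)) ≈-refl E (em 0) v-even (dbl b) ⟩
  em 0 *ₛ v-even *ₛ (E *ₛ dbl b)       ≈⟨ *ₛ-cong em*v-even (≈-sym em*a) ⟩
  E *ₛ a *ₛ (em 0 *ₛ a)                ≈⟨ RS.solve 3 (λ e m a → e :* a :* (m :* a) := e :* m :* (a :* a)) ≈-refl E (em 0) a ⟩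
  E *ₛ em 0 *ₛ (a *ₛ a)                ∎)
  where open RS using (_:*_; _:=_)

a*b : a *ₛ b ≈ dbl b *ₛ dbl b
a*b = *ₛ-cancelˡ (E *ₛ em 0) E*em-unit (begin
  E *ₛ em 0 *ₛ (a *ₛ b)                ≈⟨ RS.solve 4 (λ e m a b → e :* m :* (a :* b) := m :* a :* (e :* b)) ≈-refl E (em 0) a b ⟩
  em 0 *ₛ a *ₛ (E *ₛ b)                ≈⟨ *ₛ-cong em*a E*b ⟩
  E *ₛ dbl b *ₛ (em 0 *ₛ dbl b)        ≈⟨ RS.solve 3 (λ e m d → e :* d :* (m :* d) := e :* m :* (d :* d)) ≈-refl E (em 0) (dbl b) ⟩
  E *ₛ em 0 *ₛ (dbl b *ₛ dbl b)        ∎)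
  where open RS using (_:*_; _:=_)

-- Even and odd parts of φ and φ²

ev-q : ev q ≈ 0ₛ
ev-q = ptw λ { zero → refl ; (suc _) → refl }

od-q : od q ≈ 1ₛ
od-q = ptw λ { zero → refl ; (suc _) → refl }

ev-q*dbl : ∀ g → ev (q *ₛ dbl g) ≈ 0ₛ
ev-q*dbl g = ≈-trans (ev-* q (dbl g)) (≈-trans
  (+ₛ-cong (*ₛ-congʳ ev-q) (*ₛ-congˡ (*ₛ-congˡ (od-dbl g))))
  (RS.solve 3 (λ x q z → con 0ℤ :* x :+ q :* (z :* con 0ℤ) := con 0ℤ) ≈-refl (ev (dbl g)) q (od q)))
  where open RS using (_:*_; _:+_; _:=_; con)

od-q*dbl : ∀ g → od (q *ₛ dbl g) ≈ g
od-q*dbl g = ≈-trans (od-* q (dbl g)) (≈-trans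
  (+ₛ-cong (*ₛ-congʳ ev-q) (*ₛ-cong od-q (ev-dbl g)))
  (RS.solve 2 (λ x g → con 0ℤ :* x :+ con 1ℤ :* g := g) ≈-refl (od (dbl g)) g))
  where open RS using (_:*_; _:+_; _:=_; con)

odd-form : ∀ {f} → ev f ≈ 0ₛ → f ≈ q *ₛ dbl (od f)
odd-form {f} ev-f = ev-od-ext (≈-trans ev-f (≈-sym (ev-q*dbl (od f)))) (≈-sym (od-q*dbl (od f)))

alt-q*dbl : ∀ g → alt (q *ₛ dbl g) ≈ neg (q *ₛ dbl g)
alt-q*dbl g = ≈-trans (alt-* q (dbl g)) (≈-trans (*ₛ-cong alt-q (alt-dbl g))
  (RS.solve 2 (λ q d → RS.:- q RS.:* d RS.:= RS.:- (q RS.:* d)) ≈-refl q (dbl g)))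

ev-dbl-* : ∀ f g → ev (dbl f *ₛ g) ≈ f *ₛ ev g
ev-dbl-* f g = ≈-trans (ev-* (dbl f) g) (≈-trans
  (+ₛ-cong (*ₛ-congʳ (ev-dbl f)) (*ₛ-congˡ (*ₛ-congʳ (od-dbl f))))
  (RS.solve 4 (λ f g q z → f :* g :+ q :* (con 0ℤ :* z) := f :* g) ≈-refl f (ev g) q (od g)))
  where open RS using (_:*_; _:+_; _:=_; con)

ev-+ : ∀ f g → ev (f +ₛ g) ≈ ev f +ₛ ev g
ev-+ f g = ptw λ _ → refl

oddSquares : PowerSeries
oddSquares = ∑ₛ (λ n → r (suc (n ℕ.* 2)))

ev-oddSquares : ev oddSquares ≈ 0ₛ
ev-oddSquares = ptw λ N → ∑-0 (N ℕ.* 2) λ n _ → at (ev-r n) N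
  where
  ev-r : ∀ n → ev (r (suc (n ℕ.* 2))) ≈ 0ₛ
  ev-r n = begin
    ev (q↑ sq (suc (n ℕ.* 2)))             ≡⟨ cong (λ k → ev (q↑ k)) (ℕS.solve 1 (λ n → let m = con 1 :+ n :* con 2 in m :* m := con 1 :+ (n :* m :+ n) :* con 2) refl n) ⟩
    ev (q↑ suc (k ℕ.* 2))                  ≈⟨ ev-cong (≈-trans (qᵏ-+ 1 (k ℕ.* 2)) (*ₛ-congˡ (≈-sym (dbl-qᵏ k)))) ⟩
    ev (q *ₛ dbl (q↑ k))                   ≈⟨ ev-q*dbl (q↑ k) ⟩
    0ₛ                                     ∎
    where
    open ℕS using (_:*_; _:+_; _:=_; con)
    k = n ℕ.* suc (n ℕ.* 2) ℕ.+ n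

r-double : ∀ n → r (n ℕ.* 2) ≈ dbl (dbl (r n))
r-double n = begin
  q↑ sq (n ℕ.* 2)         ≡⟨ cong q↑_ (ℕS.solve 1 (λ n → n :* con 2 :* (n :* con 2) := n :* n :* con 2 :* con 2) refl n) ⟩
  q↑ (sq n ℕ.* 2 ℕ.* 2)   ≈⟨ dbl-qᵏ (sq n ℕ.* 2) ⟨
  dbl (q↑ (sq n ℕ.* 2))   ≈⟨ dbl-cong (dbl-qᵏ (sq n)) ⟨
  dbl (dbl (r n))         ∎
  where open ℕS using (_:*_; _:=_; con)

∑-dbl-dbl : ∀ {t} → Small t → ∑ₛ (λ n → dbl (dbl (t n))) ≈ dbl (dbl (∑ₛ t))
∑-dbl-dbl {t} small = ≈-sym (≈-trans (dbl-cong (∑ₛ-dbl small)) (∑ₛ-dbl λ n → Ord-dbl {f = t n} (small n)))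

φ-dissection : φ ≈ dbl (dbl φ) +ₛ (oddSquares +ₛ oddSquares)
φ-dissection = begin
  ∑ₛ r +ₛ ∑ₛ (λ n → r (suc n))
    ≈⟨ +ₛ-cong (∑ₛ-even-odd r-small) (∑ₛ-even-odd r-suc-small) ⟩
  ∑ₛ (λ n → r (n ℕ.* 2)) +ₛ oddSquares +ₛ (oddSquares +ₛ ∑ₛ (λ n → r (suc n ℕ.* 2)))
    ≈⟨ +ₛ-cong (+ₛ-congʳ (≈-trans (∑ₛ-cong r-double) (∑-dbl-dbl r-small)))
         (+ₛ-congˡ (≈-trans (∑ₛ-cong λ n → r-double (suc n)) (∑-dbl-dbl r-suc-small))) ⟩
  dbl (dbl (∑ₛ r)) +ₛ oddSquares +ₛ (oddSquares +ₛ dbl (dbl (∑ₛ (λ n → r (suc n)))))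
    ≈⟨ RS.solve 3 (λ x o y → x :+ o :+ (o :+ y) := x :+ y :+ (o :+ o)) ≈-refl _ oddSquares _ ⟩
  dbl (dbl (∑ₛ r)) +ₛ dbl (dbl (∑ₛ (λ n → r (suc n)))) +ₛ (oddSquares +ₛ oddSquares)
    ≈⟨ +ₛ-congʳ (≈-trans (dbl-cong (dbl-+ _ _)) (dbl-+ _ _)) ⟨
  dbl (dbl φ) +ₛ (oddSquares +ₛ oddSquares) ∎
  where open RS using (_:+_; _:=_)

-- From (2n + 1)² = 1 + 2 · 2n(n + 1), this is ∑_{n ≥ 0} q^{2n(n+1)}, so that φ(q) = φ(q⁴) + 2q
-- σ(q²).
σ : PowerSeries
σ = od oddSquares

a-form : a ≈ dbl (dbl a) +ₛ q *ₛ dbl (σ +ₛ σ)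
a-form = ≈-trans φ-dissection (+ₛ-congˡ (begin
  oddSquares +ₛ oddSquares       ≈⟨ +ₛ-cong (odd-form ev-oddSquares) (odd-form ev-oddSquares) ⟩
  q *ₛ dbl σ +ₛ q *ₛ dbl σ       ≈⟨ *ₛ-distribˡ q (dbl σ) (dbl σ) ⟨
  q *ₛ (dbl σ +ₛ dbl σ)          ≈⟨ *ₛ-congˡ (dbl-+ σ σ) ⟨
  q *ₛ dbl (σ +ₛ σ)              ∎))

ev-a : ev a ≈ dbl a
ev-a = begin
  ev a                                              ≈⟨ ≈-trans (ev-cong a-form) (ev-+ _ _) ⟩
  ev (dbl (dbl a)) +ₛ ev (q *ₛ dbl (σ +ₛ σ))        ≈⟨ +ₛ-cong (ev-dbl (dbl a)) (ev-q*dbl (σ +ₛ σ)) ⟩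
  dbl a +ₛ 0ₛ                                       ≈⟨ +ₛ-identityʳ (dbl a) ⟩
  dbl a                                             ∎

od-a : od a ≈ σ +ₛ σ
od-a = begin
  od a                                              ≈⟨ od-cong a-form ⟩
  od (dbl (dbl a) +ₛ q *ₛ dbl (σ +ₛ σ))             ≈⟨ ptw (λ _ → refl) ⟩
  od (dbl (dbl a)) +ₛ od (q *ₛ dbl (σ +ₛ σ))        ≈⟨ +ₛ-cong (od-dbl (dbl a)) (od-q*dbl (σ +ₛ σ)) ⟩
  0ₛ +ₛ (σ +ₛ σ)                                    ≈⟨ +ₛ-identityˡ (σ +ₛ σ) ⟩
  σ +ₛ σ                                            ∎

-- Applied to f = ev (φ²) - φ², where φ(q) φ(-q) = φ(-q²)² gives f(q) = -2 f(q²).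
dilation-fixed : ∀ {f} → f ! 0 ≡ 0ℤ → f ≈ neg (dbl f +ₛ dbl f) → f ≈ 0ₛ
dilation-fixed {f} f0 p = ptw (<-rec (λ n → f ! n ≡ 0ℤ) step)
  where
  step : ∀ n → (∀ {m} → m < n → f ! m ≡ 0ℤ) → f ! n ≡ 0ℤ
  step n ih with parity n
  ... | inj₁ (zero , refl)  = f0
  ... | inj₁ (suc m , refl) = trans (at p (suc m ℕ.* 2)) (cong (λ z → ℤ.- (z ℤ.+ z))
    (trans (at (ev-dbl f) (suc m)) (ih (ℕₚ.m<m*n (suc m) 2 (s≤s (s≤s z≤n))))))
  ... | inj₂ (m , refl)     = trans (at p (suc (m ℕ.* 2))) (cong (λ z → ℤ.- (z ℤ.+ z)) (at (od-dbl f) m))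

+-alt : ∀ f → f +ₛ alt f ≈ dbl (ev f) +ₛ dbl (ev f)
+-alt f = ev-od-ext
  (≈-trans (ev-+ f (alt f)) (≈-trans (+ₛ-congˡ (ev-alt f)) (≈-sym (≈-trans (ev-+ _ _) (+ₛ-cong (ev-dbl (ev f)) (ev-dbl (ev f)))))))
  (ptw λ n → trans (cong (λ z → od f ! n ℤ.+ z) (at (od-alt f) n)) (trans (ℤₚ.+-inverseʳ (od f ! n))
    (sym (cong₂ ℤ._+_ (at (od-dbl (ev f)) n) (at (od-dbl (ev f)) n)))))

-- In coefficients this is r₂(2n) = r₂(n) for sums of two squares. With x = φ(q²) and z the odd part
-- of φ, the even part of φ² is x² + q z². That of φ(q) φ(-q) is x² - q z² and, by `a*b`, equals
-- φ(-q)². Adding the two eliminates z.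
ev-a² : ev (a *ₛ a) ≈ a *ₛ a
ev-a² = begin
  ev (a *ₛ a)               ≈⟨ RS.solve 2 (λ x y → x := (x :- y) :+ y) ≈-refl (ev (a *ₛ a)) (a *ₛ a) ⟩
  D +ₛ a *ₛ a               ≈⟨ +ₛ-congʳ (dilation-fixed {D} refl D-eq) ⟩
  0ₛ +ₛ a *ₛ a              ≈⟨ +ₛ-identityˡ _ ⟩
  a *ₛ a                    ∎
  where
  open RS using (_:*_; _:+_; _:-_; :-_; _:=_)
  D = ev (a *ₛ a) -ₛ a *ₛ a
  x = dbl a

  ev-a*a : ev (a *ₛ a) ≈ x *ₛ x +ₛ q *ₛ (od a *ₛ od a)
  ev-a*a = ≈-trans (ev-* a a) (+ₛ-congʳ (*ₛ-cong ev-a ev-a))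

  b² : b *ₛ b ≈ x *ₛ x -ₛ q *ₛ (od a *ₛ od a)
  b² = begin
    b *ₛ b                                     ≈⟨ ev-dbl _ ⟨
    ev (dbl (b *ₛ b))                          ≈⟨ ev-cong (≈-trans (dbl-* b b) (≈-sym a*b)) ⟩
    ev (a *ₛ b)                                ≈⟨ ev-* a b ⟩
    ev a *ₛ ev b +ₛ q *ₛ (od a *ₛ od b)        ≈⟨ +ₛ-cong (*ₛ-cong ev-a (≈-trans (ev-alt a) ev-a)) (*ₛ-congˡ (*ₛ-congˡ (od-alt a))) ⟩
    x *ₛ x +ₛ q *ₛ (od a *ₛ neg (od a))        ≈⟨ RS.solve 3 (λ x q z → x :* x :+ q :* (z :* :- z) := x :* x :- q :* (z :* z)) ≈-refl x q (od a) ⟩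
    x *ₛ x -ₛ q *ₛ (od a *ₛ od a)              ∎

  a²+b² : a *ₛ a +ₛ b *ₛ b ≈ dbl (ev (a *ₛ a)) +ₛ dbl (ev (a *ₛ a))
  a²+b² = ≈-trans (+ₛ-congˡ (≈-sym (alt-* a a))) (+-alt (a *ₛ a))

  D-eq : D ≈ neg (dbl D +ₛ dbl D)
  D-eq = begin
    ev (a *ₛ a) -ₛ a *ₛ a
      ≈⟨ +ₛ-congʳ (≈-trans ev-a*a (≈-trans
           (RS.solve 3 (λ x q z → x :* x :+ q :* (z :* z) := x :* x :+ x :* x :- (x :* x :- q :* (z :* z))) ≈-refl x q (od a))
           (+ₛ-congˡ (neg-cong (≈-sym b²))))) ⟩
    x *ₛ x +ₛ x *ₛ x -ₛ b *ₛ b -ₛ a *ₛ a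
      ≈⟨ RS.solve 3 (λ x b a → x :+ x :- b :- a := x :+ x :- (a :+ b)) ≈-refl (x *ₛ x) (b *ₛ b) (a *ₛ a) ⟩
    x *ₛ x +ₛ x *ₛ x -ₛ (a *ₛ a +ₛ b *ₛ b)
      ≈⟨ +ₛ-cong (+ₛ-cong (≈-sym (dbl-* a a)) (≈-sym (dbl-* a a))) (neg-cong a²+b²) ⟩
    dbl (a *ₛ a) +ₛ dbl (a *ₛ a) -ₛ (dbl (ev (a *ₛ a)) +ₛ dbl (ev (a *ₛ a)))
      ≈⟨ RS.solve 2 (λ x y → x :+ x :- (y :+ y) := :- ((y :- x) :+ (y :- x))) ≈-refl (dbl (a *ₛ a)) (dbl (ev (a *ₛ a))) ⟩
    neg ((dbl (ev (a *ₛ a)) -ₛ dbl (a *ₛ a)) +ₛ (dbl (ev (a *ₛ a)) -ₛ dbl (a *ₛ a)))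
      ≈⟨ neg-cong (+ₛ-cong dbl-D dbl-D) ⟨
    neg (dbl D +ₛ dbl D) ∎
    where
    dbl-D : dbl D ≈ dbl (ev (a *ₛ a)) -ₛ dbl (a *ₛ a)
    dbl-D = ≈-trans (dbl-+ _ _) (+ₛ-congˡ (dbl-neg _))

-- The functions y, V and Z

a₁ A : PowerSeries
a₁ = dbl a
A  = dbl a₁

a₁-inv : a₁ *ₛ inv a₁ ≈ 1ₛ
a₁-inv = *-inv a₁ refl

-- `cy` is the odd part of φ divided by φ(q²). An odd series in the form q c(q²) has the visibly
-- even square X(q²) with X = q c²; this is how V arises from y.
cy y V : PowerSeries
cy = (σ +ₛ σ) *ₛ inv a₁
y  = q *ₛ dbl cy
V  = q *ₛ (cy *ₛ cy)

a₁*cy : a₁ *ₛ cy ≈ σ +ₛ σ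
a₁*cy = ≈-trans (RS.solve 3 (λ a s i → a :* (s :* i) := a :* i :* s) ≈-refl a₁ (σ +ₛ σ) (inv a₁))
  (≈-trans (*ₛ-congʳ a₁-inv) (*ₛ-identityˡ _))
  where open RS using (_:*_; _:=_)

a-y : a ≈ A *ₛ (1ₛ +ₛ y)
a-y = begin
  a                                   ≈⟨ a-form ⟩
  A +ₛ q *ₛ dbl (σ +ₛ σ)              ≈⟨ +ₛ-congˡ (*ₛ-congˡ (≈-trans (dbl-cong (≈-sym a₁*cy)) (dbl-* a₁ cy))) ⟩
  A +ₛ q *ₛ (A *ₛ dbl cy)             ≈⟨ RS.solve 3 (λ a q c → a :+ q :* (a :* c) := a :* (con 1ℤ :+ q :* c)) ≈-refl A q (dbl cy) ⟩
  A *ₛ (1ₛ +ₛ y)                      ∎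
  where open RS using (_:*_; _:+_; _:=_; con)

b-y : b ≈ A *ₛ (1ₛ -ₛ y)
b-y = begin
  alt a                               ≈⟨ alt-cong a-y ⟩
  alt (A *ₛ (1ₛ +ₛ y))                ≈⟨ alt-* A (1ₛ +ₛ y) ⟩
  alt A *ₛ alt (1ₛ +ₛ y)              ≈⟨ *ₛ-cong (alt-dbl a₁) (≈-trans (alt-+ 1ₛ y) (+ₛ-cong alt-1 (alt-q*dbl cy))) ⟩
  A *ₛ (1ₛ -ₛ y)                      ∎

odd-square : ∀ c → (q *ₛ dbl c) *ₛ (q *ₛ dbl c) ≈ dbl (q *ₛ (c *ₛ c))
odd-square c = begin
  (q *ₛ dbl c) *ₛ (q *ₛ dbl c)   ≈⟨ RS.solve 2 (λ q c → q :* c :* (q :* c) := q :* q :* (c :* c)) ≈-refl q (dbl c) ⟩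
  q *ₛ q *ₛ (dbl c *ₛ dbl c)     ≈⟨ *ₛ-cong (≈-trans (qᵏ*qˡ refl) (≈-sym (dbl-qᵏ 1))) (≈-sym (dbl-* c c)) ⟩
  dbl q *ₛ dbl (c *ₛ c)          ≈⟨ dbl-* q (c *ₛ c) ⟨
  dbl (q *ₛ (c *ₛ c))            ∎
  where open RS using (_:*_; _:=_)

y² : y *ₛ y ≈ dbl V
y² = odd-square cy

-- φ² is its own even part x² + q z², where x = φ(q²) and z = x `cy`.
a²-V : a *ₛ a ≈ dbl (a *ₛ a) *ₛ (1ₛ +ₛ V)
a²-V = begin
  a *ₛ a
    ≈⟨ ev-a² ⟨
  ev (a *ₛ a)
    ≈⟨ ≈-trans (ev-* a a) (+ₛ-cong (*ₛ-cong ev-a ev-a)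
         (*ₛ-congˡ (*ₛ-cong (≈-trans od-a (≈-sym a₁*cy)) (≈-trans od-a (≈-sym a₁*cy))))) ⟩
  a₁ *ₛ a₁ +ₛ q *ₛ (a₁ *ₛ cy *ₛ (a₁ *ₛ cy))
    ≈⟨ RS.solve 3 (λ a q c → a :* a :+ q :* (a :* c :* (a :* c)) := a :* a :* (con 1ℤ :+ q :* (c :* c))) ≈-refl a₁ q cy ⟩
  a₁ *ₛ a₁ *ₛ (1ₛ +ₛ V)
    ≈⟨ *ₛ-congʳ (dbl-* a a) ⟨
  dbl (a *ₛ a) *ₛ (1ₛ +ₛ V) ∎
  where open RS using (_:*_; _:+_; _:=_; con)

ev-1 : ev 1ₛ ≈ 1ₛ
ev-1 = ptw λ { zero → refl ; (suc _) → refl }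

-- Taking even parts in φ² = φ(q²)² (1 + V) reproduces φ² on the left and gives φ² (1 + `ev V`) on
-- the right.
ev-V : ev V ≈ 0ₛ
ev-V = begin
  ev V                      ≈⟨ RS.solve 1 (λ x → x := (con 1ℤ :+ x) :- con 1ℤ) ≈-refl (ev V) ⟩
  1ₛ +ₛ ev V -ₛ 1ₛ          ≈⟨ +ₛ-congʳ ev-1+V ⟩
  1ₛ -ₛ 1ₛ                  ≈⟨ RS.solve 0 (con 1ℤ :- con 1ℤ := con 0ℤ) ≈-refl ⟩
  0ₛ                        ∎
  where
  open RS using (_:+_; _:-_; _:=_; con)
  ev-1+V : 1ₛ +ₛ ev V ≈ 1ₛ
  ev-1+V = *ₛ-cancelˡ (a *ₛ a) refl (begin
    a *ₛ a *ₛ (1ₛ +ₛ ev V)               ≈⟨ *ₛ-congˡ (≈-trans (ev-+ 1ₛ V) (+ₛ-congʳ ev-1)) ⟨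
    a *ₛ a *ₛ ev (1ₛ +ₛ V)               ≈⟨ ev-dbl-* (a *ₛ a) (1ₛ +ₛ V) ⟨
    ev (dbl (a *ₛ a) *ₛ (1ₛ +ₛ V))       ≈⟨ ev-cong a²-V ⟨
    ev (a *ₛ a)                          ≈⟨ ev-a² ⟩
    a *ₛ a                               ≈⟨ *ₛ-identityʳ _ ⟨
    a *ₛ a *ₛ 1ₛ                         ∎)

-- Z is formed from V as V is from y. That it equals 1 - φ(-q)⁴ / φ(q)⁴ is the content of `b⁴`.
cV Z : PowerSeries
cV = od V
Z  = q *ₛ (cV *ₛ cV)

V-odd : V ≈ q *ₛ dbl cV
V-odd = odd-form ev-V

V² : V *ₛ V ≈ dbl Z
V² = ≈-trans (*ₛ-cong V-odd V-odd) (odd-square cV)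

-- After q → q² the left side is φ(-q²)⁴ = φ(q)² φ(-q)² = φ(q²)⁴ (1 + V)(1 - V), and 1 - V² = 1 -
-- Z(q²).
b⁴ : b *ₛ b *ₛ (b *ₛ b) ≈ a *ₛ a *ₛ (a *ₛ a) *ₛ (1ₛ -ₛ Z)
b⁴ = begin
  b *ₛ b *ₛ (b *ₛ b)                             ≈⟨ ev-dbl _ ⟨
  ev (dbl (b *ₛ b *ₛ (b *ₛ b)))                  ≈⟨ ev-cong doubled ⟩
  ev (dbl (a *ₛ a *ₛ (a *ₛ a) *ₛ (1ₛ -ₛ Z)))     ≈⟨ ev-dbl _ ⟩
  a *ₛ a *ₛ (a *ₛ a) *ₛ (1ₛ -ₛ Z)                ∎
  where
  open RS using (_:*_; _:+_; _:-_; _:=_; con)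

  b²-V : b *ₛ b ≈ dbl (a *ₛ a) *ₛ (1ₛ -ₛ V)
  b²-V = begin
    b *ₛ b                                    ≈⟨ alt-* a a ⟨
    alt (a *ₛ a)                              ≈⟨ ≈-trans (alt-cong a²-V) (alt-* _ _) ⟩
    alt (dbl (a *ₛ a)) *ₛ alt (1ₛ +ₛ V)       ≈⟨ *ₛ-cong (alt-dbl _) (≈-trans (alt-+ 1ₛ V) (+ₛ-cong alt-1
                                                   (≈-trans (alt-cong V-odd) (≈-trans (alt-q*dbl cV) (neg-cong (≈-sym V-odd)))))) ⟩
    dbl (a *ₛ a) *ₛ (1ₛ -ₛ V)                 ∎

  doubled : dbl (b *ₛ b *ₛ (b *ₛ b)) ≈ dbl (a *ₛ a *ₛ (a *ₛ a) *ₛ (1ₛ -ₛ Z))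
  doubled = begin
    dbl (b *ₛ b *ₛ (b *ₛ b))
      ≈⟨ ≈-trans (dbl-* _ _) (*ₛ-cong (dbl-* b b) (dbl-* b b)) ⟩
    dbl b *ₛ dbl b *ₛ (dbl b *ₛ dbl b)
      ≈⟨ *ₛ-cong a*b a*b ⟨
    a *ₛ b *ₛ (a *ₛ b)
      ≈⟨ RS.solve 2 (λ a b → a :* b :* (a :* b) := a :* a :* (b :* b)) ≈-refl a b ⟩
    a *ₛ a *ₛ (b *ₛ b)
      ≈⟨ *ₛ-cong a²-V b²-V ⟩
    d *ₛ (1ₛ +ₛ V) *ₛ (d *ₛ (1ₛ -ₛ V))
      ≈⟨ RS.solve 2 (λ d v → d :* (con 1ℤ :+ v) :* (d :* (con 1ℤ :- v)) := d :* d :* (con 1ℤ :- v :* v)) ≈-refl d V ⟩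
    d *ₛ d *ₛ (1ₛ -ₛ V *ₛ V)
      ≈⟨ *ₛ-cong (≈-sym (dbl-* _ _)) (≈-trans (+ₛ-congˡ (neg-cong V²))
           (≈-sym (≈-trans (dbl-+ _ _) (+ₛ-cong dbl-1 (dbl-neg Z))))) ⟩
    dbl (a *ₛ a *ₛ (a *ₛ a)) *ₛ dbl (1ₛ -ₛ Z)
      ≈⟨ dbl-* _ _ ⟨
    dbl (a *ₛ a *ₛ (a *ₛ a) *ₛ (1ₛ -ₛ Z)) ∎
    where d = dbl (a *ₛ a)

-- Denominators have to be even to pass through `ev`. So 1/(1 - y²) becomes 1/(1 - V), which is
-- rewritten as (1 + V)/(1 - V²) before it becomes 1/(1 - Z).
w w′ w″ W : PowerSeries
w  = inv (1ₛ -ₛ y *ₛ y)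
w′ = inv (1ₛ -ₛ V)
w″ = inv (1ₛ -ₛ V *ₛ V)
W  = inv (1ₛ -ₛ Z)

1+y 1-y : PowerSeries
1+y = 1ₛ +ₛ y
1-y = 1ₛ -ₛ y

1-y² : 1+y *ₛ 1-y *ₛ w ≈ 1ₛ
1-y² = ≈-trans
  (*ₛ-congʳ (RS.solve 1 (λ y → (con 1ℤ :+ y) :* (con 1ℤ :- y) := con 1ℤ :- y :* y) ≈-refl y))
  (*-inv (1ₛ -ₛ y *ₛ y) refl)
  where open RS using (_:*_; _:+_; _:-_; _:=_; con)

-- φ(-q)⁴ = φ(q)⁴ (1 - Z) divided by φ(q⁴)⁴.
modular : 1-y *ₛ 1-y *ₛ (1-y *ₛ 1-y) ≈ 1+y *ₛ 1+y *ₛ (1+y *ₛ 1+y) *ₛ (1ₛ -ₛ Z)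
modular = *ₛ-cancelˡ (A *ₛ A *ₛ (A *ₛ A)) refl (begin
  A *ₛ A *ₛ (A *ₛ A) *ₛ (1-y *ₛ 1-y *ₛ (1-y *ₛ 1-y))
    ≈⟨ fourth 1-y ⟩
  A *ₛ 1-y *ₛ (A *ₛ 1-y) *ₛ (A *ₛ 1-y *ₛ (A *ₛ 1-y))
    ≈⟨ *ₛ-cong (*ₛ-cong b-y b-y) (*ₛ-cong b-y b-y) ⟨
  b *ₛ b *ₛ (b *ₛ b)
    ≈⟨ b⁴ ⟩
  a *ₛ a *ₛ (a *ₛ a) *ₛ (1ₛ -ₛ Z)
    ≈⟨ *ₛ-congʳ (*ₛ-cong (*ₛ-cong a-y a-y) (*ₛ-cong a-y a-y)) ⟩
  A *ₛ 1+y *ₛ (A *ₛ 1+y) *ₛ (A *ₛ 1+y *ₛ (A *ₛ 1+y)) *ₛ (1ₛ -ₛ Z)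
    ≈⟨ *ₛ-congʳ (fourth 1+y) ⟨
  A *ₛ A *ₛ (A *ₛ A) *ₛ (1+y *ₛ 1+y *ₛ (1+y *ₛ 1+y)) *ₛ (1ₛ -ₛ Z)
    ≈⟨ *ₛ-assoc _ _ _ ⟩
  A *ₛ A *ₛ (A *ₛ A) *ₛ (1+y *ₛ 1+y *ₛ (1+y *ₛ 1+y) *ₛ (1ₛ -ₛ Z)) ∎)
  where
  open RS using (_:*_; _:=_)
  fourth : ∀ x → A *ₛ A *ₛ (A *ₛ A) *ₛ (x *ₛ x *ₛ (x *ₛ x)) ≈ A *ₛ x *ₛ (A *ₛ x) *ₛ (A *ₛ x *ₛ (A *ₛ x))
  fourth x = RS.solve 2 (λ a x → a :* a :* (a :* a) :* (x :* x :* (x :* x)) := a :* x :* (a :* x) :* (a :* x :* (a :* x))) ≈-refl A x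

private
  1-y²⁴ : 1+y *ₛ 1-y *ₛ w *ₛ (1+y *ₛ 1-y *ₛ w) *ₛ (1+y *ₛ 1-y *ₛ w *ₛ (1+y *ₛ 1-y *ₛ w)) ≈ 1ₛ
  1-y²⁴ = ≈-trans (*ₛ-cong (*ₛ-cong 1-y² 1-y²) (*ₛ-cong 1-y² 1-y²))
    (RS.solve 0 (con 1ℤ :* con 1ℤ :* (con 1ℤ :* con 1ℤ) := con 1ℤ) ≈-refl)
    where open RS using (_:*_; _:=_; con)

-- This is (1 + y²) / (1 + y)⁴ with 1/(1 + y)⁴ rewritten as (1 - y)⁴ / (1 - y²)⁴, because only `w`
-- is available as a denominator.
κ : PowerSeries
κ = (1ₛ +ₛ y *ₛ y) *ₛ (1-y *ₛ 1-y *ₛ (1-y *ₛ 1-y) *ₛ (w *ₛ w *ₛ (w *ₛ w)))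

-- The constant comes from (1 + y)⁴ - (1 - y)⁴ = 8y (1 + y²); it is the gain of each application of
-- `U` to a multiple of φ Z.
Z-y : Z ≈ int (+ 8) *ₛ (y *ₛ κ)
Z-y = begin
  Z
    ≈⟨ ≈-trans (≈-sym (*ₛ-identityʳ Z)) (*ₛ-congˡ (≈-sym 1-y²⁴)) ⟩
  Z *ₛ (p *ₛ m *ₛ w *ₛ (p *ₛ m *ₛ w) *ₛ (p *ₛ m *ₛ w *ₛ (p *ₛ m *ₛ w)))
    ≈⟨ RS.solve 4 (λ z p m w → z :* (p :* m :* w :* (p :* m :* w) :* (p :* m :* w :* (p :* m :* w))) :=
         (p :* p :* (p :* p) :- p :* p :* (p :* p) :* (con 1ℤ :- z)) :* (m :* m :* (m :* m) :* (w :* w :* (w :* w))))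
         ≈-refl Z p m w ⟩
  (p *ₛ p *ₛ (p *ₛ p) -ₛ p *ₛ p *ₛ (p *ₛ p) *ₛ (1ₛ -ₛ Z)) *ₛ (m *ₛ m *ₛ (m *ₛ m) *ₛ (w *ₛ w *ₛ (w *ₛ w)))
    ≈⟨ *ₛ-congʳ (+ₛ-congˡ (neg-cong modular)) ⟨
  (p *ₛ p *ₛ (p *ₛ p) -ₛ m *ₛ m *ₛ (m *ₛ m)) *ₛ (m *ₛ m *ₛ (m *ₛ m) *ₛ (w *ₛ w *ₛ (w *ₛ w)))
    ≈⟨ *ₛ-congʳ (RS.solve 1 (λ y → let p = con 1ℤ :+ y ; m = con 1ℤ :- y in
         p :* p :* (p :* p) :- m :* m :* (m :* m) := con (+ 8) :* y :* (con 1ℤ :+ y :* y)) ≈-refl y) ⟩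
  int (+ 8) *ₛ y *ₛ (1ₛ +ₛ y *ₛ y) *ₛ (m *ₛ m *ₛ (m *ₛ m) *ₛ (w *ₛ w *ₛ (w *ₛ w)))
    ≈⟨ RS.solve 3 (λ y u x → con (+ 8) :* y :* u :* x := con (+ 8) :* (y :* (u :* x))) ≈-refl y (1ₛ +ₛ y *ₛ y) _ ⟩
  int (+ 8) *ₛ (y *ₛ κ) ∎
  where
  open RS using (_:*_; _:+_; _:-_; _:=_; con)
  p = 1+y
  m = 1-y

-- 1/(1 - Z) is (1 + y)⁴ / (1 - y)⁴, and expanding by (1 + y)⁴ leaves the even denominator (1 -
-- y²)⁴.
W-y : W ≈ 1+y *ₛ 1+y *ₛ (1+y *ₛ 1+y) *ₛ (1+y *ₛ 1+y *ₛ (1+y *ₛ 1+y)) *ₛ (w *ₛ w *ₛ (w *ₛ w))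
W-y = *ₛ-cancelˡ (1ₛ -ₛ Z) refl (begin
  (1ₛ -ₛ Z) *ₛ W
    ≈⟨ *-inv (1ₛ -ₛ Z) refl ⟩
  1ₛ
    ≈⟨ 1-y²⁴ ⟨
  p *ₛ m *ₛ w *ₛ (p *ₛ m *ₛ w) *ₛ (p *ₛ m *ₛ w *ₛ (p *ₛ m *ₛ w))
    ≈⟨ RS.solve 3 (λ p m w → p :* m :* w :* (p :* m :* w) :* (p :* m :* w :* (p :* m :* w)) :=
         m :* m :* (m :* m) :* (p :* p :* (p :* p) :* (w :* w :* (w :* w)))) ≈-refl p m w ⟩
  m *ₛ m *ₛ (m *ₛ m) *ₛ (p *ₛ p *ₛ (p *ₛ p) *ₛ (w *ₛ w *ₛ (w *ₛ w)))
    ≈⟨ *ₛ-congʳ modular ⟩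
  p *ₛ p *ₛ (p *ₛ p) *ₛ (1ₛ -ₛ Z) *ₛ (p *ₛ p *ₛ (p *ₛ p) *ₛ (w *ₛ w *ₛ (w *ₛ w)))
    ≈⟨ RS.solve 3 (λ p z x → p :* z :* (p :* x) := z :* (p :* p :* x)) ≈-refl (p *ₛ p *ₛ (p *ₛ p)) (1ₛ -ₛ Z) (w *ₛ w *ₛ (w *ₛ w)) ⟩
  (1ₛ -ₛ Z) *ₛ (p *ₛ p *ₛ (p *ₛ p) *ₛ (p *ₛ p *ₛ (p *ₛ p)) *ₛ (w *ₛ w *ₛ (w *ₛ w))) ∎)
  where
  open RS using (_:*_; _:=_)
  p = 1+y
  m = 1-y

-- Contraction of U₄

infixl 6 _⟨+⟩_
infixl 7 _⟨*⟩_

-- The ring ℤ[x, w].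
data Gen (x w : PowerSeries) : PowerSeries → Set where
  ⟨1⟩   : Gen x w 1ₛ
  ⟨x⟩   : Gen x w x
  ⟨w⟩   : Gen x w w
  _⟨+⟩_ : ∀ {f g} → Gen x w f → Gen x w g → Gen x w (f +ₛ g)
  _⟨*⟩_ : ∀ {f g} → Gen x w f → Gen x w g → Gen x w (f *ₛ g)
  ⟨-⟩_  : ∀ {f} → Gen x w f → Gen x w (neg f)
  ⟨≈⟩   : ∀ {f g} → f ≈ g → Gen x w f → Gen x w g

Gen-⊆ : ∀ {x w x′ w′} → Gen x′ w′ x → Gen x′ w′ w → ∀ {f} → Gen x w f → Gen x′ w′ f
Gen-⊆ x∈ w∈ ⟨1⟩       = ⟨1⟩
Gen-⊆ x∈ w∈ ⟨x⟩       = x∈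
Gen-⊆ x∈ w∈ ⟨w⟩       = w∈
Gen-⊆ x∈ w∈ (f ⟨+⟩ g) = Gen-⊆ x∈ w∈ f ⟨+⟩ Gen-⊆ x∈ w∈ g
Gen-⊆ x∈ w∈ (f ⟨*⟩ g) = Gen-⊆ x∈ w∈ f ⟨*⟩ Gen-⊆ x∈ w∈ g
Gen-⊆ x∈ w∈ (⟨-⟩ f)   = ⟨-⟩ Gen-⊆ x∈ w∈ f
Gen-⊆ x∈ w∈ (⟨≈⟩ p f) = ⟨≈⟩ p (Gen-⊆ x∈ w∈ f)

⟨8⟩ : ∀ {x w} → Gen x w (int (+ 8))
⟨8⟩ = ⟨≈⟩ (RS.solve 0 (let 2′ = con 1ℤ :+ con 1ℤ in 2′ :* 2′ :* 2′ := con (+ 8)) ≈-refl)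
  ((⟨1⟩ ⟨+⟩ ⟨1⟩) ⟨*⟩ (⟨1⟩ ⟨+⟩ ⟨1⟩) ⟨*⟩ (⟨1⟩ ⟨+⟩ ⟨1⟩))
  where open RS using (_:*_; _:+_; _:=_; con)

-- One passage to even parts, for an odd x with x² = X(q²) and an even denominator w = w′(q²). It is
-- used for y and V, then for V and Z.
module Halving (x c w w′ : PowerSeries) (x-odd : x ≈ q *ₛ dbl c) (w-even : w ≈ dbl w′) where

  X : PowerSeries
  X = q *ₛ (c *ₛ c)

  x² : x *ₛ x ≈ dbl X
  x² = ≈-trans (*ₛ-cong x-odd x-odd) (odd-square c)

  ev-x*dbl : ∀ g → ev (x *ₛ dbl g) ≈ 0ₛ
  ev-x*dbl g = ≈-trans (ev-cong (begin
    x *ₛ dbl g             ≈⟨ *ₛ-congʳ x-odd ⟩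
    q *ₛ dbl c *ₛ dbl g    ≈⟨ *ₛ-assoc q (dbl c) (dbl g) ⟩
    q *ₛ (dbl c *ₛ dbl g)  ≈⟨ *ₛ-congˡ (dbl-* c g) ⟨
    q *ₛ dbl (c *ₛ g)      ∎)) (ev-q*dbl (c *ₛ g))

  ev-split : ∀ f g → ev (dbl f +ₛ x *ₛ dbl g) ≈ f
  ev-split f g = begin
    ev (dbl f +ₛ x *ₛ dbl g)         ≈⟨ ev-+ _ _ ⟩
    ev (dbl f) +ₛ ev (x *ₛ dbl g)    ≈⟨ +ₛ-cong (ev-dbl f) (ev-x*dbl g) ⟩
    f +ₛ 0ₛ                          ≈⟨ +ₛ-identityʳ f ⟩
    f                                ∎

  -- Replacing x² by X(q²) and w by w′(q²) brings any expression to degree at most 1 in x; the two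
  -- coefficients are the even part and the cofactor of x, and both stay in the ring of the next
  -- level.
  split : ∀ {f} → Gen x w f →
    ∃[ f₀ ] ∃[ f₁ ] Gen X w′ f₀ × Gen X w′ f₁ × f ≈ dbl f₀ +ₛ x *ₛ dbl f₁
  -- Zero is written `1ₛ -ₛ 1ₛ` because `Gen` has no constructor for it.
  split ⟨1⟩ = 1ₛ , 1ₛ -ₛ 1ₛ , ⟨1⟩ , ⟨1⟩ ⟨+⟩ ⟨-⟩ ⟨1⟩ , ≈-sym (begin
    dbl 1ₛ +ₛ x *ₛ dbl (1ₛ -ₛ 1ₛ)
      ≈⟨ +ₛ-cong dbl-1 (*ₛ-congˡ (≈-trans (dbl-+ _ _) (+ₛ-cong dbl-1 (≈-trans (dbl-neg 1ₛ) (neg-cong dbl-1))))) ⟩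
    1ₛ +ₛ x *ₛ (1ₛ -ₛ 1ₛ)
      ≈⟨ RS.solve 1 (λ x → con 1ℤ :+ x :* (con 1ℤ :- con 1ℤ) := con 1ℤ) ≈-refl x ⟩
    1ₛ ∎)
    where open RS using (_:*_; _:+_; _:-_; _:=_; con)
  split ⟨x⟩ = 1ₛ -ₛ 1ₛ , 1ₛ , ⟨1⟩ ⟨+⟩ ⟨-⟩ ⟨1⟩ , ⟨1⟩ , ≈-sym (begin
    dbl (1ₛ -ₛ 1ₛ) +ₛ x *ₛ dbl 1ₛ
      ≈⟨ +ₛ-cong (≈-trans (dbl-+ _ _) (+ₛ-cong dbl-1 (≈-trans (dbl-neg 1ₛ) (neg-cong dbl-1)))) (*ₛ-congˡ dbl-1) ⟩
    1ₛ -ₛ 1ₛ +ₛ x *ₛ 1ₛ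
      ≈⟨ RS.solve 1 (λ x → con 1ℤ :- con 1ℤ :+ x :* con 1ℤ := x) ≈-refl x ⟩
    x ∎)
    where open RS using (_:*_; _:+_; _:-_; _:=_; con)
  split ⟨w⟩ = w′ , 1ₛ -ₛ 1ₛ , ⟨w⟩ , ⟨1⟩ ⟨+⟩ ⟨-⟩ ⟨1⟩ , ≈-sym (begin
    dbl w′ +ₛ x *ₛ dbl (1ₛ -ₛ 1ₛ)
      ≈⟨ +ₛ-cong (≈-sym w-even) (*ₛ-congˡ (≈-trans (dbl-+ _ _) (+ₛ-cong dbl-1 (≈-trans (dbl-neg 1ₛ) (neg-cong dbl-1))))) ⟩
    w +ₛ x *ₛ (1ₛ -ₛ 1ₛ)
      ≈⟨ RS.solve 2 (λ x w → w :+ x :* (con 1ℤ :- con 1ℤ) := w) ≈-refl x w ⟩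
    w ∎)
    where open RS using (_:*_; _:+_; _:-_; _:=_; con)
  split (f ⟨+⟩ g) with split f | split g
  ... | f₀ , f₁ , f₀∈ , f₁∈ , pf | g₀ , g₁ , g₀∈ , g₁∈ , pg =
    f₀ +ₛ g₀ , f₁ +ₛ g₁ , f₀∈ ⟨+⟩ g₀∈ , f₁∈ ⟨+⟩ g₁∈ , (begin
      _
        ≈⟨ +ₛ-cong pf pg ⟩
      (dbl f₀ +ₛ x *ₛ dbl f₁) +ₛ (dbl g₀ +ₛ x *ₛ dbl g₁)
        ≈⟨ RS.solve 5 (λ a b c d x → (a :+ x :* b) :+ (c :+ x :* d) := (a :+ c) :+ x :* (b :+ d)) ≈-refl (dbl f₀) (dbl f₁) (dbl g₀) (dbl g₁) x ⟩
      (dbl f₀ +ₛ dbl g₀) +ₛ x *ₛ (dbl f₁ +ₛ dbl g₁)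
        ≈⟨ +ₛ-cong (dbl-+ f₀ g₀) (*ₛ-congˡ (dbl-+ f₁ g₁)) ⟨
      dbl (f₀ +ₛ g₀) +ₛ x *ₛ dbl (f₁ +ₛ g₁) ∎)
    where open RS using (_:*_; _:+_; _:=_)
  split (f ⟨*⟩ g) with split f | split g
  ... | f₀ , f₁ , f₀∈ , f₁∈ , pf | g₀ , g₁ , g₀∈ , g₁∈ , pg =
    f₀ *ₛ g₀ +ₛ X *ₛ (f₁ *ₛ g₁) , f₀ *ₛ g₁ +ₛ f₁ *ₛ g₀ ,
    f₀∈ ⟨*⟩ g₀∈ ⟨+⟩ ⟨x⟩ ⟨*⟩ (f₁∈ ⟨*⟩ g₁∈) , f₀∈ ⟨*⟩ g₁∈ ⟨+⟩ f₁∈ ⟨*⟩ g₀∈ , (begin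
      _
        ≈⟨ *ₛ-cong pf pg ⟩
      (dbl f₀ +ₛ x *ₛ dbl f₁) *ₛ (dbl g₀ +ₛ x *ₛ dbl g₁)
        ≈⟨ RS.solve 5 (λ a b c d x → (a :+ x :* b) :* (c :+ x :* d) := (a :* c :+ x :* x :* (b :* d)) :+ x :* (a :* d :+ b :* c)) ≈-refl (dbl f₀) (dbl f₁) (dbl g₀) (dbl g₁) x ⟩
      (dbl f₀ *ₛ dbl g₀ +ₛ x *ₛ x *ₛ (dbl f₁ *ₛ dbl g₁)) +ₛ x *ₛ (dbl f₀ *ₛ dbl g₁ +ₛ dbl f₁ *ₛ dbl g₀)
        ≈⟨ +ₛ-cong
             (≈-trans (dbl-+ _ _) (+ₛ-cong (dbl-* f₀ g₀) (≈-trans (dbl-* X _) (*ₛ-cong (≈-sym x²) (dbl-* f₁ g₁)))))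
             (*ₛ-congˡ (≈-trans (dbl-+ _ _) (+ₛ-cong (dbl-* f₀ g₁) (dbl-* f₁ g₀)))) ⟨
      dbl (f₀ *ₛ g₀ +ₛ X *ₛ (f₁ *ₛ g₁)) +ₛ x *ₛ dbl (f₀ *ₛ g₁ +ₛ f₁ *ₛ g₀) ∎)
    where open RS using (_:*_; _:+_; _:=_)
  split (⟨-⟩ f) with split f
  ... | f₀ , f₁ , f₀∈ , f₁∈ , pf =
    neg f₀ , neg f₁ , ⟨-⟩ f₀∈ , ⟨-⟩ f₁∈ , (begin
      _
        ≈⟨ neg-cong pf ⟩
      neg (dbl f₀ +ₛ x *ₛ dbl f₁)
        ≈⟨ RS.solve 3 (λ a b x → :- (a :+ x :* b) := :- a :+ x :* :- b) ≈-refl (dbl f₀) (dbl f₁) x ⟩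
      neg (dbl f₀) +ₛ x *ₛ neg (dbl f₁)
        ≈⟨ +ₛ-cong (dbl-neg f₀) (*ₛ-congˡ (dbl-neg f₁)) ⟨
      dbl (neg f₀) +ₛ x *ₛ dbl (neg f₁) ∎)
    where open RS using (_:*_; _:+_; :-_; _:=_)
  split (⟨≈⟩ p f) with split f
  ... | f₀ , f₁ , f₀∈ , f₁∈ , pf = f₀ , f₁ , f₀∈ , f₁∈ , ≈-trans (≈-sym p) pf

  -- The even part of x (f₀ + x f₁) with even f₀ and f₁ comes from x² f₁ alone, so a factor x is
  -- turned into a factor X and is not lost.
  halve : ∀ {f} → Gen x w f → ∃[ g ] Gen X w′ g × (∀ h → ev (dbl h *ₛ (x *ₛ f)) ≈ h *ₛ (X *ₛ g))
  halve {f} f∈ with split f∈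
  ... | f₀ , f₁ , _ , f₁∈ , pf = f₁ , f₁∈ , λ h → begin
    ev (dbl h *ₛ (x *ₛ f))
      ≈⟨ ev-cong (begin
           dbl h *ₛ (x *ₛ f)
             ≈⟨ *ₛ-congˡ (*ₛ-congˡ pf) ⟩
           dbl h *ₛ (x *ₛ (dbl f₀ +ₛ x *ₛ dbl f₁))
             ≈⟨ RS.solve 4 (λ h x a b → h :* (x :* (a :+ x :* b)) := h :* (x :* x :* b) :+ x :* (h :* a)) ≈-refl (dbl h) x (dbl f₀) (dbl f₁) ⟩
           dbl h *ₛ (x *ₛ x *ₛ dbl f₁) +ₛ x *ₛ (dbl h *ₛ dbl f₀)
             ≈⟨ +ₛ-cong (≈-trans (dbl-* h _) (*ₛ-congˡ (≈-trans (dbl-* X f₁) (*ₛ-congʳ (≈-sym x²))))) (*ₛ-congˡ (dbl-* h f₀)) ⟨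
           dbl (h *ₛ (X *ₛ f₁)) +ₛ x *ₛ dbl (h *ₛ f₀) ∎) ⟩
    ev (dbl (h *ₛ (X *ₛ f₁)) +ₛ x *ₛ dbl (h *ₛ f₀))
      ≈⟨ ev-split _ _ ⟩
    h *ₛ (X *ₛ f₁) ∎
    where open RS using (_:*_; _:+_; _:=_)

inv-dbl : ∀ f → f ! 0 ≡ 1ℤ → ∀ {g} → g ≈ dbl f → inv g ≈ dbl (inv f)
inv-dbl f f0 {g} g≈ = *ₛ-cancelˡ g g0 (begin
  g *ₛ inv g               ≈⟨ *-inv g g0 ⟩
  1ₛ                       ≈⟨ dbl-1 ⟨
  dbl 1ₛ                   ≈⟨ dbl-cong (*-inv f f0) ⟨
  dbl (f *ₛ inv f)         ≈⟨ dbl-* f (inv f) ⟩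
  dbl f *ₛ dbl (inv f)     ≈⟨ *ₛ-congʳ g≈ ⟨
  g *ₛ dbl (inv f)         ∎)
  where
  g0 : g ! 0 ≡ 1ℤ
  g0 = trans (at g≈ 0) f0

1-dbl : ∀ {f g} → f ≈ dbl g → 1ₛ -ₛ f ≈ dbl (1ₛ -ₛ g)
1-dbl {f} {g} p = ≈-trans (+ₛ-congˡ (neg-cong p))
  (≈-sym (≈-trans (dbl-+ 1ₛ (neg g)) (+ₛ-cong dbl-1 (dbl-neg g))))

w-even : w ≈ dbl w′
w-even = inv-dbl (1ₛ -ₛ V) refl (1-dbl y²)

w″-even : w″ ≈ dbl W
w″-even = inv-dbl (1ₛ -ₛ Z) refl (1-dbl V²)

w′-w″ : w′ ≈ (1ₛ +ₛ V) *ₛ w″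
w′-w″ = *ₛ-cancelˡ (1ₛ -ₛ V) refl (begin
  (1ₛ -ₛ V) *ₛ w′                     ≈⟨ *-inv (1ₛ -ₛ V) refl ⟩
  1ₛ                                  ≈⟨ *-inv (1ₛ -ₛ V *ₛ V) refl ⟨
  (1ₛ -ₛ V *ₛ V) *ₛ w″                ≈⟨ RS.solve 2 (λ v w → (con 1ℤ :- v :* v) :* w := (con 1ℤ :- v) :* ((con 1ℤ :+ v) :* w)) ≈-refl V w″ ⟩
  (1ₛ -ₛ V) *ₛ ((1ₛ +ₛ V) *ₛ w″)      ∎)
  where open RS using (_:*_; _:+_; _:-_; _:=_; con)

module First  = Halving y cy w w′ ≈-refl w-even
module Second = Halving V cV w″ W V-odd w″-even

U : PowerSeries → PowerSeries
U f = ev (ev f)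

ev-int : ∀ c f → ev (int c *ₛ f) ≈ int c *ₛ ev f
ev-int c f = ptw λ n → trans (int-* c f (n ℕ.* 2)) (sym (int-* c (ev f) n))

U-cong : ∀ {f g} → f ≈ g → U f ≈ U g
U-cong p = ev-cong (ev-cong p)

U-int : ∀ c f → U (int c *ₛ f) ≈ int c *ₛ U f
U-int c f = ≈-trans (ev-cong (ev-int c f)) (ev-int c (ev f))

κ∈ : Gen y w κ
κ∈ = (⟨1⟩ ⟨+⟩ ⟨x⟩ ⟨*⟩ ⟨x⟩) ⟨*⟩ (m ⟨*⟩ m ⟨*⟩ (m ⟨*⟩ m) ⟨*⟩ (⟨w⟩ ⟨*⟩ ⟨w⟩ ⟨*⟩ (⟨w⟩ ⟨*⟩ ⟨w⟩)))
  where
  m : Gen y w 1-y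
  m = ⟨1⟩ ⟨+⟩ ⟨-⟩ ⟨x⟩

Z∈ : Gen y w Z
Z∈ = ⟨≈⟩ (≈-sym Z-y) (⟨8⟩ ⟨*⟩ (⟨x⟩ ⟨*⟩ κ∈))

W∈ : Gen y w W
W∈ = ⟨≈⟩ (≈-sym W-y) (p ⟨*⟩ p ⟨*⟩ (p ⟨*⟩ p) ⟨*⟩ (p ⟨*⟩ p ⟨*⟩ (p ⟨*⟩ p)) ⟨*⟩ (⟨w⟩ ⟨*⟩ ⟨w⟩ ⟨*⟩ (⟨w⟩ ⟨*⟩ ⟨w⟩)))
  where
  p : Gen y w 1+y
  p = ⟨1⟩ ⟨+⟩ ⟨x⟩

U-contracts : ∀ {f} → Gen Z W f → ∃[ g ] Gen Z W g × U (a *ₛ (Z *ₛ f)) ≈ int (+ 8) *ₛ (a *ₛ (Z *ₛ g))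
U-contracts {f} f∈ =
  -- φ Z f = 8 φ(q⁴) y (1 + y) κ f. The two even parts carry φ(q⁴) to φ(q²) and then to φ, and the
  -- factor y to V and then to Z.
  let g , g∈ , pg = First.halve ((⟨1⟩ ⟨+⟩ ⟨x⟩) ⟨*⟩ κ∈ ⟨*⟩ Gen-⊆ Z∈ W∈ f∈)
      -- The second passage needs an even denominator, hence the change from `w′` to `w″`.
      h , h∈ , ph = Second.halve (Gen-⊆ ⟨x⟩ (⟨≈⟩ (≈-sym w′-w″) ((⟨1⟩ ⟨+⟩ ⟨x⟩) ⟨*⟩ ⟨w⟩)) g∈)
  in h , h∈ , (begin
  U (a *ₛ (Z *ₛ f))
    ≈⟨ U-cong (begin
         a *ₛ (Z *ₛ f)
           ≈⟨ *ₛ-cong a-y (*ₛ-congʳ Z-y) ⟩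
         A *ₛ 1+y *ₛ (int (+ 8) *ₛ (y *ₛ κ) *ₛ f)
           ≈⟨ RS.solve 5 (λ a p y k f → a :* p :* (con (+ 8) :* (y :* k) :* f) := con (+ 8) :* (a :* (y :* (p :* k :* f)))) ≈-refl A 1+y y κ f ⟩
         int (+ 8) *ₛ (A *ₛ (y *ₛ (1+y *ₛ κ *ₛ f))) ∎) ⟩
  U (int (+ 8) *ₛ (A *ₛ (y *ₛ (1+y *ₛ κ *ₛ f))))
    ≈⟨ U-int (+ 8) _ ⟩
  int (+ 8) *ₛ U (A *ₛ (y *ₛ (1+y *ₛ κ *ₛ f)))
    ≈⟨ *ₛ-congˡ (≈-trans (ev-cong (pg a₁)) (ph a)) ⟩
  int (+ 8) *ₛ (a *ₛ (Z *ₛ h)) ∎)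
  where open RS using (_:*_; _:=_; con)

U-a : U a ≈ a
U-a = ≈-trans (ev-cong ev-a) (ev-dbl a)

-- The series 2 ∑ v₀(4n) qⁿ - 1.
F : PowerSeries
F = ev v-even

-- Taking even parts turns φ(-q²) into φ(-q) but leaves φ² as it is.
F*b : F *ₛ b ≈ a *ₛ a
F*b = begin
  ev v-even *ₛ b              ≈⟨ *ₛ-comm _ _ ⟩
  b *ₛ ev v-even              ≈⟨ ev-dbl-* b v-even ⟨
  ev (dbl b *ₛ v-even)        ≈⟨ ev-cong (≈-trans (*ₛ-comm _ _) v-even*dbl-b) ⟩
  ev (a *ₛ a)                 ≈⟨ ev-a² ⟩
  a *ₛ a                      ∎

F-y : F ≈ A *ₛ (1+y *ₛ 1+y *ₛ 1+y *ₛ w)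
F-y = *ₛ-cancelˡ b refl (begin
  b *ₛ F                                          ≈⟨ *ₛ-comm b F ⟩
  F *ₛ b                                          ≈⟨ F*b ⟩
  a *ₛ a                                          ≈⟨ *ₛ-cong a-y a-y ⟩
  A *ₛ 1+y *ₛ (A *ₛ 1+y)                          ≈⟨ ≈-trans (≈-sym (*ₛ-identityʳ _)) (*ₛ-congˡ (≈-sym 1-y²)) ⟩
  A *ₛ 1+y *ₛ (A *ₛ 1+y) *ₛ (1+y *ₛ 1-y *ₛ w)     ≈⟨ RS.solve 4 (λ a p m w → a :* p :* (a :* p) :* (p :* m :* w) := a :* m :* (a :* (p :* p :* p :* w))) ≈-refl A 1+y 1-y w ⟩
  A *ₛ 1-y *ₛ (A *ₛ (1+y *ₛ 1+y *ₛ 1+y *ₛ w))     ≈⟨ *ₛ-congʳ b-y ⟨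
  b *ₛ (A *ₛ (1+y *ₛ 1+y *ₛ 1+y *ₛ w))            ∎)
  where open RS using (_:*_; _:=_)

dbl-int : ∀ c → dbl (int c) ≈ int c
dbl-int c = ≈-trans (dbl-cong (int≈const c)) (≈-trans
  (ev-od-ext (≈-trans (ev-dbl _) (ptw λ { zero → refl ; (suc _) → refl })) (≈-trans (od-dbl _) (ptw λ _ → refl)))
  (≈-sym (int≈const c)))

-- F = φ(q⁴) (1 + y)³ / (1 - y²). The even part of (1 + y)³ is 1 + 3y²; then (1 + V)(1 + 3V) has the
-- even part 1 + 3V², which gives φ (1 + 3Z) / (1 - Z).
U-F : U F ≈ a +ₛ int (+ 4) *ₛ (a *ₛ (Z *ₛ W))
U-F = begin
  ev (ev F)
    ≈⟨ ev-cong (≈-trans (ev-cong F-split) (First.ev-split _ _)) ⟩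
  ev (a₁ *ₛ w′ *ₛ (1ₛ +ₛ int (+ 3) *ₛ V))
    ≈⟨ ≈-trans (ev-cong V-split) (Second.ev-split _ _) ⟩
  a *ₛ W *ₛ (1ₛ +ₛ int (+ 3) *ₛ Z)
    ≈⟨ RS.solve 3 (λ a w z → a :* w :* (con 1ℤ :+ con (+ 3) :* z) := a :* ((con 1ℤ :- z) :* w) :+ con (+ 4) :* (a :* (z :* w))) ≈-refl a W Z ⟩
  a *ₛ ((1ₛ -ₛ Z) *ₛ W) +ₛ int (+ 4) *ₛ (a *ₛ (Z *ₛ W))
    ≈⟨ +ₛ-congʳ (≈-trans (*ₛ-congˡ (*-inv (1ₛ -ₛ Z) refl)) (*ₛ-identityʳ a)) ⟩
  a +ₛ int (+ 4) *ₛ (a *ₛ (Z *ₛ W)) ∎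
  where
  open RS using (_:*_; _:+_; _:-_; _:=_; con)

  F-split : F ≈ dbl (a₁ *ₛ w′ *ₛ (1ₛ +ₛ int (+ 3) *ₛ V)) +ₛ y *ₛ dbl (a₁ *ₛ w′ *ₛ (int (+ 3) +ₛ V))
  F-split = begin
    F
      ≈⟨ F-y ⟩
    A *ₛ (1+y *ₛ 1+y *ₛ 1+y *ₛ w)
      ≈⟨ RS.solve 3 (λ a y w → let p = con 1ℤ :+ y in a :* (p :* p :* p :* w) :=
           a :* w :* (con 1ℤ :+ con (+ 3) :* (y :* y)) :+ y :* (a :* w :* (con (+ 3) :+ y :* y))) ≈-refl A y w ⟩
    A *ₛ w *ₛ (1ₛ +ₛ int (+ 3) *ₛ (y *ₛ y)) +ₛ y *ₛ (A *ₛ w *ₛ (int (+ 3) +ₛ y *ₛ y))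
      ≈⟨ +ₛ-cong
           (≈-trans (dbl-* _ _) (*ₛ-cong Aw (≈-trans (dbl-+ _ _) (+ₛ-cong dbl-1 (≈-trans (dbl-* _ _) (*ₛ-cong (dbl-int (+ 3)) (≈-sym y²)))))))
           (*ₛ-congˡ (≈-trans (dbl-* _ _) (*ₛ-cong Aw (≈-trans (dbl-+ _ _) (+ₛ-cong (dbl-int (+ 3)) (≈-sym y²)))))) ⟨
    dbl (a₁ *ₛ w′ *ₛ (1ₛ +ₛ int (+ 3) *ₛ V)) +ₛ y *ₛ dbl (a₁ *ₛ w′ *ₛ (int (+ 3) +ₛ V)) ∎
    where
    Aw : dbl (a₁ *ₛ w′) ≈ A *ₛ w
    Aw = ≈-trans (dbl-* _ _) (*ₛ-congˡ (≈-sym w-even))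

  V-split : a₁ *ₛ w′ *ₛ (1ₛ +ₛ int (+ 3) *ₛ V) ≈
    dbl (a *ₛ W *ₛ (1ₛ +ₛ int (+ 3) *ₛ Z)) +ₛ V *ₛ dbl (int (+ 4) *ₛ (a *ₛ W))
  V-split = begin
    a₁ *ₛ w′ *ₛ (1ₛ +ₛ int (+ 3) *ₛ V)
      ≈⟨ *ₛ-congʳ (*ₛ-congˡ w′-w″) ⟩
    a₁ *ₛ ((1ₛ +ₛ V) *ₛ w″) *ₛ (1ₛ +ₛ int (+ 3) *ₛ V)
      ≈⟨ RS.solve 3 (λ a v w → a :* ((con 1ℤ :+ v) :* w) :* (con 1ℤ :+ con (+ 3) :* v) :=
           a :* w :* (con 1ℤ :+ con (+ 3) :* (v :* v)) :+ v :* (con (+ 4) :* (a :* w))) ≈-refl a₁ V w″ ⟩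
    a₁ *ₛ w″ *ₛ (1ₛ +ₛ int (+ 3) *ₛ (V *ₛ V)) +ₛ V *ₛ (int (+ 4) *ₛ (a₁ *ₛ w″))
      ≈⟨ +ₛ-cong
           (≈-trans (dbl-* _ _) (*ₛ-cong aW (≈-trans (dbl-+ _ _) (+ₛ-cong dbl-1 (≈-trans (dbl-* _ _) (*ₛ-cong (dbl-int (+ 3)) (≈-sym V²)))))))
           (*ₛ-congˡ (≈-trans (dbl-* _ _) (*ₛ-cong (dbl-int (+ 4)) aW))) ⟨
    dbl (a *ₛ W *ₛ (1ₛ +ₛ int (+ 3) *ₛ Z)) +ₛ V *ₛ dbl (int (+ 4) *ₛ (a *ₛ W)) ∎
    where
    aW : dbl (a *ₛ W) ≈ a₁ *ₛ w″
    aW = ≈-trans (dbl-* _ _) (*ₛ-congˡ (≈-sym w″-even))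

-- Beyond the 8 of `Z-y` one more factor 2 sits in y: the odd part of φ is 2σ, as n and -n have the
-- same square.
Z-even : ∃[ z ] Z ≈ int (+ 16) *ₛ z
Z-even = y′ *ₛ κ , (begin
  Z                                          ≈⟨ Z-y ⟩
  int (+ 8) *ₛ (y *ₛ κ)                      ≈⟨ *ₛ-congˡ (*ₛ-congʳ y-half) ⟩
  int (+ 8) *ₛ ((y′ +ₛ y′) *ₛ κ)             ≈⟨ RS.solve 2 (λ y k → con (+ 8) :* ((y :+ y) :* k) := con (+ 16) :* (y :* k)) ≈-refl y′ κ ⟩
  int (+ 16) *ₛ (y′ *ₛ κ)                    ∎)
  where
  open RS using (_:*_; _:+_; _:=_; con)
  y′ = q *ₛ dbl (σ *ₛ inv a₁)
  y-half : y ≈ y′ +ₛ y′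
  y-half = begin
    q *ₛ dbl ((σ +ₛ σ) *ₛ inv a₁)             ≈⟨ *ₛ-congˡ (≈-trans (dbl-* _ _) (*ₛ-congʳ (dbl-+ σ σ))) ⟩
    q *ₛ ((dbl σ +ₛ dbl σ) *ₛ dbl (inv a₁))   ≈⟨ RS.solve 3 (λ q s i → q :* ((s :+ s) :* i) := q :* (s :* i) :+ q :* (s :* i)) ≈-refl q (dbl σ) (dbl (inv a₁)) ⟩
    q *ₛ (dbl σ *ₛ dbl (inv a₁)) +ₛ q *ₛ (dbl σ *ₛ dbl (inv a₁)) ≈⟨ +ₛ-cong (*ₛ-congˡ (dbl-* _ _)) (*ₛ-congˡ (dbl-* _ _)) ⟨
    y′ +ₛ y′                                  ∎

≡⇒≈ : ∀ {f g} → f ≡ g → f ≈ g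
≡⇒≈ refl = ≈-refl

int-int-* : ∀ c d f → int c *ₛ (int d *ₛ f) ≈ int (c ℤ.* d) *ₛ f
int-int-* c d f = ptw λ n → trans (int-* c (int d *ₛ f) n) (trans (cong (c ℤ.*_) (int-* d f n))
  (trans (sym (ℤₚ.*-assoc c d (f ! n))) (sym (int-* (c ℤ.* d) f n))))

U^ : ℕ → PowerSeries → PowerSeries
U^ zero    f = f
U^ (suc n) f = U (U^ n f)

-- The 4 is that of `U-F`. Each further application fixes the leading φ and multiplies the remainder
-- by 8.
U^-F : ∀ n → ∃[ g ] Gen Z W g × U^ (suc n) F ≈ a +ₛ int (+ (4 ℕ.* 8 ℕ.^ n)) *ₛ (a *ₛ (Z *ₛ g))
U^-F zero    = W , ⟨w⟩ , U-F
U^-F (suc n) =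
  let g , g∈ , pg = U^-F n
      h , h∈ , ph = U-contracts g∈
  in h , h∈ , (begin
  U (U^ (suc n) F)
    ≈⟨ U-cong pg ⟩
  U (a +ₛ int c *ₛ (a *ₛ (Z *ₛ g)))
    ≈⟨ ptw (λ _ → refl) ⟩
  U a +ₛ U (int c *ₛ (a *ₛ (Z *ₛ g)))
    ≈⟨ +ₛ-cong U-a (≈-trans (U-int c _) (*ₛ-congˡ ph)) ⟩
  a +ₛ int c *ₛ (int (+ 8) *ₛ (a *ₛ (Z *ₛ h)))
    ≈⟨ +ₛ-congˡ (≈-trans (int-int-* c (+ 8) _) (*ₛ-congʳ (≡⇒≈ (cong int exponent)))) ⟩
  a +ₛ int (+ (4 ℕ.* 8 ℕ.^ suc n)) *ₛ (a *ₛ (Z *ₛ h)) ∎)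
  where
  c = + (4 ℕ.* 8 ℕ.^ n)
  exponent : c ℤ.* + 8 ≡ + (4 ℕ.* 8 ℕ.^ suc n)
  exponent = trans (sym (ℤₚ.pos-* (4 ℕ.* 8 ℕ.^ n) 8)) (cong +_
    (ℕS.solve 1 (λ x → ℕS.con 4 ℕS.:* x ℕS.:* ℕS.con 8 ℕS.:= ℕS.con 4 ℕS.:* (ℕS.con 8 ℕS.:* x)) refl (8 ℕ.^ n)))

-- Coefficients and the congruence

U^-! : ∀ n f N → U^ n f ! N ≡ f ! (N ℕ.* 4 ℕ.^ n)
U^-! zero    f N = cong (f !_) (sym (ℕₚ.*-identityʳ N))
U^-! (suc n) f N = trans (U^-! n f (N ℕ.* 2 ℕ.* 2)) (cong (f !_)
  (ℕS.solve 2 (λ N x → N ℕS.:* ℕS.con 2 ℕS.:* ℕS.con 2 ℕS.:* x ℕS.:= N ℕS.:* (ℕS.con 4 ℕS.:* x)) refl N (4 ℕ.^ n)))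

φ-nonsquare : ∀ N → (∀ j → N ≢ sq j) → φ ! N ≡ 0ℤ
φ-nonsquare N nonsquare = cong₂ ℤ._+_
  (∑-0 N λ j _ → qᵏ-other (nonsquare j)) (∑-0 N λ j _ → qᵏ-other (nonsquare (suc j)))

1ₛ-nonzero : ∀ {n} → n ≢ 0 → 1ₛ ! n ≡ 0ℤ
1ₛ-nonzero {zero}  n≢0 = contradiction refl n≢0
1ₛ-nonzero {suc _} n≢0 = refl

-- At the index M = 4ᵏ⁺¹ N the series `F` has the coefficient 2 v₀(4M), and φ contributes nothing at
-- N. What is left, 4 · 8ᵏ · 16 X, is twice 32 · 8ᵏ X, and the 2 cancels.
v₀-nonsquare : ∀ k N → (∀ j → N ≢ sq j) → + (32 * 8 ^ k) ∣ v₀ (N * 4 ^ suc k * 2 * 2)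
v₀-nonsquare k N nonsquare = ℕ∣.divides ℤ.∣ X ∣
  (trans (cong ℤ.∣_∣ (double-cancel (v₀ (M * 2 * 2)) (d ℤ.* X) double))
    (trans (ℤₚ.abs-* d X) (ℕₚ.*-comm ℤ.∣ d ∣ ℤ.∣ X ∣)))
  where
  M = N * 4 ^ suc k
  c = + (4 * 8 ^ k)
  d = + (32 * 8 ^ k)
  g = proj₁ (U^-F k)
  z = proj₁ Z-even
  X = (a *ₛ (z *ₛ g)) ! N

  -- N is nonzero because 0 is a square; thus the constant -1 in `F` does not enter.
  M*2≢0 : M * 2 ≢ 0
  M*2≢0 eq = nonsquare 0 (ℕₚ.m*n≡0⇒m≡0 N (4 ^ suc k) {{ℕₚ.m^n≢0 4 (suc k)}} (ℕₚ.m*n≡0⇒m≡0 M 2 eq))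

  factor : (a *ₛ (Z *ₛ g)) ! N ≡ + 16 ℤ.* X
  factor = trans
    (at (≈-trans (*ₛ-congˡ (*ₛ-congʳ (proj₂ Z-even)))
      (RS.solve 3 (λ a z g → a :* (con (+ 16) :* z :* g) := con (+ 16) :* (a :* (z :* g))) ≈-refl a z g)) N)
    (int-* (+ 16) (a *ₛ (z *ₛ g)) N)
    where open RS using (_:*_; _:=_; con)

  F!M : F ! M ≡ c ℤ.* (+ 16 ℤ.* X)
  F!M = trans (sym (U^-! (suc k) F N)) (trans (at (proj₂ (proj₂ (U^-F k))) N)
    (trans (cong₂ ℤ._+_ (φ-nonsquare N nonsquare) (trans (int-* c (a *ₛ (Z *ₛ g)) N) (cong (c ℤ.*_) factor)))
      (ℤₚ.+-identityˡ (c ℤ.* (+ 16 ℤ.* X)))))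

  double : v₀ (M * 2 * 2) ℤ.+ v₀ (M * 2 * 2) ≡ d ℤ.* X ℤ.+ d ℤ.* X
  double = trans (sym (trans
    (cong (λ x → v₀ (M * 2 * 2) ℤ.+ v₀ (M * 2 * 2) ℤ.- x) (1ₛ-nonzero M*2≢0))
    (ℤₚ.+-identityʳ (v₀ (M * 2 * 2) ℤ.+ v₀ (M * 2 * 2))))) (trans F!M (32·8ᵏ k X))

corollary1p1 : (α p r : ℕ) → 0 < α → Prime p → 3 ≤ p →
    QuadraticNonresidue p r → (n : ℕ) →
    + (2 ^ (3 * α + 2)) ∣ v₀ (2 ^ (2 * α + 2) * (p * n + r))
corollary1p1 (suc k) p r _ _ _ nonresidue n =
  subst (λ m → + (2 ^ (3 * suc k + 2)) ∣ v₀ m) (index-pow N (suc k))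
    (subst (λ m → + m ∣ v₀ (N * 4 ^ suc k * 2 * 2)) (modulus-pow k)
      (v₀-nonsquare k N (nonresidue⇒nonsquare p r n nonresidue)))
  where N = p * n + r
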